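{- Let $\mathsf{TA}=(\mathcal L,\mathcal I,\Gamma,\Pi,\mathcal R,RC)$ be a threshold automaton, and let $\mathit{Locs}\subseteq\mathcal L$ be a set of local states. Let $\sigma$ be a configuration, let $\tau$ be a steady conventional schedule applicable to $\sigma$, and let $\psi$ be one of the following two formulas: $$\bigvee_{\ell\in\mathit{Locs}}\boldsymbol\kappa[\ell]\neq 0,\qquad\text{or}\qquad \bigwedge_{\ell\in\mathit{Locs}}\boldsymbol\kappa[\ell]=0 .$$ If all configurations visited by $\tau$ from $\sigma$ satisfy $\psi$, i.e. $\mathsf{Cfgs}(\sigma,\tau)\models\psi$, then there is a steady schedule $\mathsf{repr}[\psi,\sigma,\tau]$ with the following properties: (a) $\mathsf{repr}[\psi,\sigma,\tau]$ is applicable to $\sigma$, and $\mathsf{repr}[\psi,\sigma,\tau](\sigma)=\tau(\sigma)$; (b) $|\mathsf{repr}[\psi,\sigma,\tau]|\le 6\cdot|\mathcal R|$; (c) $\mathsf{Cfgs}(\sigma,\mathsf{repr}[\psi,\sigma,\tau])\models\psi$; (d) there exist (possibly empty) subschedules $\tau_1,\tau_2,\tau_3$ of $\tau$ such that $\tau_1\cdot\tau_2\cdot\tau_3$ is applicable to $\sigma$, $(\tau_1\cdot\tau_2\cdot\tau_3)(\sigma)=\tau(\sigma)$, and $$\mathsf{repr}[\psi,\sigma,\tau]=\mathsf{srep}[\sigma,\tau_1]\cdot\mathsf{srep}[\tau_1(\sigma),\tau_2]\cdot\mathsf{srep}[(\tau_1\cdot\tau_2)(\sigma),\tau_3].$$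
   Context: **Threshold automata.** A threshold automaton is a tuple $\mathsf{TA}=(\mathcal L,\mathcal I,\Gamma,\Pi,\mathcal R,RC)$: $\mathcal L=\{1,\dots,|\mathcal L|\}$ is a finite set of local states, $\mathcal I\subseteq\mathcal L$ the initial local states; $\Gamma$ and $\Pi$ are finite sets of shared variables and parameters, ranging over $\mathbb N_0$; $RC$ is a linear integer arithmetic formula over $\Pi$, and $\mathbf P_{RC}=\{\mathbf p\in\mathbb N_0^{|\Pi|}:\mathbf p\models RC\}$ is the set of admissible parameter values; $\mathcal R$ is a finite set of rules. A rule is $r=(\mathit{from},\mathit{to},\varphi^{\le},\varphi^{>},\mathbf u)$ with $\mathit{from},\mathit{to}\in\mathcal L$, $\mathbf u\in\mathbb N_0^{|\Gamma|}$, $\varphi^{\le}$ a conjunction of lower guards $x\ge a_0+\sum_{i=1}^{|\Pi|}a_ip_i$, and $\varphi^{>}$ a conjunction of upper guards $x<a_0+\sum_{i=1}^{|\Pi|}a_ip_i$ ($x\in\Gamma$, $a_i\in\mathbb Z$, $p_i\in\Pi$). $\Phi^{\mathrm{rise}}$, $\Phi^{\mathrm{fall}}$ are the sets of lower and upper guards. Standing assumptions: a rule lying on a cycle (of the directed graph on $\mathcal L$ with edges $\mathit{from}\to\mathit{to}$) has $\mathbf u=\mathbf 0$; all cycles are simple, i.e. between any two locations in a cycle there is exactly one node-disjoint directed path (nodes in cycles may have self-loops). **Counter systems.** Fix a function $N:\mathbf P_{RC}\to\mathbb N_0$ (a linear combination of parameters; the number of modeled processes) and $\mathbf p\in\mathbf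 P_{RC}$. A configuration is $\sigma=(\boldsymbol\kappa,\mathbf g,\mathbf p)$ with counters $\sigma.\boldsymbol\kappa\in\mathbb N_0^{|\mathcal L|}$, shared variable values $\sigma.\mathbf g\in\mathbb N_0^{|\Gamma|}$ and parameter values $\sigma.\mathbf p=\mathbf p$. It is initial if $\sigma.\mathbf g=\mathbf 0$, $\sum_{i\in\mathcal I}\sigma.\boldsymbol\kappa[i]=N(\mathbf p)$ and $\sum_{i\notin\mathcal I}\sigma.\boldsymbol\kappa[i]=0$. A transition is $t=(\mathit{rule},\mathit{factor})$ with $\mathit{rule}\in\mathcal R$, $\mathit{factor}\in\mathbb N_0$; write $t.\mathit{from}=t.\mathit{rule}.\mathit{from}$, etc. $t$ is unlocked in $\sigma$ if for all $k\in\{0,\dots,t.\mathit{factor}-1\}$, $(\sigma.\boldsymbol\kappa,\sigma.\mathbf g+k\cdot t.\mathbf u,\sigma.\mathbf p)\models t.\varphi^{\le}\wedge t.\varphi^{>}$; it is applicable (enabled) in $\sigma$ if it is unlocked and $\sigma.\boldsymbol\kappa[t.\mathit{from}]\ge t.\mathit{factor}$, or $t.\mathit{factor}=0$. Then $\sigma'=t(\sigma)$ is given by $\sigma'.\mathbf g=\sigma.\mathbf g+t.\mathit{factor}\cdot t.\mathbf u$, $\sigma'.\mathbf p=\sigma.\mathbf p$, and $\sigma'.\boldsymbol\kappa$ is obtained from $\sigma.\boldsymbol\kappa$ by subtracting $t.\mathit{factor}$ at $t.\mathit{from}$ and adding it at $t.\mathit{to}$ (no change if $t.\mathit{from}=t.\mathit{to}$).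 A schedule is a sequence of transitions; $\tau=t_1,\dots,t_m$ is applicable to $\sigma_0$ if there are $\sigma_i=t_i(\sigma_{i-1})$ with $t_i$ applicable in $\sigma_{i-1}$; then $\tau(\sigma_0)=\sigma_m$. $|\tau|$ is the length, $\tau\cdot\tau'$ concatenation. A schedule is conventional if all factors are $1$. The context of $\sigma$ is $\omega(\sigma)=\{g\in\Phi^{\mathrm{rise}}:\sigma\models g\}\cup\{g\in\Phi^{\mathrm{fall}}:\sigma\not\models g\}$; $\tau$ is steady for $\sigma$ if all configurations visited when applying $\tau$ to $\sigma$ have the same context. $\mathsf{Cfgs}(\sigma,\tau)\models\psi$ means $\tau'(\sigma)\models\psi$ for every prefix $\tau'$ of $\tau$ (including the empty prefix and $\tau$). A subschedule is a subsequence of the transitions of a schedule. **Simple representatives $\mathsf{srep}$.** For rules, $r_1\prec_P r_2$ iff $r_1.\mathit{to}=r_2.\mathit{from}$; $\prec_P^+$ is the transitive closure; $r_1\sim_P r_2$ iff ($r_1\prec_P^+r_2$ and $r_2\prec_P^+r_1$) or $r_1=r_2$; $[r]$ is the $\sim_P$-class of $r$. For classes, $c_1\prec_C c_2$ iff there are $r_1,r_2$ with $[r_1]=c_1$, $[r_2]=c_2$, $r_1\prec_P^+r_2$, $r_1\not\sim_P r_2$. Fix a linear extension $\prec^{lin}_C$ of $\prec_C$. For a steady schedule $\tau$ applicable to $\sigma$, $\mathsf{srep}[\sigma,\tau]$ is constructed as follows. (i) Repeatedly swap neighboring transitions $t_1,t_2$ (in this order) whenever $[t_2]\prec^{lin}_C[t_1]$,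 until no such pair exists. (ii) Merge all neighboring transitions of the same rule into one (possibly accelerated) transition. (iii) For rules $r_1,\dots,r_j$ forming a loop, replace the subschedule $\tau_{\mathrm{loop}}$ of transitions belonging to the loop, starting in $\sigma_0$ and with $\sigma_{\mathrm{end}}=\tau_{\mathrm{loop}}(\sigma_0)$, by the schedule $(r_1,f_1),\dots,(r_j,f_j),(r_1,f_{j+1}),\dots,(r_j,f_{2j})$ from which transitions with zero factor are removed, where: if all of $r_1,\dots,r_j$ appear in $\tau_{\mathrm{loop}}$, then inductively $f_i=\sigma_{i-1}.\boldsymbol\kappa[r_i.\mathit{from}]-\min(\sigma_0.\boldsymbol\kappa[r_i.\mathit{from}],\sigma_{\mathrm{end}}.\boldsymbol\kappa[r_i.\mathit{from}])$ and $\sigma_i=(r_i,f_i)(\sigma_{i-1})$ for $1\le i\le j$, and $f_i=\sigma_{i-1}.\boldsymbol\kappa[r_{i-j}.\mathit{from}]-\sigma_{\mathrm{end}}.\boldsymbol\kappa[r_{i-j}.\mathit{from}]$ and $\sigma_i=(r_{i-j},f_i)(\sigma_{i-1})$ for $j+1\le i\le 2j$; otherwise, if $r_i$ is the first rule not appearing in $\tau_{\mathrm{loop}}$, then $f_\ell=0$ for $\ell\le i$ or $\ell\ge j+i$, $f_\ell$ is the sum of the factors of the transitions of $\tau_{\mathrm{loop}}$ with rule $r_\ell$ for $i<\ell\le j$, and with rule $r_{\ell-j}$ for $j<\ell<i+j$. Recalled fact (Konnov, Veith, Widder, CAV 2015): $\mathsf{srep}[\sigma,\tau]$ is steady, applicable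 to $\sigma$, $\mathsf{srep}[\sigma,\tau](\sigma)=\tau(\sigma)$, and $|\mathsf{srep}[\sigma,\tau]|\le 2|\mathcal R|$. -}

module Defs where

open import Data.Fin using (Fin)
import Data.Fin.Properties as Fin
open import Data.Fin.Subset using (Subset) renaming (_∈_ to _∈ₛ_)
open import Data.Integer as ℤ using (ℤ; +_)
open import Data.List using (List; []; _∷_; _++_; map; foldr; foldl; filter; span)
open import Data.List.Membership.Propositional using (_∈_; _∉_)
import Data.List.Membership.DecPropositional as DecMembership
open import Data.List.Relation.Binary.Disjoint.Propositional using (Disjoint)
open import Data.List.Relation.Unary.All using (All)
open import Data.List.Relation.Unary.AllPairs using (AllPairs)
open import Data.List.Relation.Unary.Any using (Any)
open import Data.List.Relation.Unary.Linked using (Linked; []; [-]; _∷_)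
open import Data.List.Relation.Unary.Unique.Propositional using (Unique)
open import Data.Nat using (ℕ; suc; _+_; _*_; _∸_; _⊓_; _<_; _≥_)
import Data.Nat as ℕ
open import Data.Nat.ListAction using (sum)
open import Data.Product using (_×_; _,_; ∃; ∃!)
open import Data.Sum using (_⊎_; inj₁; inj₂)
open import Data.Unit using (⊤)
open import Data.Vec as Vec using (Vec; lookup; updateAt; replicate; zipWith)
open import Function.Base using (_∘_)
open import Function.Definitions using (Injective)
open import Relation.Binary.Construct.Closure.ReflexiveTransitive using (Star; ε; _◅_; _◅◅_; gmap)
open import Relation.Binary.Construct.Closure.Transitive using (TransClosure)
open import Relation.Binary.PropositionalEquality using (_≡_; _≢_)
open import Relation.Binary.Structures using (IsStrictTotalOrder)
open import Relation.Nullary using (¬_; yes; no)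
open import Relation.Nullary.Decidable using (¬?)
open import Relation.Unary using (Pred; Decidable; _≐_)

------------------------------------------------------------------------
-- Linear integer arithmetic

-- (a₀ , a) stands for the linear term a₀ + Σᵢ aᵢ xᵢ.
Linear : ℕ → Set
Linear n = ℤ × Vec ℤ n

⟦_⟧ : ∀ {n} → Linear n → Vec ℤ n → ℤ
⟦ a₀ , a ⟧ x = a₀ ℤ.+ Vec.foldr′ ℤ._+_ (+ 0) (zipWith ℤ._*_ a x)

data LIA (n : ℕ) : Set where
  _≤ᴸ_ _≡ᴸ_ : Linear n → Linear n → LIA n
  ¬ᴸ_       : LIA n → LIA n
  _∧ᴸ_ _∨ᴸ_ : LIA n → LIA n → LIA n
  ∀ᴸ_ ∃ᴸ_   : LIA (suc n) → LIA n

infix 4 _⊨ᴸ_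

_⊨ᴸ_ : ∀ {n} → Vec ℤ n → LIA n → Set
x ⊨ᴸ (s ≤ᴸ t) = ⟦ s ⟧ x ℤ.≤ ⟦ t ⟧ x
x ⊨ᴸ (s ≡ᴸ t) = ⟦ s ⟧ x ≡ ⟦ t ⟧ x
x ⊨ᴸ (¬ᴸ φ)   = ¬ (x ⊨ᴸ φ)
x ⊨ᴸ (φ ∧ᴸ χ) = x ⊨ᴸ φ × x ⊨ᴸ χ
x ⊨ᴸ (φ ∨ᴸ χ) = x ⊨ᴸ φ ⊎ x ⊨ᴸ χ
x ⊨ᴸ (∀ᴸ φ)   = ∀ (y : ℤ) → (y Vec.∷ x) ⊨ᴸ φ
x ⊨ᴸ (∃ᴸ φ)   = ∃ λ (y : ℤ) → (y Vec.∷ x) ⊨ᴸ φ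

------------------------------------------------------------------------
-- Threshold automata

-- A guard compares a shared variable with a threshold; whether it is a
-- lower guard (var ≥ threshold) or an upper guard (var < threshold) is
-- determined by where it is used.
record Guard (nΓ nΠ : ℕ) : Set where
  field
    var       : Fin nΓ
    threshold : Linear nΠ

record Rule (nL nΓ nΠ : ℕ) : Set where
  field
    from to : Fin nL
    φ≤ φ>   : List (Guard nΓ nΠ)   -- conjunctions
    u       : Vec ℕ nΓ

record ThresholdAutomaton : Set where
  field
    |L| |Γ| |Π| |R| : ℕ
    𝓘     : Subset |L|
    RC    : LIA |Π|
    -- The finite set of rules, as an enumeration without repetitions.
    rules : Fin |R| → Rule |L| |Γ| |Π|
    rules-injective : Injective _≡_ _≡_ rules

module _ (TA : ThresholdAutomaton) where
  open ThresholdAutomaton TA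

  Loc RuleName TAGuard : Set
  Loc      = Fin |L|
  RuleName = Fin |R|
  TAGuard  = Guard |Γ| |Π|

  module R (r : RuleName) = Rule (rules r)

  Path : Loc → List RuleName → Loc → Set
  Path ℓ []       ℓ′ = ℓ ≡ ℓ′
  Path ℓ (r ∷ rs) ℓ′ = R.from r ≡ ℓ × Path (R.to r) rs ℓ′

  IsCycle : Pred (List RuleName) _
  IsCycle c = c ≢ [] × ∃ λ ℓ → Path ℓ c ℓ

  OnCycle : Pred RuleName _
  OnCycle r = ∃ λ c → IsCycle c × r ∈ c

  CyclesDoNotUpdate : Set
  CyclesDoNotUpdate = ∀ r → OnCycle r → R.u r ≡ replicate |Γ| 0

  NotSelfLoop : Pred RuleName _
  NotSelfLoop r = R.from r ≢ R.to r

  NodeDisjointPath : Loc → Loc → Pred (List RuleName) _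
  NodeDisjointPath ℓ ℓ′ rs =
    rs ≢ [] × Path ℓ rs ℓ′ × All NotSelfLoop rs ×
    Unique (map R.from rs) × Unique (map R.to rs)

  -- Self-loops are disregarded.  The two locations may coincide, in which
  -- case the path is a simple closed one: this is what rules out two
  -- different cycles through a common location.  Paths are sequences of
  -- rules, so parallel rules on a cycle are ruled out as well.
  AllCyclesSimple : Set
  AllCyclesSimple =
    ∀ c → IsCycle c → All NotSelfLoop c →
    ∀ ℓ ℓ′ → ℓ ∈ map R.from c → ℓ′ ∈ map R.from c →
    ∃! _≡_ (NodeDisjointPath ℓ ℓ′)

------------------------------------------------------------------------
-- Counter systems

  record Config : Set where
    constructor config
    field
      κ : Vec ℕ |L|
      g : Vec ℕ |Γ|
      p : Vec ℕ |Π|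

  record Transition : Set where
    constructor _,ₜ_
    field
      rule   : RuleName
      factor : ℕ

  Schedule : Set
  Schedule = List Transition

  -- The two kinds of formulas ψ:  ⋁_{ℓ ∈ Locs} κ[ℓ] ≠ 0  and  ⋀_{ℓ ∈ Locs} κ[ℓ] = 0.
  data Formula : Set where
    ⋁κ≢0 : (Locs : Subset |L|) → Formula
    ⋀κ≡0 : (Locs : Subset |L|) → Formula

module _ {TA : ThresholdAutomaton} where
  open ThresholdAutomaton TA
  open Config
  open Transition
  open R TA

  infix 4 _⊨_ _⊨≤_ _⊨>_

  Admissible : Pred (Config TA) _
  Admissible σ = Vec.map +_ (p σ) ⊨ᴸ RC

  _⊨_ : Config TA → Formula TA → Set
  σ ⊨ ⋁κ≢0 Locs = ∃ λ ℓ → ℓ ∈ₛ Locs × lookup (κ σ) ℓ ≢ 0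
  σ ⊨ ⋀κ≡0 Locs = ∀ ℓ → ℓ ∈ₛ Locs → lookup (κ σ) ℓ ≡ 0

  _⊨≤_ _⊨>_ : Config TA → TAGuard TA → Set
  σ ⊨≤ γ = + lookup (g σ) (Guard.var γ) ℤ.≥ ⟦ Guard.threshold γ ⟧ (Vec.map +_ (p σ))
  σ ⊨> γ = + lookup (g σ) (Guard.var γ) ℤ.< ⟦ Guard.threshold γ ⟧ (Vec.map +_ (p σ))

  _+[_]·_ : ∀ {n} → Vec ℕ n → ℕ → Vec ℕ n → Vec ℕ n
  v +[ k ]· w = zipWith _+_ v (Vec.map (k *_) w)

  Unlocked : Transition TA → Pred (Config TA) _
  Unlocked (r ,ₜ f) (config κ g p) = ∀ k → k < f →
    let σₖ = config κ (g +[ k ]· u r) p in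
    All (σₖ ⊨≤_) (φ≤ r) × All (σₖ ⊨>_) (φ> r)

  Enabled : Transition TA → Pred (Config TA) _
  Enabled t σ =
    (Unlocked t σ × lookup (κ σ) (from (rule t)) ≥ factor t) ⊎ factor t ≡ 0

  move : Loc TA → Loc TA → ℕ → Vec ℕ |L| → Vec ℕ |L|
  move ℓ ℓ′ f κ with ℓ Fin.≟ ℓ′
  ... | yes _ = κ
  ... | no  _ = updateAt (updateAt κ ℓ (_∸ f)) ℓ′ (_+ f)

  -- Total, but only meaningful when the transition is enabled.
  step : Transition TA → Config TA → Config TA
  step (r ,ₜ f) (config κ g p) = config (move (from r) (to r) f κ) (g +[ f ]· u r) p

  run : Schedule TA → Config TA → Config TA
  run []      σ = σ
  run (t ∷ τ) σ = run τ (step t σ)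

  Applicable : Schedule TA → Pred (Config TA) _
  Applicable []      σ = ⊤
  Applicable (t ∷ τ) σ = Enabled t σ × Applicable τ (step t σ)

  -- The configurations τ′(σ) for the prefixes τ′ of τ.
  Cfgs : Config TA → Schedule TA → List (Config TA)
  Cfgs σ []      = σ ∷ []
  Cfgs σ (t ∷ τ) = σ ∷ Cfgs (step t σ) τ

  Conventional : Pred (Schedule TA) _
  Conventional τ = All (λ t → factor t ≡ 1) τ

  Φrise Φfall : Pred (TAGuard TA) _
  Φrise γ = ∃ λ r → γ ∈ φ≤ r
  Φfall γ = ∃ λ r → γ ∈ φ> r

  -- Lower guards are tagged inj₁ and upper guards inj₂.
  ω : Config TA → Pred (TAGuard TA ⊎ TAGuard TA) _
  ω σ (inj₁ γ) = Φrise γ × σ ⊨≤ γ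
  ω σ (inj₂ γ) = Φfall γ × ¬ (σ ⊨> γ)

  Steady : Config TA → Pred (Schedule TA) _
  Steady σ τ = ∀ {σ₁ σ₂} → σ₁ ∈ Cfgs σ τ → σ₂ ∈ Cfgs σ τ → ω σ₁ ≐ ω σ₂

------------------------------------------------------------------------
-- Precedence of rules and the choices on which srep depends

module _ (TA : ThresholdAutomaton) where
  open ThresholdAutomaton TA
  open R TA

  _≺P_ _≺P⁺_ _∼P_ _≺C_ : RuleName TA → RuleName TA → Set
  r₁ ≺P  r₂ = to r₁ ≡ from r₂
  r₁ ≺P⁺ r₂ = TransClosure _≺P_ r₁ r₂
  r₁ ∼P  r₂ = (r₁ ≺P⁺ r₂ × r₂ ≺P⁺ r₁) ⊎ r₁ ≡ r₂
  -- The relation [ r₁ ] ≺C [ r₂ ] between ∼P-classes, each class given by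
  -- any of its members.
  r₁ ≺C  r₂ = ∃ λ r₁′ → ∃ λ r₂′ →
    r₁′ ∼P r₁ × r₂′ ∼P r₂ × r₁′ ≺P⁺ r₂′ × ¬ (r₁′ ∼P r₂′)

  -- A strict total order on ∼P-classes, presented on their members.
  record LinearExtension : Set₁ where
    field
      _≺lin_             : RuleName TA → RuleName TA → Set
      isStrictTotalOrder : IsStrictTotalOrder _∼P_ _≺lin_
      extends            : ∀ {r₁ r₂} → r₁ ≺C r₂ → r₁ ≺lin r₂
    open IsStrictTotalOrder isStrictTotalOrder public using (_<?_; asym)

  IsLoop : Pred (List (RuleName TA)) _
  IsLoop rs = IsCycle TA rs × Unique (map from rs)

  -- The loops r₁ , … , rⱼ, each listed once, starting from an arbitrarily
  -- chosen rule r₁.  Self-loops are loops with j = 1.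
  record LoopEnumeration : Set where
    field
      loops    : List (List (RuleName TA))
      isLoop   : All IsLoop loops
      covers   : ∀ {r} → OnCycle TA r → Any (r ∈_) loops
      disjoint : AllPairs Disjoint loops

------------------------------------------------------------------------
-- Simple representatives

module Srep {TA : ThresholdAutomaton} (lin : LinearExtension TA) where
  open ThresholdAutomaton TA
  open R TA
  open Config
  open Transition
  open LinearExtension lin

  -- (i) Swapping neighbours.

  data _↝_ : Schedule TA → Schedule TA → Set where
    swap : ∀ {t₁ t₂ τ} → rule t₂ ≺lin rule t₁ → (t₁ ∷ t₂ ∷ τ) ↝ (t₂ ∷ t₁ ∷ τ)
    cons : ∀ {t τ τ′} → τ ↝ τ′ → (t ∷ τ) ↝ (t ∷ τ′)

  insert : Transition TA → Schedule TA → Schedule TA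
  insert t []       = t ∷ []
  insert t (t′ ∷ τ) with rule t′ <? rule t
  ... | yes _ = t′ ∷ insert t τ
  ... | no  _ = t ∷ t′ ∷ τ

  sort : Schedule TA → Schedule TA
  sort = foldr insert []

  -- sort performs such swaps until none is possible; no two transitions of
  -- the same class are ever swapped, so the outcome does not depend on the
  -- order in which the swaps are made.

  insert-↝ : ∀ t τ → Star _↝_ (t ∷ τ) (insert t τ)
  insert-↝ t []       = ε
  insert-↝ t (t′ ∷ τ) with rule t′ <? rule t
  ... | yes t′≺t = swap t′≺t ◅ gmap (t′ ∷_) cons (insert-↝ t τ)
  ... | no  _    = ε

  sort-↝ : ∀ τ → Star _↝_ τ (sort τ)
  sort-↝ []      = ε
  sort-↝ (t ∷ τ) = gmap (t ∷_) cons (sort-↝ τ) ◅◅ insert-↝ t (sort τ)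

  NoSwap : Schedule TA → Set
  NoSwap = Linked (λ t₁ t₂ → ¬ (rule t₂ ≺lin rule t₁))

  insert-NoSwap : ∀ t {τ} → NoSwap τ → NoSwap (insert t τ)
  insert-NoSwap t {[]} _ = [-]
  insert-NoSwap t {t′ ∷ τ} s with rule t′ <? rule t
  ... | no  t′⊀t = t′⊀t ∷ s
  insert-NoSwap t {t′ ∷ []} s | yes t′≺t = asym t′≺t ∷ [-]
  insert-NoSwap t {t′ ∷ t″ ∷ τ} (q ∷ s) | yes t′≺t
    with rule t″ <? rule t | insert-NoSwap t s
  ... | yes _ | s′ = q ∷ s′
  ... | no  _ | s′ = asym t′≺t ∷ s′

  sort-NoSwap : ∀ τ → NoSwap (sort τ)
  sort-NoSwap []      = []
  sort-NoSwap (t ∷ τ) = insert-NoSwap t (sort-NoSwap τ)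

  NoSwap⇒¬↝ : ∀ {τ τ′} → NoSwap τ → ¬ (τ ↝ τ′)
  NoSwap⇒¬↝ (q ∷ _) (swap t₂≺t₁)    = q t₂≺t₁
  NoSwap⇒¬↝ (_ ∷ s) (cons x)        = NoSwap⇒¬↝ s x
  NoSwap⇒¬↝ [-]     (cons ())

  -- (ii) Merging neighbours.

  cons-merge : Transition TA → Schedule TA → Schedule TA
  cons-merge t [] = t ∷ []
  cons-merge t (t′ ∷ τ) with rule t Fin.≟ rule t′
  ... | yes _ = (rule t ,ₜ (factor t + factor t′)) ∷ τ
  ... | no  _ = t ∷ t′ ∷ τ

  merge : Schedule TA → Schedule TA
  merge = foldr cons-merge []

  -- (iii) Replacing loops.

  _∈?_ : ∀ r rs → _
  _∈?_ = DecMembership._∈?_ (Fin._≟_ {|R|})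

  -- The transitions (r , f) for r in rs with f = σ′.κ[r.from] − b(r.from),
  -- where σ′ is the configuration reached so far.
  flush : (Loc TA → ℕ) → List (RuleName TA) → Config TA → Schedule TA
  flush b []       σ = []
  flush b (r ∷ rs) σ = t ∷ flush b rs (step t σ)
    where t = r ,ₜ (lookup (κ σ) (from r) ∸ b (from r))

  totalFactor : Schedule TA → RuleName TA → ℕ
  totalFactor τ r = sum (map factor (filter (λ t → rule t Fin.≟ r) τ))

  -- The second argument is the loop split before its first rule that does
  -- not appear in τloop, if there is such a rule.
  loopTransitions : Config TA → Schedule TA →
                    List (RuleName TA) × List (RuleName TA) → Schedule TA
  loopTransitions σ₀ τloop (rs , []) = first ++ second
    where
      σend   = run τloop σ₀
      first  = flush (λ ℓ → lookup (κ σ₀) ℓ ⊓ lookup (κ σend) ℓ) rs σ₀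
      second = flush (lookup (κ σend)) rs (run first σ₀)
  loopTransitions σ₀ τloop (before , rᵢ ∷ after) =
    zeros before ++ zeros (rᵢ ∷ []) ++ totals after ++
    totals before ++ zeros (rᵢ ∷ []) ++ zeros after
    where
      zeros totals : List (RuleName TA) → Schedule TA
      zeros  = map (_,ₜ 0)
      totals = map (λ r → r ,ₜ totalFactor τloop r)

  loopSchedule : Config TA → Schedule TA → List (RuleName TA) → Schedule TA
  loopSchedule σ₀ τloop rs =
    filter (λ t → ¬? (factor t ℕ.≟ 0))
           (loopTransitions σ₀ τloop (span (_∈? map rule τloop) rs))

  -- The replacement takes the place of the first transition of the loop.
  -- (After sorting, the only other transitions between two transitions of
  -- a loop belong to self-loops at locations of that loop, or, if the loop
  -- is itself a self-loop, to loops through its location.)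
  replaceLoop : Config TA → Schedule TA → List (RuleName TA) → Schedule TA
  replaceLoop σ τ rs with span (λ t → ¬? (rule t ∈? rs)) τ
  ... | τpre , τrest =
    τpre ++ loopSchedule (run τpre σ) (filter (λ t → rule t ∈? rs) τrest) rs
         ++ filter (λ t → ¬? (rule t ∈? rs)) τrest

srep : ∀ {TA} → LinearExtension TA → LoopEnumeration TA →
       Config TA → Schedule TA → Schedule TA
srep lin enum σ τ = foldl (replaceLoop σ) (merge (sort τ)) (LoopEnumeration.loops enum)
  where open Srep lin

{-# OPTIONS --safe #-}
-- In a steady schedule all guards of the rules in use hold throughout, so only
-- the movement of tokens matters.  For ψ = ⋀ κ[ℓ] = 0, no transition of τ, hence
-- none of srep[σ,τ], moves a token into or out of Locs, and τ₁ = τ will do.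
-- For ψ = ⋁ κ[ℓ] ≠ 0, note that adding a token that does not move does not change
-- srep; hence it suffices to split τ into parts during each of which a token
-- waits in Locs.  Let the token x start in Locs.  If x never leaves Locs, move
-- all other tokens while x waits, and then x alone.  Otherwise some other token
-- z is in Locs at a moment when x is not, and some token y ends in Locs.
-- If y ≠ z, move z up to that moment (x waits), then all tokens but z
-- (z waits), then z to its end (y waits).  If y = z, move z to its end (x waits)
-- and then the others (z waits).
module Submission where

open import Defs
open import Data.Bool using (if_then_else_; true; false)
open import Data.Fin using (Fin; zero; suc)
import Data.Fin.Properties as Fin
open import Data.Fin.Subset using (Subset) renaming (_∈_ to _∈ₛ_)
open import Data.Fin.Subset.Properties using () renaming (_∈?_ to _∈ₛ?_)
import Data.Integer as ℤ
import Data.Integer.Properties as ℤ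
open import Data.List using (List; []; _∷_; _++_; [_]; map; filter; length; span; foldl)
import Data.List as List
import Data.List.Membership.DecPropositional as DecMembership
open import Data.List.Membership.Propositional using (_∈_; _∉_)
open import Data.List.Membership.Propositional.Properties
  using (∈-∃++; ∈-map⁺; ∈-map⁻; ∈-++⁺ˡ; ∈-++⁺ʳ; ∈-++⁻; ∈-insert; ∈-filter⁻)
open import Data.List.Properties
  using (length-++; length-map; map-++; map-∘; map-id; map-cong-local; ++-assoc; ++-identityʳ;
         filter-++; filter-none; filter-idem)
open import Data.List.Relation.Binary.Permutation.Propositional
  using (_↭_; prep; swap; ↭⇒↭ₛ; ↭-refl; ↭-sym; ↭-trans; ↭-reflexive)
import Data.List.Relation.Binary.Permutation.Propositional as ↭
open import Data.List.Relation.Binary.Permutation.Propositional.Properties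
  using (++-comm; ++⁺ˡ; shift; drop-∷; ∈-resp-↭)
import Data.List.Relation.Binary.Permutation.Propositional.Properties as ↭
import Data.List.Relation.Binary.Permutation.Setoid.Properties as Permutationₛ
open import Data.List.Relation.Binary.Sublist.Propositional using (_⊆_)
import Data.List.Relation.Binary.Sublist.Propositional as Sublist
import Data.List.Relation.Binary.Sublist.Propositional.Properties as Sublist
open import Data.List.Relation.Unary.All using (All; []; _∷_)
import Data.List.Relation.Unary.All as All
import Data.List.Relation.Unary.All.Properties as All
open import Data.List.Relation.Unary.AllPairs using (AllPairs; []; _∷_)
import Data.List.Relation.Unary.AllPairs.Properties as AllPairs
open import Data.List.Relation.Unary.Any using (Any; here; there)
import Data.List.Relation.Unary.Any as Any
open import Data.List.Relation.Unary.Linked.Properties using (Linked⇒AllPairs)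
open import Data.List.Relation.Unary.Unique.Propositional using (Unique)
import Data.List.Relation.Unary.Unique.Propositional.Properties as Unique
open import Data.List.Relation.Unary.Unique.Propositional.Properties using (Unique[x∷xs]⇒x∉xs)
open import Data.Nat using (ℕ; zero; suc; _+_; _*_; _∸_; _⊓_; _≤_; _<_; z≤n; s≤s)
import Data.Nat as ℕ
open import Data.Nat.ListAction using (sum)
open import Data.Nat.Properties hiding (_<?_)
open import Data.Nat.Solver using (module +-*-Solver)
open import Data.Product using (_×_; _,_; proj₁; proj₂; ∃; ∃-syntax)
open import Data.Sum using (_⊎_; inj₁; inj₂)
open import Data.Vec as Vec using (Vec; []; _∷_; lookup; tabulate)
open import Data.Vec.Functional using (updateAt)
import Data.Vec.Functional.Properties as Vector
import Data.Vec.Properties as Vec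
open import Function using (_∘_; case_of_; const)
open import Level using (0ℓ)
open import Relation.Binary.Construct.Closure.ReflexiveTransitive using (Star; ε; _◅_)
open import Relation.Binary.Construct.Closure.Transitive using (_∷_) renaming ([_] to [_]⁺; _++_ to _++⁺_)
open import Relation.Binary.Definitions using (tri<; tri≈; tri>)
open import Relation.Binary.PropositionalEquality hiding ([_])
open import Relation.Binary.Structures using (IsStrictTotalOrder)
open import Relation.Nullary using (¬_; Dec; yes; no; does; contradiction)
open import Relation.Nullary.Decidable using (¬?; dec-true; dec-false; decidable-stable)
open import Relation.Unary using (Pred; Decidable)
open import Algebra.Properties.CommutativeMonoid.Sum +-0-commutativeMonoid
  using (∑-distrib-+; sum-replicate-zero; sum-cong-≗) renaming (sum to ∑)

-- That a waiting token does not disturb `srep` is not shown by comparing two counter systems.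
-- Instead a floor `c` of tokens that must stay put is carried through sorting, merging and loop
-- replacement. The construction never mentions `c`; yet whenever τ spares the floor, so does its
-- representative: a fully used loop is drawn down only to the minimum of its initial and final
-- counters or to the final ones, and both lie above the floor; any other loop is cut open into a
-- path. So correctness of `srep` is proved once for all floors. A unit floor in Locs then yields ψ,
-- and floor 0 serves where no token has to wait.
--
-- Counters and shared variables are followed separately. Sorting and merging keep the number of
-- uses of each rule, but loop replacement does not, so final counters need their own argument.
-- Shared variables are updated only off cycles, where the numbers of uses are kept. They grow
-- monotonically, so every schedule with the same total update stays between the two ends of τ, and
-- this gives the guards and steadiness.
--
-- The constant 6 is 3 pieces times 2: a rule of a loop occurs at most twice in a representative,
-- any other rule at most once.

δ : ∀ {n} → Fin n → Fin n → ℕ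
δ i j = if does (i Fin.≟ j) then 1 else 0

δ-refl : ∀ {n} (i : Fin n) → δ i i ≡ 1
δ-refl i rewrite dec-true (i Fin.≟ i) refl = refl

δ-≡ : ∀ {n} {i j : Fin n} → i ≡ j → δ i j ≡ 1
δ-≡ {i = i} refl = δ-refl i

δ-≢ : ∀ {n} {i j : Fin n} → i ≢ j → δ i j ≡ 0
δ-≢ {i = i} {j} i≢j rewrite dec-false (i Fin.≟ j) i≢j = refl

lookup-ext : ∀ {A : Set} {n} {v w : Vec A n} → (∀ i → lookup v i ≡ lookup w i) → v ≡ w
lookup-ext {v = v} {w} v≗w = begin
  v                   ≡⟨ Vec.tabulate∘lookup v ⟨
  tabulate (lookup v) ≡⟨ Vec.tabulate-cong v≗w ⟩
  tabulate (lookup w) ≡⟨ Vec.tabulate∘lookup w ⟩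
  w                   ∎
  where open ≡-Reasoning

-- Counters, token flow and floors.

module Tokens (TA : ThresholdAutomaton) where
  open ThresholdAutomaton TA
  open R TA
  open Config
  open Transition

  Counters : Set
  Counters = Vec ℕ |L|

  stepK : Transition TA → Counters → Counters
  stepK (r ,ₜ f) = move {TA} (from r) (to r) f

  runK : Schedule TA → Counters → Counters
  runK []      v = v
  runK (t ∷ τ) v = runK τ (stepK t v)

  κ-run : ∀ τ (σ : Config TA) → κ (run τ σ) ≡ runK τ (κ σ)
  κ-run []      σ = refl
  κ-run (t ∷ τ) σ = κ-run τ (step t σ)

  runK-++ : ∀ τ τ′ v → runK (τ ++ τ′) v ≡ runK τ′ (runK τ v)
  runK-++ []      τ′ v = refl
  runK-++ (t ∷ τ) τ′ v = runK-++ τ τ′ (stepK t v)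

  SelfLoop : Pred (RuleName TA) _
  SelfLoop r = from r ≡ to r

  -- The tokens in the floor c stay where they are.  A self-loop is always
  -- allowed: merging k uses of a self-loop by one token gives a factor k
  -- that exceeds the counter, which is harmless as srep deletes self-loops.
  data Fires (c : Loc TA → ℕ) (t : Transition TA) (v : Counters) : Set where
    idles : SelfLoop (rule t) → Fires c t v
    moves : factor t + c (from (rule t)) ≤ lookup v (from (rule t)) → Fires c t v

  data FiresAll (c : Loc TA → ℕ) : Schedule TA → Counters → Set where
    []  : ∀ {v} → FiresAll c [] v
    _∷_ : ∀ {t τ v} → Fires c t v → FiresAll c τ (stepK t v) → FiresAll c (t ∷ τ) v

  FiresAll-++⁺ : ∀ {c} τ {τ′ v} → FiresAll c τ v → FiresAll c τ′ (runK τ v) → FiresAll c (τ ++ τ′) v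
  FiresAll-++⁺ []      _       y = y
  FiresAll-++⁺ (t ∷ τ) (o ∷ x) y = o ∷ FiresAll-++⁺ τ x y

  FiresAll-++⁻ : ∀ {c} τ {τ′ v} → FiresAll c (τ ++ τ′) v → FiresAll c τ v × FiresAll c τ′ (runK τ v)
  FiresAll-++⁻ []      y       = [] , y
  FiresAll-++⁻ (t ∷ τ) (o ∷ x) with FiresAll-++⁻ τ x
  ... | x₁ , x₂ = o ∷ x₁ , x₂

  stepK-selfLoop : ∀ {r} f v → SelfLoop r → stepK (r ,ₜ f) v ≡ v
  stepK-selfLoop {r} f v loop with from r Fin.≟ to r
  ... | yes _   = refl
  ... | no  ¬eq = contradiction loop ¬eq

  stepK-from : ∀ {r} f v → ¬ SelfLoop r → lookup (stepK (r ,ₜ f) v) (from r) ≡ lookup v (from r) ∸ f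
  stepK-from {r} f v ¬loop with from r Fin.≟ to r
  ... | yes eq = contradiction eq ¬loop
  ... | no  _  = trans (Vec.lookup∘updateAt′ (from r) (to r) {_+ f} ¬loop (Vec.updateAt v (from r) (_∸ f))) (Vec.lookup∘updateAt (from r) {_∸ f} v)

  stepK-to : ∀ {r} f v → ¬ SelfLoop r → lookup (stepK (r ,ₜ f) v) (to r) ≡ lookup v (to r) + f
  stepK-to {r} f v ¬loop with from r Fin.≟ to r
  ... | yes eq = contradiction eq ¬loop
  ... | no  _  = trans (Vec.lookup∘updateAt (to r) {_+ f} (Vec.updateAt v (from r) (_∸ f)))
                       (cong (_+ f) (Vec.lookup∘updateAt′ (to r) (from r) {_∸ f} (¬loop ∘ sym) v))

  stepK-other : ∀ {r} f v {ℓ} → ℓ ≢ from r → ℓ ≢ to r → lookup (stepK (r ,ₜ f) v) ℓ ≡ lookup v ℓ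
  stepK-other {r} f v {ℓ} ≢from ≢to with from r Fin.≟ to r
  ... | yes _ = refl
  ... | no  _ = trans (Vec.lookup∘updateAt′ ℓ (to r) {_+ f} ≢to (Vec.updateAt v (from r) (_∸ f)))
                       (Vec.lookup∘updateAt′ ℓ (from r) {_∸ f} ≢from v)

  -- The balance is written with sums on both sides to keep truncated subtraction out of later
  -- arguments. For `moves` the subtraction in `step` is exact; for a self-loop the two added terms
  -- coincide, whatever the factor.
  stepK-flow : ∀ {c} t v → Fires c t v → ∀ ℓ →
    lookup (stepK t v) ℓ + factor t * δ (from (rule t)) ℓ ≡ lookup v ℓ + factor t * δ (to (rule t)) ℓ
  stepK-flow (r ,ₜ f) v (idles loop) ℓ
    rewrite stepK-selfLoop f v loop | loop = refl
  stepK-flow (r ,ₜ f) v (moves f≤) ℓ with from r Fin.≟ to r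
  ... | yes eq rewrite eq = refl
  ... | no ¬loop with ℓ Fin.≟ from r | ℓ Fin.≟ to r
  ...   | yes refl | yes eq = contradiction eq ¬loop
  ...   | yes refl | no _
    rewrite δ-refl (from r) | δ-≢ (¬loop ∘ sym) | *-identityʳ f | *-zeroʳ f | +-identityʳ (lookup v (from r))
          | Vec.lookup∘updateAt′ (from r) (to r) {_+ f} ¬loop (Vec.updateAt v (from r) (_∸ f))
          | Vec.lookup∘updateAt (from r) {_∸ f} v
    = m∸n+n≡m (m+n≤o⇒m≤o f f≤)
  ...   | no ≢from | yes refl
    rewrite δ-refl (to r) | δ-≢ ¬loop | *-identityʳ f | *-zeroʳ f
          | Vec.lookup∘updateAt (to r) {_+ f} (Vec.updateAt v (from r) (_∸ f))
          | Vec.lookup∘updateAt′ (to r) (from r) {_∸ f} (¬loop ∘ sym) v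
    = +-identityʳ _
  ...   | no ≢from | no ≢to
    rewrite δ-≢ (≢from ∘ sym) | δ-≢ (≢to ∘ sym) | *-zeroʳ f
          | Vec.lookup∘updateAt′ ℓ (to r) {_+ f} ≢to (Vec.updateAt v (from r) (_∸ f))
          | Vec.lookup∘updateAt′ ℓ (from r) {_∸ f} ≢from v
    = refl

  -- One functional for several counts: with the indicator of a source or target location it is the
  -- outflow or inflow there, with an entry of `u` the growth of a shared variable, and with the
  -- indicator of a rule its total factor.
  weight : (RuleName TA → ℕ) → Schedule TA → ℕ
  weight w []      = 0
  weight w (t ∷ τ) = factor t * w (rule t) + weight w τ

  weight-++ : ∀ w τ τ′ → weight w (τ ++ τ′) ≡ weight w τ + weight w τ′
  weight-++ w []      τ′ = refl
  weight-++ w (t ∷ τ) τ′ rewrite weight-++ w τ τ′ = sym (+-assoc (factor t * w (rule t)) _ _)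

  weight-partition : ∀ w {P : Pred (Transition TA) 0ℓ} (P? : Decidable P) τ →
    weight w τ ≡ weight w (filter P? τ ++ filter (¬? ∘ P?) τ)
  weight-partition w P? []      = refl
  weight-partition w P? (t ∷ τ) with does (P? t)
  ... | true  = cong (factor t * w (rule t) +_) (weight-partition w P? τ)
  ... | false = begin
    factor t * w (rule t) + weight w τ
      ≡⟨ cong (factor t * w (rule t) +_) (trans (weight-partition w P? τ) (weight-++ w ins outs)) ⟩
    factor t * w (rule t) + (weight w ins + weight w outs)
      ≡⟨ solve 3 (λ x y z → x :+ (y :+ z) := y :+ (x :+ z)) refl (factor t * w (rule t)) (weight w ins) (weight w outs) ⟩
    weight w ins + weight w (t ∷ outs)
      ≡⟨ weight-++ w ins (t ∷ outs) ⟨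
    weight w (ins ++ t ∷ outs) ∎
    where
      open ≡-Reasoning
      open +-*-Solver
      ins outs : Schedule TA
      ins  = filter P? τ
      outs = filter (¬? ∘ P?) τ

  runK-flow : ∀ {c} τ v → FiresAll c τ v → ∀ ℓ →
    lookup (runK τ v) ℓ + weight (λ r → δ (from r) ℓ) τ ≡ lookup v ℓ + weight (λ r → δ (to r) ℓ) τ
  runK-flow []      v _       ℓ = refl
  runK-flow (t ∷ τ) v (o ∷ x) ℓ = begin
    lookup (runK τ v₁) ℓ + (out + outs)  ≡⟨ solve 3 (λ x y z → x :+ (y :+ z) := (x :+ z) :+ y) refl (lookup (runK τ v₁) ℓ) out outs ⟩
    (lookup (runK τ v₁) ℓ + outs) + out  ≡⟨ cong (_+ out) (runK-flow τ v₁ x ℓ) ⟩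
    (lookup v₁ ℓ + ins) + out            ≡⟨ solve 3 (λ x y z → (x :+ y) :+ z := (x :+ z) :+ y) refl (lookup v₁ ℓ) ins out ⟩
    (lookup v₁ ℓ + out) + ins            ≡⟨ cong (_+ ins) (stepK-flow t v o ℓ) ⟩
    (lookup v ℓ + inn) + ins             ≡⟨ +-assoc (lookup v ℓ) inn ins ⟩
    lookup v ℓ + (inn + ins)             ∎
    where
      open ≡-Reasoning
      open +-*-Solver
      v₁ : Counters
      v₁ = stepK t v
      out outs inn ins : ℕ
      out  = factor t * δ (from (rule t)) ℓ
      outs = weight (λ r → δ (from r) ℓ) τ
      inn  = factor t * δ (to (rule t)) ℓ
      ins  = weight (λ r → δ (to r) ℓ) τ

  -- Outflow and inflow at each location are weights, so the flow balance determines the final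
  -- counters from the numbers of uses alone. Reordering and merging thus only require that the new
  -- schedule still fires.
  runK-weight : ∀ {c} τ τ′ v → FiresAll c τ v → FiresAll c τ′ v →
    (∀ w → weight w τ ≡ weight w τ′) → runK τ v ≡ runK τ′ v
  runK-weight τ τ′ v x x′ τ≈τ′ = lookup-ext λ ℓ → +-cancelʳ-≡ (weight (λ r → δ (from r) ℓ) τ) _ _ (begin
    lookup (runK τ v) ℓ + weight (λ r → δ (from r) ℓ) τ   ≡⟨ runK-flow τ v x ℓ ⟩
    lookup v ℓ + weight (λ r → δ (to r) ℓ) τ              ≡⟨ cong (lookup v ℓ +_) (τ≈τ′ _) ⟩
    lookup v ℓ + weight (λ r → δ (to r) ℓ) τ′             ≡⟨ runK-flow τ′ v x′ ℓ ⟨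
    lookup (runK τ′ v) ℓ + weight (λ r → δ (from r) ℓ) τ′ ≡⟨ cong (lookup (runK τ′ v) ℓ +_) (τ≈τ′ _) ⟨
    lookup (runK τ′ v) ℓ + weight (λ r → δ (from r) ℓ) τ  ∎)
    where open ≡-Reasoning

  Above : (Loc TA → ℕ) → Pred Counters _
  Above c v = ∀ ℓ → c ℓ ≤ lookup v ℓ

  -- Only the source of a rule loses tokens, and there `moves` sets the floor aside.
  stepK-above : ∀ {c} t {v} → Fires c t v → Above c v → Above c (stepK t v)
  stepK-above {c} (r ,ₜ f) {v} (idles loop) above = subst (Above c) (sym (stepK-selfLoop f v loop)) above
  stepK-above {c} (r ,ₜ f) {v} (moves f≤) above ℓ = +-cancelʳ-≤ (f * δ (from r) ℓ) _ _ (begin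
    c ℓ + f * δ (from r) ℓ                         ≤⟨ below ⟩
    lookup v ℓ                                     ≤⟨ m≤m+n _ _ ⟩
    lookup v ℓ + f * δ (to r) ℓ                    ≡⟨ stepK-flow {c} (r ,ₜ f) v (moves f≤) ℓ ⟨
    lookup (stepK (r ,ₜ f) v) ℓ + f * δ (from r) ℓ ∎)
    where
      open ≤-Reasoning
      below : c ℓ + f * δ (from r) ℓ ≤ lookup v ℓ
      below with from r Fin.≟ ℓ
      ... | yes refl = subst (_≤ lookup v ℓ) (trans (+-comm f (c ℓ)) (cong (c ℓ +_) (sym (*-identityʳ f)))) f≤
      ... | no _     = subst (_≤ lookup v ℓ) (trans (sym (+-identityʳ (c ℓ))) (cong (c ℓ +_) (sym (*-zeroʳ f)))) (above ℓ)

  runK-above : ∀ {c} τ {v} → FiresAll c τ v → Above c v → Above c (runK τ v)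
  runK-above []      _       above = above
  runK-above (t ∷ τ) (o ∷ x) above = runK-above τ x (stepK-above t o above)

-- Exchanging, partitioning and merging transitions.

module Rearrange (TA : ThresholdAutomaton) where
  open ThresholdAutomaton TA
  open R TA
  open Transition
  open Tokens TA

  -- Deliberately asymmetric: it permits moving `r′` ahead of a preceding `r`. For this `r` must not
  -- supply the source of `r′`; that `r′` supplies the source of `r` only helps.
  Commutes : RuleName TA → RuleName TA → Set
  Commutes r r′ = SelfLoop r ⊎ SelfLoop r′ ⊎ to r ≢ from r′

  private
    fires-earlier : ∀ {c} s t {v} → Commutes (rule s) (rule t) → Fires c s v → Fires c t (stepK s v) → Fires c t v
    fires-earlier s t             _                  _  (idles loop) = idles loop
    fires-earlier (r ,ₜ f) t {v} (inj₁ loop)         _  o rewrite stepK-selfLoop f v loop = o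
    fires-earlier s t            (inj₂ (inj₁ loop))  _  _ = idles loop
    fires-earlier {c} s t {v}    (inj₂ (inj₂ to≢from)) o (moves le) = moves (begin
      factor t + c ℓ                 ≤⟨ le ⟩
      lookup (stepK s v) ℓ           ≤⟨ m≤m+n _ _ ⟩
      lookup (stepK s v) ℓ + factor s * δ (from (rule s)) ℓ ≡⟨ stepK-flow s v o ℓ ⟩
      lookup v ℓ + factor s * δ (to (rule s)) ℓ ≡⟨ cong (λ x → lookup v ℓ + factor s * x) (δ-≢ to≢from) ⟩
      lookup v ℓ + factor s * 0      ≡⟨ cong (lookup v ℓ +_) (*-zeroʳ (factor s)) ⟩
      lookup v ℓ + 0                 ≡⟨ +-identityʳ _ ⟩
      lookup v ℓ                     ∎)
      where
        open ≤-Reasoning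
        ℓ = from (rule t)

    fires-later : ∀ {c} s t {v} → Commutes (rule s) (rule t) → Fires c s v → Fires c t (stepK s v) → Fires c s (stepK t v)
    fires-later s t _ (idles loop) _ = idles loop
    fires-later {c} s (r ,ₜ f) {v} _ o (idles loop) = subst (Fires c s) (sym (stepK-selfLoop f v loop)) o
    fires-later s t (inj₁ loop) _ _ = idles loop
    fires-later {c} s (r ,ₜ f) {v} (inj₂ (inj₁ loop)) o _ = subst (Fires c s) (sym (stepK-selfLoop f v loop)) o
    fires-later {c} s t {v} com@(inj₂ (inj₂ to≢from)) o@(moves le) o′@(moves le′)
      with from (rule t) Fin.≟ from (rule s)
    ... | no from≢from = moves (begin
      factor s + c ℓ                 ≤⟨ le ⟩
      lookup v ℓ                     ≤⟨ m≤m+n _ _ ⟩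
      lookup v ℓ + factor t * δ (to (rule t)) ℓ ≡⟨ stepK-flow t v (fires-earlier s t com o o′) ℓ ⟨
      lookup (stepK t v) ℓ + factor t * δ (from (rule t)) ℓ ≡⟨ cong (λ x → lookup (stepK t v) ℓ + factor t * x) (δ-≢ from≢from) ⟩
      lookup (stepK t v) ℓ + factor t * 0 ≡⟨ cong (lookup (stepK t v) ℓ +_) (*-zeroʳ (factor t)) ⟩
      lookup (stepK t v) ℓ + 0       ≡⟨ +-identityʳ _ ⟩
      lookup (stepK t v) ℓ           ∎)
      where
        open ≤-Reasoning
        ℓ = from (rule s)
    -- Both transitions drain the same location. That `t` fires after `s` shows that the location
    -- holds enough for both above the floor, in either order.
    ... | yes eq = moves (+-cancelʳ-≤ (factor t) _ _ (begin
      factor s + c ℓ + factor t      ≡⟨ solve 3 (λ x y z → x :+ y :+ z := z :+ y :+ x) refl (factor s) (c ℓ) (factor t) ⟩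
      factor t + c ℓ + factor s      ≤⟨ +-monoˡ-≤ (factor s) (subst (λ a → factor t + c a ≤ lookup (stepK s v) a) eq le′) ⟩
      lookup (stepK s v) ℓ + factor s ≡⟨ cong (lookup (stepK s v) ℓ +_) (sym (*-identityʳ _)) ⟩
      lookup (stepK s v) ℓ + factor s * 1 ≡⟨ cong (λ x → lookup (stepK s v) ℓ + factor s * x) (δ-refl ℓ) ⟨
      lookup (stepK s v) ℓ + factor s * δ ℓ ℓ ≡⟨ stepK-flow s v o ℓ ⟩
      lookup v ℓ + factor s * δ (to (rule s)) ℓ ≡⟨ cong (λ x → lookup v ℓ + factor s * x) (δ-≢ (λ e → to≢from (trans e (sym eq)))) ⟩
      lookup v ℓ + factor s * 0      ≡⟨ cong (lookup v ℓ +_) (*-zeroʳ (factor s)) ⟩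
      lookup v ℓ + 0                 ≤⟨ +-monoʳ-≤ (lookup v ℓ) z≤n ⟩
      lookup v ℓ + factor t * δ (to (rule t)) ℓ ≡⟨ stepK-flow t v (fires-earlier s t com o o′) ℓ ⟨
      lookup (stepK t v) ℓ + factor t * δ (from (rule t)) ℓ ≡⟨ cong (λ x → lookup (stepK t v) ℓ + factor t * x) (δ-≡ eq) ⟩
      lookup (stepK t v) ℓ + factor t * 1 ≡⟨ cong (lookup (stepK t v) ℓ +_) (*-identityʳ _) ⟩
      lookup (stepK t v) ℓ + factor t ∎))
      where
        open ≤-Reasoning
        open +-*-Solver
        ℓ = from (rule s)

  FiresAll-swap : ∀ {c s t τ v} → Commutes (rule s) (rule t) →
    FiresAll c (s ∷ t ∷ τ) v → FiresAll c (t ∷ s ∷ τ) v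
  FiresAll-swap {c} {s} {t} {τ} {v} com (o ∷ o′ ∷ x) = p ∷ p′ ∷ subst (FiresAll c τ) same x
    where
      open +-*-Solver
      p  = fires-earlier s t com o o′
      p′ = fires-later s t com o o′
      same : stepK t (stepK s v) ≡ stepK s (stepK t v)
      same = runK-weight (s ∷ t ∷ []) (t ∷ s ∷ []) v (o ∷ o′ ∷ []) (p ∷ p′ ∷ [])
        (λ w → solve 2 (λ x y → x :+ (y :+ con 0) := y :+ (x :+ con 0)) refl
                       (factor s * w (rule s)) (factor t * w (rule t)))

  private
    FiresAll-shift : ∀ {c s ps qs v} → All (λ p → Commutes (rule s) (rule p)) ps →
      FiresAll c (s ∷ ps ++ qs) v → FiresAll c (ps ++ s ∷ qs) v
    FiresAll-shift []         x = x
    FiresAll-shift (com ∷ cs) x with FiresAll-swap com x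
    ... | o ∷ y = o ∷ FiresAll-shift cs y

  module _ {P : Pred (Transition TA) 0ℓ} (P? : Decidable P) where

    -- The partition is stable, so the only pairs to be exchanged are those in which a transition
    -- outside `P` precedes one in `P`.
    FiresAll-partition : ∀ {c τ v} →
      AllPairs (λ s t → ¬ P s → P t → Commutes (rule s) (rule t)) τ →
      FiresAll c τ v → FiresAll c (filter P? τ ++ filter (¬? ∘ P?) τ) v
    FiresAll-partition []       x = x
    FiresAll-partition {τ = t ∷ τ} (cs ∷ css) (o ∷ x) with P? t | FiresAll-partition css x
    ... | yes _  | y = o ∷ y
    ... | no ¬Pt | y = FiresAll-shift (All.zipWith (λ (com , Pp) → com ¬Pt Pp)
                         (All.filter⁺ P? cs , All.all-filter P? τ)) (o ∷ y)

    runK-partition : ∀ {c τ v} →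
      AllPairs (λ s t → ¬ P s → P t → Commutes (rule s) (rule t)) τ →
      FiresAll c τ v → runK τ v ≡ runK (filter P? τ ++ filter (¬? ∘ P?) τ) v
    runK-partition {τ = τ} {v} cs x =
      runK-weight τ _ v x (FiresAll-partition cs x) (λ w → weight-partition w P? τ)

  weight-merge : ∀ w r f f′ τ → weight w ((r ,ₜ f) ∷ (r ,ₜ f′) ∷ τ) ≡ weight w ((r ,ₜ (f + f′)) ∷ τ)
  weight-merge w r f f′ τ = solve 4 (λ f f′ x y → f :* x :+ (f′ :* x :+ y) := (f :+ f′) :* x :+ y) refl f f′ (w r) (weight w τ)
    where open +-*-Solver

  FiresAll-merge : ∀ {c r f f′ τ v} →
    FiresAll c ((r ,ₜ f) ∷ (r ,ₜ f′) ∷ τ) v → FiresAll c ((r ,ₜ (f + f′)) ∷ τ) v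
  FiresAll-merge {c} {r} {f} {f′} {τ} {v} (o ∷ o′ ∷ x) = p ∷ subst (FiresAll c τ) same x
    where
      together : Dec (SelfLoop r) → Fires c (r ,ₜ f) v → Fires c (r ,ₜ f′) (stepK (r ,ₜ f) v) → Fires c (r ,ₜ (f + f′)) v
      together (yes loop) _            _            = idles loop
      together (no ¬loop) (idles loop) _            = contradiction loop ¬loop
      together (no ¬loop) _            (idles loop) = contradiction loop ¬loop
      together (no ¬loop) (moves le)   (moves le′)  = moves (begin
        f + f′ + c (from r)                  ≡⟨ +-assoc f f′ (c (from r)) ⟩
        f + (f′ + c (from r))                ≤⟨ +-monoʳ-≤ f (subst (f′ + c (from r) ≤_) (stepK-from f v ¬loop) le′) ⟩
        f + (lookup v (from r) ∸ f)          ≡⟨ m+[n∸m]≡n (m+n≤o⇒m≤o f le) ⟩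
        lookup v (from r)                    ∎)
        where open ≤-Reasoning
      p : Fires c (r ,ₜ (f + f′)) v
      p = together (from r Fin.≟ to r) o o′
      same : stepK (r ,ₜ f′) (stepK (r ,ₜ f) v) ≡ stepK (r ,ₜ (f + f′)) v
      same = runK-weight ((r ,ₜ f) ∷ (r ,ₜ f′) ∷ []) ((r ,ₜ (f + f′)) ∷ []) v (o ∷ o′ ∷ []) (p ∷ [])
               (λ w → weight-merge w r f f′ [])

  nonzero? : Decidable (λ (t : Transition TA) → factor t ≢ 0)
  nonzero? t = ¬? (factor t ℕ.≟ 0)

  stepK-zero : ∀ r v → stepK (r ,ₜ 0) v ≡ v
  stepK-zero r v = lookup-ext (λ ℓ → +-cancelʳ-≡ 0 _ _ (stepK-flow {λ _ → 0} (r ,ₜ 0) v (moves z≤n) ℓ))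

  FiresAll-nonzero : ∀ {c} τ {v} → FiresAll c τ v → FiresAll c (filter nonzero? τ) v
  FiresAll-nonzero []      x = x
  FiresAll-nonzero {c} ((r ,ₜ zero)  ∷ τ) {v} (o ∷ x) = FiresAll-nonzero τ (subst (FiresAll c τ) (stepK-zero r v) x)
  FiresAll-nonzero ((r ,ₜ suc f) ∷ τ) (o ∷ x) = o ∷ FiresAll-nonzero τ x

  runK-nonzero : ∀ τ v → runK (filter nonzero? τ) v ≡ runK τ v
  runK-nonzero []                  v = refl
  runK-nonzero ((r ,ₜ zero)  ∷ τ) v = trans (runK-nonzero τ v) (cong (runK τ) (sym (stepK-zero r v)))
  runK-nonzero ((r ,ₜ suc f) ∷ τ) v = runK-nonzero τ (stepK (r ,ₜ suc f) v)

-- Sorting by classes and merging.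

module SortMerge {TA : ThresholdAutomaton} (lin : LinearExtension TA) where
  open ThresholdAutomaton TA
  open R TA
  open Transition
  open Tokens TA
  open Rearrange TA
  open LinearExtension lin
  open Srep lin
  open IsStrictTotalOrder isStrictTotalOrder using (compare; irrefl; <-respˡ-≈; <-respʳ-≈) renaming (trans to ≺-trans; module Eq to ∼)

  -- An edge between different classes is already a `≺C` step, and the linear order extends `≺C`.
  -- Tokens therefore never flow to an earlier class.
  ≺P⇒ : ∀ {r r′} → to r ≡ from r′ → _∼P_ TA r r′ ⊎ r ≺lin r′
  ≺P⇒ {r} {r′} eq with compare r r′
  ... | tri< r≺r′ _ _ = inj₂ r≺r′
  ... | tri≈ _ r∼r′ _ = inj₁ r∼r′
  ... | tri> _ r≁r′ _ = inj₂ (extends (r , r′ , ∼.refl , ∼.refl , [ eq ]⁺ , r≁r′))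

  -- If the first transition supplied the second, `≺P⇒` would put its class no later than that of
  -- the second, against the condition of the swap.
  FiresAll-↝ : ∀ {c τ τ′ v} → τ ↝ τ′ → FiresAll c τ v → FiresAll c τ′ v
  FiresAll-↝ (swap {t₁} {t₂} t₂≺t₁) x = FiresAll-swap (inj₂ (inj₂ λ eq → case ≺P⇒ eq of λ where
    (inj₁ t₁∼t₂) → irrefl (∼.sym t₁∼t₂) t₂≺t₁
    (inj₂ t₁≺t₂) → asym t₁≺t₂ t₂≺t₁)) x
  FiresAll-↝ (cons s) (o ∷ x) = o ∷ FiresAll-↝ s x

  weight-↝ : ∀ w {τ τ′} → τ ↝ τ′ → weight w τ ≡ weight w τ′
  weight-↝ w (swap {t₁} {t₂} {τ} _) =
    solve 3 (λ x y z → x :+ (y :+ z) := y :+ (x :+ z)) refl (factor t₁ * w (rule t₁)) (factor t₂ * w (rule t₂)) (weight w τ)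
    where open +-*-Solver
  weight-↝ w (cons {t} s) = cong (factor t * w (rule t) +_) (weight-↝ w s)

  FiresAll-sort : ∀ {c} τ {v} → FiresAll c τ v → FiresAll c (sort τ) v
  FiresAll-sort {c} τ {v} = go (sort-↝ τ)
    where
      go : ∀ {τ τ′} → Star _↝_ τ τ′ → FiresAll c τ v → FiresAll c τ′ v
      go ε        x = x
      go (s ◅ ss) x = go ss (FiresAll-↝ s x)

  weight-sort : ∀ w τ → weight w τ ≡ weight w (sort τ)
  weight-sort w τ = go (sort-↝ τ)
    where
      go : ∀ {τ τ′} → Star _↝_ τ τ′ → weight w τ ≡ weight w τ′
      go ε        = refl
      go (s ◅ ss) = trans (weight-↝ w s) (go ss)

  FiresAll-cons-merge : ∀ {c} t τ {v} → FiresAll c (t ∷ τ) v → FiresAll c (cons-merge t τ) v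
  FiresAll-cons-merge t []       x = x
  FiresAll-cons-merge t (t′ ∷ τ) x with rule t Fin.≟ rule t′
  ... | yes refl = FiresAll-merge x
  ... | no  _    = x

  weight-cons-merge : ∀ w t τ → weight w (t ∷ τ) ≡ weight w (cons-merge t τ)
  weight-cons-merge w t []       = refl
  weight-cons-merge w t (t′ ∷ τ) with rule t Fin.≟ rule t′
  ... | yes refl = weight-merge w (rule t) (factor t) (factor t′) τ
  ... | no  _    = refl

  FiresAll-merges : ∀ {c} τ {v} → FiresAll c τ v → FiresAll c (merge τ) v
  FiresAll-merges []      x       = x
  FiresAll-merges (t ∷ τ) (o ∷ x) = FiresAll-cons-merge t (merge τ) (o ∷ FiresAll-merges τ x)

  weight-merges : ∀ w τ → weight w τ ≡ weight w (merge τ)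
  weight-merges w []      = refl
  weight-merges w (t ∷ τ) =
    trans (cong (factor t * w (rule t) +_) (weight-merges w τ)) (weight-cons-merge w t (merge τ))

  All-insert : ∀ {P : Pred (RuleName TA) 0ℓ} t τ → P (rule t) → All (P ∘ rule) τ → All (P ∘ rule) (insert t τ)
  All-insert t []       p ps = p ∷ ps
  All-insert t (t′ ∷ τ) p (p′ ∷ ps) with rule t′ <? rule t
  ... | yes _ = p′ ∷ All-insert t τ p ps
  ... | no  _ = p ∷ p′ ∷ ps

  All-sort : ∀ {P : Pred (RuleName TA) 0ℓ} {τ} → All (P ∘ rule) τ → All (P ∘ rule) (sort τ)
  All-sort []       = []
  All-sort (p ∷ ps) = All-insert _ _ p (All-sort ps)

  All-cons-merge : ∀ {P : Pred (RuleName TA) 0ℓ} t τ → P (rule t) → All (P ∘ rule) τ → All (P ∘ rule) (cons-merge t τ)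
  All-cons-merge t []       p ps = p ∷ ps
  All-cons-merge t (t′ ∷ τ) p (p′ ∷ ps) with rule t Fin.≟ rule t′
  ... | yes _ = p ∷ ps
  ... | no  _ = p ∷ p′ ∷ ps

  All-merge : ∀ {P : Pred (RuleName TA) 0ℓ} {τ} → All (P ∘ rule) τ → All (P ∘ rule) (merge τ)
  All-merge []       = []
  All-merge (p ∷ ps) = All-cons-merge _ _ p (All-merge ps)

  infix 4 _⋠_
  -- The weak order on classes, in the negative form in which `NoSwap` provides it; it holds in both
  -- directions within a class.
  _⋠_ : RuleName TA → RuleName TA → Set
  r ⋠ r′ = ¬ (r′ ≺lin r)

  Sorted : Schedule TA → Set
  Sorted = AllPairs (λ s t → rule s ⋠ rule t)

  -- Transitivity of a negated order rests on trichotomy. It lifts the absence of swaps between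
  -- neighbours to all pairs.
  ⋠-trans : ∀ {r₁ r₂ r₃} → r₁ ⋠ r₂ → r₂ ⋠ r₃ → r₁ ⋠ r₃
  ⋠-trans {r₁} {r₂} p q r₃≺r₁ with compare r₁ r₂
  ... | tri< r₁≺r₂ _ _ = q (≺-trans r₃≺r₁ r₁≺r₂)
  ... | tri≈ _ r₁∼r₂ _ = q (<-respʳ-≈ r₁∼r₂ r₃≺r₁)
  ... | tri> _ _ r₂≺r₁ = p r₂≺r₁

  Sorted-sort : ∀ τ → Sorted (sort τ)
  Sorted-sort τ = Linked⇒AllPairs (λ {t₁} {t₂} {t₃} → ⋠-trans {rule t₁} {rule t₂} {rule t₃}) (sort-NoSwap τ)

  Sorted-merge : ∀ {τ} → Sorted τ → Sorted (merge τ)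
  Sorted-merge []               = []
  Sorted-merge {t ∷ τ} (p ∷ ps) = go (merge τ) (All-merge {rule t ⋠_} p) (Sorted-merge ps)
    where
      go : ∀ τ → All (λ t′ → rule t ⋠ rule t′) τ → Sorted τ → Sorted (cons-merge t τ)
      go []       q        qs       = q ∷ qs
      go (t′ ∷ τ) (q ∷ q′) (r ∷ qs) with rule t Fin.≟ rule t′
      ... | yes _ = q′ ∷ qs
      ... | no  _ = (q ∷ q′) ∷ r ∷ qs

-- Paths, loops and simple cycles.

Unique-resp-↭ : ∀ {A : Set} {xs ys : List A} → xs ↭ ys → Unique xs → Unique ys
Unique-resp-↭ {A} p = Permutationₛ.Unique-resp-↭ (setoid A) (↭⇒↭ₛ p)

module Cycles (TA : ThresholdAutomaton) where
  open ThresholdAutomaton TA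
  open R TA
  open Tokens TA using (SelfLoop)

  Path-++⁺ : ∀ {a b c} rs {rs′} → Path TA a rs b → Path TA b rs′ c → Path TA a (rs ++ rs′) c
  Path-++⁺ []       refl    p′ = p′
  Path-++⁺ (r ∷ rs) (e , p) p′ = e , Path-++⁺ rs p p′

  Path-++⁻ : ∀ {a c} rs {rs′} → Path TA a (rs ++ rs′) c → ∃ λ b → Path TA a rs b × Path TA b rs′ c
  Path-++⁻ []       p       = _ , refl , p
  Path-++⁻ (r ∷ rs) (e , p) with Path-++⁻ rs p
  ... | b , p₁ , p₂ = b , (e , p₁) , p₂

  -- Both sides list the nodes of the path. Targets are thus sources shifted by one, which lets
  -- distinctness of sources speak about targets.
  Path-tos : ∀ {a z} rs → Path TA a rs z → a ∷ map to rs ≡ map from rs ++ [ z ]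
  Path-tos []       refl       = refl
  Path-tos (r ∷ rs) (refl , p) = cong (from r ∷_) (Path-tos rs p)

  Path-to : ∀ {a z q} rs → Path TA a rs z → q ∈ rs → to q ∈ map from rs ++ [ z ]
  Path-to rs p q∈ = subst (_ ∈_) (Path-tos rs p) (there (∈-map⁺ to q∈))

  ≺P⁺⇒Path : ∀ {r q} → _≺P⁺_ TA r q → ∃ λ rs → Path TA (from r) (r ∷ rs) (from q)
  ≺P⁺⇒Path [ e ]⁺  = [] , refl , e
  ≺P⁺⇒Path (e ∷ x) with ≺P⁺⇒Path x
  ... | rs , _ , p = _ ∷ rs , refl , sym e , p

  Path⇒≺P⁺ : ∀ {a z r q} rs → Path TA a (r ∷ rs) z → q ∈ rs → _≺P⁺_ TA r q
  Path⇒≺P⁺ (r′ ∷ rs) (_ , e , p) (here refl) = [ sym e ]⁺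
  Path⇒≺P⁺ (r′ ∷ rs) (_ , e , p) (there q∈)  = sym e ∷ Path⇒≺P⁺ rs (e , p) q∈

  ≺P⁺⇒OnCycle : ∀ {r} → _≺P⁺_ TA r r → OnCycle TA r
  ≺P⁺⇒OnCycle x with ≺P⁺⇒Path x
  ... | rs , p = _ , ((λ ()) , _ , p) , here refl

  -- A loop read from another starting rule. A permutation suffices as the link to the original,
  -- since only membership and distinctness are carried over.
  record ClosedFrom (r : RuleName TA) (rs : List (RuleName TA)) : Set where
    constructor closedFrom
    field
      rest   : List (RuleName TA)
      path   : Path TA (from r) (r ∷ rest) (from r)
      unique : Unique (map from (r ∷ rest))
      perm   : rs ↭ r ∷ rest

  rotate : ∀ {rs r} → IsLoop TA rs → r ∈ rs → ClosedFrom r rs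
  rotate {rs} {r} ((_ , ℓ , p) , unique) r∈ with ∈-∃++ r∈
  ... | xs , ys , refl with Path-++⁻ xs p
  ... | b , p₁ , refl , p₂ = closedFrom (ys ++ xs) (refl , Path-++⁺ ys p₂ p₁)
    (Unique-resp-↭ (↭.map⁺ from perm) unique) perm
    where
      perm : xs ++ r ∷ ys ↭ r ∷ ys ++ xs
      perm = ++-comm xs (r ∷ ys)

  loop-∼P : ∀ {rs r q} → IsLoop TA rs → r ∈ rs → q ∈ rs → _∼P_ TA r q
  loop-∼P loop r∈ q∈ with rotate loop r∈ | rotate loop q∈
  ... | closedFrom ps p _ perm | closedFrom qs p′ _ perm′ with ∈-resp-↭ perm q∈ | ∈-resp-↭ perm′ r∈
  ... | here q≡r  | _         = inj₂ (sym q≡r)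
  ... | there _   | here r≡q  = inj₂ r≡q
  ... | there q∈′ | there r∈′ = inj₁ (Path⇒≺P⁺ ps p q∈′ , Path⇒≺P⁺ qs p′ r∈′)

  -- A rule following the self-loop would start at the same location, against the distinct sources
  -- of a loop.
  IsLoop-selfLoop : ∀ {rs r} → IsLoop TA rs → r ∈ rs → SelfLoop r → rs ≡ [ r ]
  IsLoop-selfLoop {rs} loop r∈ self with rotate loop r∈
  ... | closedFrom []       _           _      perm = ↭.↭-singleton-inv perm
  ... | closedFrom (q ∷ ps) (_ , e , p) unique perm =
    contradiction (here (trans self (sym e))) (Unique[x∷xs]⇒x∉xs unique)

  IsLoop-noSelfLoops : ∀ {rs r q} → IsLoop TA rs → r ∈ rs → ¬ SelfLoop r → q ∈ rs → ¬ SelfLoop q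
  IsLoop-noSelfLoops loop r∈ ¬self q∈ self with IsLoop-selfLoop loop q∈ self
  IsLoop-noSelfLoops loop (here refl) ¬self q∈ self | refl = ¬self self

  -- On a closed path the targets are a rotation of the sources, hence distinct as well; and one
  -- rule that is no self-loop excludes self-loops from the whole loop.
  IsLoop⇒NodeDisjoint : ∀ {a rs r} → Path TA a rs a → Unique (map from rs) → r ∈ rs → ¬ SelfLoop r →
    NodeDisjointPath TA a a rs
  IsLoop⇒NodeDisjoint {a} {rs} {r} p unique r∈ ¬self =
    nonempty r∈ , p , All.tabulate (IsLoop-noSelfLoops ((nonempty r∈ , a , p) , unique) r∈ ¬self) ,
    unique , Unique-resp-↭ (↭-sym (drop-∷ (↭-trans (↭-reflexive (Path-tos rs p)) (++-comm (map from rs) [ a ])))) unique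
    where
      nonempty : ∀ {rs : List (RuleName TA)} → r ∈ rs → rs ≢ []
      nonempty () refl

  -- The field `z∉` allows a rule starting at `z` to be appended with the sources still distinct,
  -- which is how a path is closed up in `enters-loop`.
  record SimplePath (a z : Loc TA) : Set where
    constructor simplePath
    field
      edges  : List (RuleName TA)
      path   : Path TA a edges z
      unique : Unique (map from edges)
      z∉     : z ∉ map from edges

  open DecMembership (Fin._≟_ {|L|}) using (_∈?_)

  -- Loop erasure from the back: if the new start occurs on the erased remainder, everything before
  -- that occurrence is dropped.
  erase : ∀ {a z} rs → Path TA a rs z → SimplePath a z
  erase []       refl = simplePath [] refl [] (λ ())
  erase {z = z} (r ∷ rs) (refl , p) with erase rs p | from r Fin.≟ z
  ... | _                            | yes refl = simplePath [] refl [] (λ ())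
  ... | simplePath es pe unique z∉   | no r≢z with from r ∈? map from es
  ...   | no r∉ = simplePath (r ∷ es) (refl , pe) (All.¬Any⇒All¬ _ r∉ ∷ unique)
                    (λ { (here eq) → r≢z (sym eq) ; (there z∈) → z∉ z∈ })
  ...   | yes r∈ with ∈-map⁻ from r∈
  ...     | q , q∈ , eq with ∈-∃++ q∈
  ...       | xs , ys , refl with Path-++⁻ xs pe
  ...         | b , _ , e , p₂ rewrite eq = simplePath (q ∷ ys) (refl , p₂) (suffix xs unique)
                                     (λ z∈ → z∉ (subst (z ∈_) (sym (map-++ from xs (q ∷ ys))) (∈-++⁺ʳ (map from xs) z∈)))
    where
      suffix : ∀ xs {ys} → Unique (map from (xs ++ ys)) → Unique (map from ys)
      suffix []       u       = u
      suffix (x ∷ xs) (_ ∷ u) = suffix xs u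

  -- Otherwise the loop and a simple closed path ending in s would be two
  -- node-disjoint closed paths through to s.
  enters-loop : AllCyclesSimple TA → ∀ {rs s t} → IsLoop TA rs → t ∈ rs →
    to s ≡ from t → _∼P_ TA s t → ¬ SelfLoop s → ¬ SelfLoop t → s ∈ rs
  enters-loop simple loop t∈ _  (inj₂ refl) _ _ = t∈
  enters-loop simple {rs} {s} {t} loop t∈ eq (inj₁ (_ , t≺⁺s)) ¬self-s ¬self-t
    with rotate loop t∈ | erase _ (proj₂ (≺P⁺⇒Path t≺⁺s))
  ... | closedFrom ps p unique perm | simplePath es pe unique′ s∉ =
    ∈-resp-↭ (↭-sym perm) (subst (s ∈_) (trans (sym (only c-disjoint)) (only l-disjoint)) (∈-insert es))
    where
      l-disjoint : NodeDisjointPath TA (from t) (from t) (t ∷ ps)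
      l-disjoint = IsLoop⇒NodeDisjoint p unique (here refl) ¬self-t
      c-disjoint : NodeDisjointPath TA (from t) (from t) (es ++ [ s ])
      c-disjoint = IsLoop⇒NodeDisjoint (Path-++⁺ es pe (refl , eq))
        (subst Unique (sym (map-++ from es [ s ]))
          (Unique-resp-↭ (++-comm [ from s ] (map from es)) (All.¬Any⇒All¬ _ s∉ ∷ unique′)))
        (∈-insert es) ¬self-s
      ex = simple (t ∷ ps) ((λ ()) , from t , p) (proj₁ (proj₂ (proj₂ l-disjoint)))
             (from t) (from t) (here refl) (here refl)
      only : ∀ {c} → NodeDisjointPath TA (from t) (from t) c → proj₁ ex ≡ c
      only = proj₂ (proj₂ ex)

-- Splitting lists and counting occurrences.

data Span {A : Set} (P : Pred A 0ℓ) (xs : List A) : List A × List A → Set where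
  all  : All P xs → Span P xs (xs , [])
  stop : ∀ {ys z zs} → All P ys → ¬ P z → xs ≡ ys ++ z ∷ zs → Span P xs (ys , z ∷ zs)

span-view : ∀ {A : Set} {P : Pred A 0ℓ} (P? : Decidable P) xs → Span P xs (span P? xs)
span-view P? []       = all []
span-view P? (x ∷ xs) with P? x
... | no ¬Px = stop [] ¬Px refl
... | yes Px with span P? xs | span-view P? xs
...   | _ | all Pxs           = all (Px ∷ Pxs)
...   | _ | stop Pys ¬Pz refl = stop (Px ∷ Pys) ¬Pz refl

occ : ∀ {n} → Fin n → List (Fin n) → ℕ
occ i []       = 0
occ i (j ∷ js) = δ i j + occ i js

occ-++ : ∀ {n} (i : Fin n) js ks → occ i (js ++ ks) ≡ occ i js + occ i ks
occ-++ i []       ks = refl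
occ-++ i (j ∷ js) ks = trans (cong (δ i j +_) (occ-++ i js ks)) (sym (+-assoc (δ i j) _ _))

occ-∉ : ∀ {n} {i : Fin n} js → i ∉ js → occ i js ≡ 0
occ-∉ []       _  = refl
occ-∉ {i = i} (j ∷ js) i∉ = cong₂ _+_ (δ-≢ {i = i} {j} (i∉ ∘ here)) (occ-∉ js (i∉ ∘ there))

occ-∈ : ∀ {n} {i : Fin n} {js} → Unique js → i ∈ js → occ i js ≡ 1
occ-∈ {i = i} {_ ∷ js} u@(_ ∷ _) (here refl) = cong₂ _+_ (δ-refl i) (occ-∉ js (Unique[x∷xs]⇒x∉xs u))
occ-∈ {i = i} {j ∷ _} (j≢ ∷ u) (there i∈) =
  cong₂ _+_ (δ-≢ {i = i} {j} (λ eq → All.lookup j≢ i∈ (sym eq))) (occ-∈ u i∈)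

occ-unique : ∀ {n} (i : Fin n) {js} → Unique js → occ i js ≤ 1
occ-unique i {js} u with DecMembership._∈?_ Fin._≟_ i js
... | yes i∈ = ≤-reflexive (occ-∈ u i∈)
... | no  i∉ = subst (_≤ 1) (sym (occ-∉ js i∉)) z≤n

occ-filter : ∀ {A : Set} {P : Pred A 0ℓ} (P? : Decidable P) {n} (f : A → Fin n) i xs →
  occ i (map f (filter P? xs)) ≤ occ i (map f xs)
occ-filter P? f i []       = z≤n
occ-filter P? f i (x ∷ xs) with does (P? x)
... | true  = +-monoʳ-≤ (δ i (f x)) (occ-filter P? f i xs)
... | false = m≤n⇒m≤o+n (δ i (f x)) (occ-filter P? f i xs)

-- Replacing the transitions of one loop.

module LoopReplacement {TA : ThresholdAutomaton} (lin : LinearExtension TA) where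
  open ThresholdAutomaton TA
  open R TA
  open Config using (κ)
  open Transition
  open Tokens TA
  open Rearrange TA
  open Cycles TA
  open Srep lin
  open DecMembership (Fin._≟_ {|L|}) using () renaming (_∈?_ to _∈ℓ?_)

  runK-frame : ∀ τ v {ℓ} → All (λ t → ℓ ≢ from (rule t) × ℓ ≢ to (rule t)) τ → lookup (runK τ v) ℓ ≡ lookup v ℓ
  runK-frame []      v []             = refl
  runK-frame (t ∷ τ) v ((≢f , ≢t) ∷ ps) = trans (runK-frame τ (stepK t v) ps) (stepK-other (factor t) v ≢f ≢t)

  rule-flush : ∀ b rs σ → map rule (flush b rs σ) ≡ rs
  rule-flush b []       σ = refl
  rule-flush b (r ∷ rs) σ = cong (r ∷_) (rule-flush b rs _)

  -- A flush leaves the minimum of the bound and the current counter behind, and the floor is below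
  -- both.
  FiresAll-flush : ∀ {c b} rs σ → (∀ ℓ → c ℓ ≤ b ℓ) → Above c (κ σ) → FiresAll c (flush b rs σ) (κ σ)
  FiresAll-flush         []       σ c≤b above = []
  FiresAll-flush {c} {b} (r ∷ rs) σ c≤b above = o ∷ FiresAll-flush rs _ c≤b (stepK-above _ o above)
    where
      ℓ = from r
      x = lookup (κ σ) ℓ
      o : Fires c (r ,ₜ (x ∸ b ℓ)) (κ σ)
      o = moves (begin
        x ∸ b ℓ + c ℓ       ≤⟨ +-monoʳ-≤ (x ∸ b ℓ) (⊓-glb (c≤b ℓ) (above ℓ)) ⟩
        x ∸ b ℓ + b ℓ ⊓ x   ≡⟨ +-comm (x ∸ b ℓ) _ ⟩
        b ℓ ⊓ x + (x ∸ b ℓ) ≡⟨ m⊓n+n∸m≡n (b ℓ) x ⟩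
        x                   ∎)
        where open ≤-Reasoning

  -- A location is cut down to its bound when its rule fires last, and nothing arrives afterwards:
  -- the target of a rule on the path is the source of the next one or the endpoint `z`. Only `z`
  -- may be refilled. The disjunction says that `ℓ` is yet to be flushed or is settled already.
  flush-≤ : ∀ {a z b} rs σ → Path TA a rs z → ∀ {ℓ} → ℓ ≢ z →
    ℓ ∈ map from rs ⊎ lookup (κ σ) ℓ ≤ b ℓ → lookup (runK (flush b rs σ) (κ σ)) ℓ ≤ b ℓ
  flush-≤ []       σ p       ℓ≢z (inj₂ le) = le
  flush-≤ {b = b} (r ∷ rs) σ (_ , p) {ℓ} ℓ≢z h = flush-≤ rs _ p ℓ≢z h′
    where
      v = κ σ
      f = lookup v (from r) ∸ b (from r)
      h′ : ℓ ∈ map from rs ⊎ lookup (stepK (r ,ₜ f) v) ℓ ≤ b ℓ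
      h′ with ℓ ∈ℓ? map from rs
      ... | yes ℓ∈ = inj₁ ℓ∈
      ... | no ℓ∉ = inj₂ (go (ℓ Fin.≟ from r) h)
        where
          ℓ≢to : ℓ ≢ to r
          ℓ≢to refl with ∈-++⁻ (map from rs) (subst (to r ∈_) (Path-tos rs p) (here refl))
          ... | inj₁ ∈rs      = ℓ∉ ∈rs
          ... | inj₂ (here e) = ℓ≢z e
          go : Dec (ℓ ≡ from r) → ℓ ∈ map from (r ∷ rs) ⊎ lookup v ℓ ≤ b ℓ → lookup (stepK (r ,ₜ f) v) ℓ ≤ b ℓ
          go (yes refl) _ = subst (_≤ b ℓ) (sym (stepK-from f v ℓ≢to))
            (m≤n+o⇒m∸n≤o _ f (subst (lookup v ℓ ≤_) (+-comm (b ℓ) f) (m≤n+m∸n _ (b ℓ))))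
          go (no ≢from) (inj₁ (here e))   = contradiction e ≢from
          go (no ≢from) (inj₁ (there ℓ∈)) = contradiction ℓ∈ ℓ∉
          go (no ≢from) (inj₂ le)         = subst (_≤ b ℓ) (sym (stepK-other f v ≢from ℓ≢to)) le

  total : Counters → List (RuleName TA) → ℕ
  total v rs = sum (map (lookup v ∘ from) rs)

  total-mono : ∀ v e rs → All (λ q → lookup v (from q) ≤ lookup e (from q)) rs → total v rs ≤ total e rs
  total-mono v e []       []         = z≤n
  total-mono v e (r ∷ rs) (le ∷ les) = +-mono-≤ le (total-mono v e rs les)

  total-cong : ∀ v e {rs} → All (λ q → lookup v (from q) ≡ lookup e (from q)) rs → total v rs ≡ total e rs
  total-cong v e eqs = cong sum (map-cong-local eqs)

  -- A pass empties the surplus of each location into the next one; as no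
  -- later location has a surplus of its own, equal totals force equality.
  flush-settles : ∀ {a z} e r rs σ → Path TA a (r ∷ rs) z → Unique (map from (r ∷ rs)) →
    total (κ σ) (r ∷ rs) ≡ total e (r ∷ rs) →
    All (λ q → lookup (κ σ) (from q) ≤ lookup e (from q)) rs →
    (∀ ℓ → ℓ ∉ map from (r ∷ rs) → lookup (κ σ) ℓ ≡ lookup e ℓ) →
    runK (flush (lookup e) (r ∷ rs) σ) (κ σ) ≡ e
  flush-settles e r [] σ p unique totals les eqs = begin
    stepK (r ,ₜ (x ∸ y)) (κ σ) ≡⟨ cong (λ f → stepK (r ,ₜ f) (κ σ)) (trans (cong (_∸ y) x≡y) (n∸n≡0 y)) ⟩
    stepK (r ,ₜ 0) (κ σ)       ≡⟨ stepK-zero r (κ σ) ⟩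
    κ σ                        ≡⟨ lookup-ext same ⟩
    e                          ∎
    where
      open ≡-Reasoning
      x = lookup (κ σ) (from r)
      y = lookup e (from r)
      x≡y : x ≡ y
      x≡y = +-cancelʳ-≡ 0 x y totals
      same : ∀ ℓ → lookup (κ σ) ℓ ≡ lookup e ℓ
      same ℓ with ℓ Fin.≟ from r
      ... | yes refl = x≡y
      ... | no ≢from = eqs ℓ (λ { (here eq) → ≢from eq })
  flush-settles e r (r′ ∷ rs) σ (_ , p@(from≡to , _)) (from≢ ∷ unique@(from′≢ ∷ _)) totals (le ∷ les) eqs =
    flush-settles e r′ rs (step (r ,ₜ f) σ) p unique totals′ les′ eqs′
    where
      v = κ σ
      x = lookup v (from r)
      y = lookup e (from r)
      f = x ∸ y
      ¬self : ¬ SelfLoop r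
      ¬self eq = All.head from≢ (trans eq (sym from≡to))
      v′ = stepK (r ,ₜ f) v
      others : ∀ {q} → q ∈ rs → lookup v′ (from q) ≡ lookup v (from q)
      others q∈ = stepK-other f v (λ eq → All.lookup from≢ (there (∈-map⁺ from q∈)) (sym eq))
                                  (λ eq → All.lookup from′≢ (∈-map⁺ from q∈) (trans from≡to (sym eq)))
      -- The later locations have no surplus over `e`, so equal totals leave no deficit at `from r`;
      -- the truncated difference `f` is then exact.
      y≤x : y ≤ x
      y≤x = +-cancelʳ-≤ (total v (r′ ∷ rs)) y x (begin
        y + total v (r′ ∷ rs) ≤⟨ +-monoʳ-≤ y (total-mono v e (r′ ∷ rs) (le ∷ les)) ⟩
        y + total e (r′ ∷ rs) ≡⟨ totals ⟨
        x + total v (r′ ∷ rs) ∎)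
        where open ≤-Reasoning
      totals′ : total v′ (r′ ∷ rs) ≡ total e (r′ ∷ rs)
      totals′ = +-cancelˡ-≡ y _ _ (begin
        y + (lookup v′ (from r′) + total v′ rs)
          ≡⟨ cong (y +_) (cong₂ _+_ (trans (cong (lookup v′) from≡to) (trans (stepK-to f v ¬self) (cong (λ ℓ → lookup v ℓ + f) (sym from≡to))))
                                    (total-cong v′ v (All.tabulate others))) ⟩
        y + (lookup v (from r′) + f + total v rs)
          ≡⟨ solve 4 (λ y z f t → y :+ (z :+ f :+ t) := (y :+ f) :+ (z :+ t)) refl y (lookup v (from r′)) f (total v rs) ⟩
        (y + f) + total v (r′ ∷ rs)
          ≡⟨ cong (_+ total v (r′ ∷ rs)) (m+[n∸m]≡n y≤x) ⟩
        x + total v (r′ ∷ rs)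
          ≡⟨ totals ⟩
        y + total e (r′ ∷ rs) ∎)
        where
          open ≡-Reasoning
          open +-*-Solver
      les′ : All (λ q → lookup v′ (from q) ≤ lookup e (from q)) rs
      les′ = All.tabulate λ {q} q∈ → subst (_≤ lookup e (from q)) (sym (others q∈)) (All.lookup les q∈)
      eqs′ : ∀ ℓ → ℓ ∉ map from (r′ ∷ rs) → lookup v′ ℓ ≡ lookup e ℓ
      eqs′ ℓ ℓ∉ with ℓ Fin.≟ from r
      ... | yes refl = trans (stepK-from f v ¬self) (m∸[m∸n]≡n y≤x)
      ... | no ≢from = trans (stepK-other f v ≢from (λ eq → ℓ∉ (here (trans eq (sym from≡to)))))
                             (eqs ℓ λ { (here eq) → ≢from eq ; (there ℓ∈) → ℓ∉ ℓ∈ })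

  module _ {rs} (loop : IsLoop TA rs) where

    to∈froms : ∀ {r} → r ∈ rs → to r ∈ map from rs
    to∈froms r∈ with rotate loop r∈
    ... | closedFrom [] (_ , eq) _ _ = subst (_∈ map from rs) (sym eq) (∈-map⁺ from r∈)
    ... | closedFrom (q ∷ _) (_ , eq , _) _ perm =
      subst (_∈ map from rs) eq (∈-map⁺ from (∈-resp-↭ (↭-sym perm) (there (here refl))))

    -- Source and target of a loop rule are each listed exactly once among the sources of the loop,
    -- so the sum loses and gains the same factor.
    total-step : ∀ {c} t v → rule t ∈ rs → Fires c t v → total (stepK t v) rs ≡ total v rs
    total-step t v r∈ o = +-cancelʳ-≡ (factor t) _ _ (begin
      total v′ rs + factor t                               ≡⟨ cong (total v′ rs +_) (*-identityʳ (factor t)) ⟨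
      total v′ rs + factor t * 1                           ≡⟨ cong (λ x → total v′ rs + factor t * x) (occ-∈ (proj₂ loop) (∈-map⁺ from r∈)) ⟨
      total v′ rs + factor t * occ (from (rule t)) (map from rs) ≡⟨ go rs ⟩
      total v rs + factor t * occ (to (rule t)) (map from rs) ≡⟨ cong (λ x → total v rs + factor t * x) (occ-∈ (proj₂ loop) (to∈froms r∈)) ⟩
      total v rs + factor t * 1                            ≡⟨ cong (total v rs +_) (*-identityʳ (factor t)) ⟩
      total v rs + factor t                                ∎)
      where
        open ≡-Reasoning
        open +-*-Solver
        v′ = stepK t v
        regroup : ∀ x y f d o → (x + y) + f * (d + o) ≡ (x + f * d) + (y + f * o)
        regroup = solve 5 (λ x y f d o → (x :+ y) :+ f :* (d :+ o) := (x :+ f :* d) :+ (y :+ f :* o)) refl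
        go : ∀ qs → total v′ qs + factor t * occ (from (rule t)) (map from qs)
                  ≡ total v qs + factor t * occ (to (rule t)) (map from qs)
        go []       = refl
        go (q ∷ qs) = begin
          (lookup v′ (from q) + total v′ qs) + factor t * (δ (from (rule t)) (from q) + occ (from (rule t)) (map from qs))
            ≡⟨ regroup (lookup v′ (from q)) (total v′ qs) (factor t) _ _ ⟩
          (lookup v′ (from q) + factor t * δ (from (rule t)) (from q)) + (total v′ qs + factor t * occ (from (rule t)) (map from qs))
            ≡⟨ cong₂ _+_ (stepK-flow t v o (from q)) (go qs) ⟩
          (lookup v (from q) + factor t * δ (to (rule t)) (from q)) + (total v qs + factor t * occ (to (rule t)) (map from qs))
            ≡⟨ regroup (lookup v (from q)) (total v qs) (factor t) _ _ ⟨
          (lookup v (from q) + total v qs) + factor t * (δ (to (rule t)) (from q) + occ (to (rule t)) (map from qs)) ∎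

    total-run : ∀ {c} τ v → All (λ t → rule t ∈ rs) τ → FiresAll c τ v → total (runK τ v) rs ≡ total v rs
    total-run []      v []        []      = refl
    total-run (t ∷ τ) v (r∈ ∷ ∈s) (o ∷ x) = trans (total-run τ (stepK t v) ∈s x) (total-step t v r∈ o)

    outside-loop : ∀ τ v → All (λ t → rule t ∈ rs) τ → ∀ ℓ → ℓ ∉ map from rs → lookup (runK τ v) ℓ ≡ lookup v ℓ
    outside-loop τ v ∈s ℓ ℓ∉ = runK-frame τ v (All.map (λ r∈ →
      (λ { refl → ℓ∉ (∈-map⁺ from r∈) }) , (λ { refl → ℓ∉ (to∈froms r∈) })) ∈s)

  rules∈ : ∀ {rs} (τ : Schedule TA) → map rule τ ≡ rs → All (λ t → rule t ∈ rs) τ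
  rules∈ τ refl = All.tabulate (∈-map⁺ rule)

  module _ (b : Loc TA → ℕ) (rs : List (RuleName TA)) (σ : Config TA) where
    -- The two rounds of `loopTransitions` for a loop whose rules all appear, with the bound of the
    -- first round and the goal of the second left free.
    flush² : Counters → Schedule TA
    flush² e = flush b rs σ ++ flush (lookup e) rs (run (flush b rs σ) σ)

    rule-flush² : ∀ e → map rule (flush² e) ≡ rs ++ rs
    rule-flush² e = trans (map-++ rule (flush b rs σ) _) (cong₂ _++_ (rule-flush b rs _) (rule-flush (lookup e) rs _))

    FiresAll-flush² : ∀ {c e} → (∀ ℓ → c ℓ ≤ b ℓ) → Above c e → Above c (κ σ) → FiresAll c (flush² e) (κ σ)
    FiresAll-flush² {c} {e} c≤b c≤e above = FiresAll-++⁺ first fires₁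
      (subst (FiresAll c _) (κ-run first σ) (FiresAll-flush rs _ c≤e
        (subst (Above c) (sym (κ-run first σ)) (runK-above first fires₁ above))))
      where
        first  = flush b rs σ
        fires₁ = FiresAll-flush rs σ c≤b above

  -- The first round lowers every location of the loop except its start to at most `b`, hence to at
  -- most `e`, and conserves the total. All surplus then sits at the start, the situation in which
  -- `flush-settles` makes the second round reach `e`.
  runK-flush² : ∀ {c b rs} σ {e} → IsLoop TA rs → (∀ ℓ → c ℓ ≤ b ℓ) → (∀ ℓ → b ℓ ≤ lookup e ℓ) →
    Above c (κ σ) → total (κ σ) rs ≡ total e rs → (∀ ℓ → ℓ ∉ map from rs → lookup (κ σ) ℓ ≡ lookup e ℓ) →
    runK (flush² b rs σ e) (κ σ) ≡ e
  runK-flush² {rs = []} σ ((rs≢[] , _) , _) _ _ _ _ _ = contradiction refl rs≢[]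
  runK-flush² {c} {b} {r ∷ rs} σ {e} loop@((_ , a , p@(refl , _)) , unique@(from≢ ∷ _)) c≤b b≤e above totals eqs = begin
    runK (first ++ second) (κ σ)    ≡⟨ runK-++ first second (κ σ) ⟩
    runK second (runK first (κ σ))  ≡⟨ cong (runK second) (κ-run first σ) ⟨
    runK second (κ σ₁)              ≡⟨ flush-settles e r rs σ₁ p unique totals′ les eqs′ ⟩
    e                               ∎
    where
      open ≡-Reasoning
      first = flush b (r ∷ rs) σ
      σ₁ = run first σ
      second = flush (lookup e) (r ∷ rs) σ₁
      ∈s = rules∈ first (rule-flush b (r ∷ rs) σ)
      totals′ : total (κ σ₁) (r ∷ rs) ≡ total e (r ∷ rs)
      totals′ = trans (cong (λ v → total v (r ∷ rs)) (κ-run first σ))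
        (trans (total-run loop first (κ σ) ∈s (FiresAll-flush (r ∷ rs) σ c≤b above)) totals)
      les : All (λ q → lookup (κ σ₁) (from q) ≤ lookup e (from q)) rs
      les = All.tabulate λ {q} q∈ → ≤-trans (≤-reflexive (cong (λ v → lookup v (from q)) (κ-run first σ)))
        (≤-trans (flush-≤ {b = b} (r ∷ rs) σ p (λ eq → All.lookup from≢ (∈-map⁺ from q∈) (sym eq)) (inj₁ (∈-map⁺ from (there q∈))))
                 (b≤e (from q)))
      eqs′ : ∀ ℓ → ℓ ∉ map from (r ∷ rs) → lookup (κ σ₁) ℓ ≡ lookup e ℓ
      eqs′ ℓ ℓ∉ = trans (cong (λ v → lookup v ℓ) (κ-run first σ)) (trans (outside-loop loop first (κ σ) ∈s ℓ ℓ∉) (eqs ℓ ℓ∉))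

  weight-≡0 : ∀ {w} τ → All (λ t → w (rule t) ≡ 0) τ → weight w τ ≡ 0
  weight-≡0 []      []         = refl
  weight-≡0 (t ∷ τ) (eq ∷ eqs) = cong₂ _+_ (trans (cong (factor t *_) eq) (*-zeroʳ (factor t))) (weight-≡0 τ eqs)

  totalFactor-weight : ∀ τ r → totalFactor τ r ≡ weight (λ q → δ q r) τ
  totalFactor-weight []      r = refl
  totalFactor-weight (t ∷ τ) r with rule t Fin.≟ r
  ... | yes refl = cong₂ _+_ (sym (*-identityʳ (factor t))) (totalFactor-weight τ r)
  ... | no _     = cong₂ _+_ (sym (*-zeroʳ (factor t))) (totalFactor-weight τ r)

  totalFactor-∉ : ∀ {τ r} → r ∉ map rule τ → totalFactor τ r ≡ 0
  totalFactor-∉ {τ} {r} r∉ = trans (totalFactor-weight τ r)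
    (weight-≡0 τ (All.tabulate λ {t} t∈ → δ-≢ {i = rule t} {r} λ { refl → r∉ (∈-map⁺ rule t∈) }))

  totals : Schedule TA → List (RuleName TA) → Schedule TA
  totals τ = map (λ r → r ,ₜ totalFactor τ r)

  module _ {c : Loc TA → ℕ} where

    Fires-sum : ∀ {q} τ {v} → All (λ t → rule t ≡ q) τ → Above c v → FiresAll c τ v →
      Fires c (q ,ₜ sum (map factor τ)) v
    Fires-sum []      []          above _       = moves (above _)
    Fires-sum (t ∷ τ) (refl ∷ eqs) above (o ∷ x)
      with FiresAll-merge {τ = []} (o ∷ Fires-sum τ eqs (stepK-above t o above) x ∷ [])
    ... | o′ ∷ [] = o′

    weight-sum : ∀ w {q} τ → All (λ t → rule t ≡ q) τ → weight w τ ≡ sum (map factor τ) * w q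
    weight-sum w []      []           = refl
    weight-sum w {q} (t ∷ τ) (refl ∷ eqs) = trans (cong (factor t * w q +_) (weight-sum w τ eqs))
      (sym (*-distribʳ-+ (w q) (factor t) (sum (map factor τ))))

    -- No later rule of `qs` supplies an earlier one. So all uses of the first rule can be pulled to
    -- the front and added up, and the rest follows by recursion.
    totals-fires : ∀ qs τ {v} → AllPairs (λ q q′ → to q′ ≢ from q) qs → Unique qs →
      All (λ t → rule t ∈ qs) τ → Above c v → FiresAll c τ v →
      FiresAll c (totals τ qs) v × runK (totals τ qs) v ≡ runK τ v
    totals-fires []       []      [] [] []         above x = [] , refl
    totals-fires []       (_ ∷ _) [] [] (() ∷ _)   above x
    totals-fires (q ∷ qs) τ {v} (to≢ ∷ path) (q≢ ∷ unique) ∈s above x =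
      -- The recursion sums over `outs` instead of τ. The sums agree because removing the uses of
      -- `q` does not affect the other rules.
      subst (λ ts → FiresAll c (tq ∷ ts) v × runK (tq ∷ ts) v ≡ runK τ v) (map-cong-local same-totals)
        ( o ∷ subst (FiresAll c _) (sym step≡) (proj₁ rec)
        , trans (cong (runK (totals outs qs)) step≡) (trans (proj₂ rec) (sym run-τ)) )
      where
        q? = λ (t : Transition TA) → rule t Fin.≟ q
        ins outs : Schedule TA
        ins  = filter q? τ
        outs = filter (¬? ∘ q?) τ
        tq : Transition TA
        tq   = q ,ₜ totalFactor τ q
        in-q : All (λ t → rule t ≡ q) ins
        in-q = All.all-filter q? τ
        narrow : ∀ {r} → r ∈ q ∷ qs → r ≢ q → r ∈ qs
        narrow (here eq)  r≢q = contradiction eq r≢q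
        narrow (there r∈) _   = r∈
        allPairs : ∀ {τ} → All (λ t → rule t ∈ q ∷ qs) τ →
          AllPairs (λ s t → rule s ≢ q → rule t ≡ q → Commutes (rule s) (rule t)) τ
        allPairs []            = []
        allPairs (s∈ ∷ ss) = All.tabulate (λ { {t} _ s≢q refl → inj₂ (inj₂ (All.lookup to≢ (narrow s∈ s≢q))) }) ∷ allPairs ss
        split : FiresAll c ins v × FiresAll c outs (runK ins v)
        split = FiresAll-++⁻ ins (FiresAll-partition q? (allPairs ∈s) x)
        run-τ : runK τ v ≡ runK outs (runK ins v)
        run-τ = trans (runK-partition q? (allPairs ∈s) x) (runK-++ ins outs v)
        o : Fires c tq v
        o = Fires-sum ins in-q above (proj₁ split)
        step≡ : stepK tq v ≡ runK ins v
        step≡ = runK-weight (tq ∷ []) ins v (o ∷ []) (proj₁ split)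
          (λ w → trans (+-identityʳ _) (sym (weight-sum w ins in-q)))
        rec : FiresAll c (totals outs qs) (runK ins v) × runK (totals outs qs) (runK ins v) ≡ runK outs (runK ins v)
        rec = totals-fires qs outs path unique
          (All.zipWith (λ (r∈ , r≢) → narrow r∈ r≢) (All.filter⁺ (¬? ∘ q?) ∈s , All.all-filter (¬? ∘ q?) τ))
          (runK-above ins (proj₁ split) above) (proj₂ split)
        same-totals : All (λ r → (r ,ₜ totalFactor outs r) ≡ (r ,ₜ totalFactor τ r)) qs
        same-totals = All.map (λ {r} q≢r → cong (r ,ₜ_) (sym (begin
          totalFactor τ r                                 ≡⟨ totalFactor-weight τ r ⟩
          weight (λ q → δ q r) τ                          ≡⟨ trans (weight-partition (λ q → δ q r) q? τ) (weight-++ _ ins outs) ⟩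
          weight (λ q → δ q r) ins + weight (λ q → δ q r) outs
            ≡⟨ cong₂ _+_ (weight-≡0 ins (All.map (λ { refl → δ-≢ q≢r }) in-q)) (sym (totalFactor-weight outs r)) ⟩
          totalFactor outs r                              ∎))) q≢
          where open ≡-Reasoning

  zeros : List (RuleName TA) → Schedule TA
  zeros = map (_,ₜ 0)

  nonzero-zeros : ∀ rs → filter nonzero? (zeros rs) ≡ []
  nonzero-zeros []       = refl
  nonzero-zeros (r ∷ rs) = nonzero-zeros rs

  -- Without the zero factors the two rounds are a single pass along the loop cut open at the
  -- missing rule.
  nonzero-missing : ∀ σ₀ τ before r after →
    filter nonzero? (loopTransitions σ₀ τ (before , r ∷ after)) ≡ filter nonzero? (totals τ (after ++ before))
  nonzero-missing σ₀ τ before r after = begin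
    nz (zeros before ++ zeros [ r ] ++ totals τ after ++ totals τ before ++ zeros [ r ] ++ zeros after)
      ≡⟨ drop (zeros before) _ (nonzero-zeros before) ⟩
    nz (totals τ after ++ totals τ before ++ zeros [ r ] ++ zeros after)
      ≡⟨ filter-++ nonzero? (totals τ after) _ ⟩
    nz (totals τ after) ++ nz (totals τ before ++ zeros [ r ] ++ zeros after)
      ≡⟨ cong (nz (totals τ after) ++_) (filter-++ nonzero? (totals τ before) _) ⟩
    nz (totals τ after) ++ nz (totals τ before) ++ nz (zeros after)
      ≡⟨ cong (λ ts → nz (totals τ after) ++ nz (totals τ before) ++ ts) (nonzero-zeros after) ⟩
    nz (totals τ after) ++ nz (totals τ before) ++ []
      ≡⟨ cong (nz (totals τ after) ++_) (++-identityʳ _) ⟩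
    nz (totals τ after) ++ nz (totals τ before)
      ≡⟨ filter-++ nonzero? (totals τ after) _ ⟨
    nz (totals τ after ++ totals τ before)
      ≡⟨ cong nz (map-++ _ after before) ⟨
    nz (totals τ (after ++ before)) ∎
    where
      open ≡-Reasoning
      nz : Schedule TA → Schedule TA
      nz = filter nonzero?
      drop : ∀ xs ys → nz xs ≡ [] → nz (xs ++ ys) ≡ nz ys
      drop xs ys eq = trans (filter-++ nonzero? xs ys) (cong (_++ nz ys) eq)

  -- Removing one rule turns the loop into a path that ends at the source of this rule. Each target
  -- on it is the next source or that endpoint, and all of these are distinct, so no rule leads back
  -- to an earlier source.
  cut-loop : ∀ {a rs} before {r after} → rs ≡ before ++ r ∷ after → Path TA a rs a → Unique (map from rs) →
    AllPairs (λ q q′ → to q′ ≢ from q) (after ++ before) × Unique (after ++ before)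
  cut-loop before {r} {after} refl p unique with Path-++⁻ before p
  ... | _ , p₁ , refl , p₂ with Unique-resp-↭ (↭.map⁺ from (++-comm before (r ∷ after))) unique
  ...   | r≢ ∷ unique′ = go (after ++ before) (Path-++⁺ after p₂ p₁) r≢ unique′ , Unique.map⁻ unique′
    where
      go : ∀ {a z} qs → Path TA a qs z → All (z ≢_) (map from qs) → Unique (map from qs) →
        AllPairs (λ q q′ → to q′ ≢ from q) qs
      go []       _       _          _          = []
      go {z = z} (q ∷ qs) (_ , p) (z≢q ∷ z≢) (q≢ ∷ u) = All.tabulate later ∷ go qs p z≢ u
        where
          later : ∀ {q′} → q′ ∈ qs → to q′ ≢ from q
          later q′∈ eq with ∈-++⁻ (map from qs) (Path-to qs p q′∈)
          ... | inj₁ ∈qs      = All.lookup q≢ ∈qs (sym eq)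
          ... | inj₂ (here e) = z≢q (trans (sym e) eq)

  record Replaces (c : Loc TA → ℕ) (v : Counters) (τ π : Schedule TA) : Set where
    field
      fires : FiresAll c π v
      same  : runK π v ≡ runK τ v
      rules : All (λ t → rule t ∈ map rule τ) π

  Replaces-nonzero : ∀ {c v τ π} → Replaces c v τ π → Replaces c v τ (filter nonzero? π)
  Replaces-nonzero {π = π} rep = record
    { fires = FiresAll-nonzero π (Replaces.fires rep)
    ; same  = trans (runK-nonzero π _) (Replaces.same rep)
    ; rules = All.filter⁺ nonzero? (Replaces.rules rep)
    }

  loopSchedule-replaces : ∀ {c rs} σ₀ τ → IsLoop TA rs → All (λ t → rule t ∈ rs) τ →
    Above c (κ σ₀) → FiresAll c τ (κ σ₀) → Replaces c (κ σ₀) τ (loopSchedule σ₀ τ rs)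
  loopSchedule-replaces {c} {rs} σ₀ τ loop@((_ , a , path) , unique) ∈s above x
    with span (_∈? map rule τ) rs | span-view (_∈? map rule τ) rs
  ... | _ | all appear = Replaces-nonzero record
    { fires = FiresAll-flush² b rs σ₀ {e = e} c≤b c≤e above
    ; same  = trans (runK-flush² {b = b} σ₀ {e} loop c≤b (λ ℓ → m⊓n≤n _ _) above
                (trans (sym (total-run loop τ (κ σ₀) ∈s x)) (cong (λ v → total v rs) (sym e≡)))
                (λ ℓ ℓ∉ → trans (sym (outside-loop loop τ (κ σ₀) ∈s ℓ ℓ∉)) (cong (λ v → lookup v ℓ) (sym e≡)))) e≡
    ; rules = All.map⁻ (subst (All (_∈ map rule τ)) (sym (rule-flush² b rs σ₀ e)) (All.++⁺ appear appear))
    }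
    where
      e = κ (run τ σ₀)
      b = λ ℓ → lookup (κ σ₀) ℓ ⊓ lookup e ℓ
      e≡ : e ≡ runK τ (κ σ₀)
      e≡ = κ-run τ σ₀
      c≤e : Above c e
      c≤e = subst (Above c) (sym e≡) (runK-above τ x above)
      c≤b : ∀ ℓ → c ℓ ≤ b ℓ
      c≤b ℓ = ⊓-glb (above ℓ) (c≤e ℓ)
  ... | _ | stop {before} {r} {after} _ r∉ eq rewrite nonzero-missing σ₀ τ before r after = record
    { fires = FiresAll-nonzero π (proj₁ fires)
    ; same  = trans (runK-nonzero π (κ σ₀)) (proj₂ fires)
    ; rules = All.tabulate occurring
    }
    where
      cut = cut-loop before eq path unique
      π = totals τ (after ++ before)
      elsewhere : ∀ {q} → q ∈ rs → q ∈ map rule τ → q ∈ after ++ before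
      elsewhere q∈rs q∈τ with ∈-++⁻ before (subst (_ ∈_) eq q∈rs)
      ... | inj₁ q∈           = ∈-++⁺ʳ after q∈
      ... | inj₂ (here refl)  = contradiction q∈τ r∉
      ... | inj₂ (there q∈)   = ∈-++⁺ˡ q∈
      fires : FiresAll c π (κ σ₀) × runK π (κ σ₀) ≡ runK τ (κ σ₀)
      fires = totals-fires (after ++ before) τ (proj₁ cut) (proj₂ cut)
        (All.tabulate λ t∈ → elsewhere (All.lookup ∈s t∈) (∈-map⁺ rule t∈)) above x
      -- A rule that τ does not use has total factor 0 and is removed by the filter.
      occurring : ∀ {t} → t ∈ filter nonzero? π → rule t ∈ map rule τ
      occurring t∈ with ∈-filter⁻ nonzero? {xs = π} t∈
      ... | t∈π , ≢0 with ∈-map⁻ (λ r → r ,ₜ totalFactor τ r) t∈π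
      ...   | q , _ , refl with q ∈? map rule τ
      ...     | yes q∈ = q∈
      ...     | no q∉  = contradiction (totalFactor-∉ {τ} q∉) ≢0

  occ-loopSchedule : ∀ {rs} σ₀ τ → IsLoop TA rs → ∀ r → occ r (map rule (loopSchedule σ₀ τ rs)) ≤ 2
  occ-loopSchedule {rs} σ₀ τ (( _ , a , path) , unique) r
    with span (_∈? map rule τ) rs | span-view (_∈? map rule τ) rs
  ... | _ | all _ = begin
    occ r (map rule (filter nonzero? π)) ≤⟨ occ-filter nonzero? rule r π ⟩
    occ r (map rule π)                   ≡⟨ cong (occ r) (rule-flush² b rs σ₀ e) ⟩
    occ r (rs ++ rs)                     ≡⟨ occ-++ r rs rs ⟩
    occ r rs + occ r rs                  ≤⟨ +-mono-≤ (occ-unique r (Unique.map⁻ unique)) (occ-unique r (Unique.map⁻ unique)) ⟩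
    2                                    ∎
    where
      open ≤-Reasoning
      e = κ (run τ σ₀)
      b = λ ℓ → lookup (κ σ₀) ℓ ⊓ lookup e ℓ
      π = flush² b rs σ₀ e
  ... | _ | stop {before} {r′} {after} _ _ eq rewrite nonzero-missing σ₀ τ before r′ after = begin
    occ r (map rule (filter nonzero? π)) ≤⟨ occ-filter nonzero? rule r π ⟩
    occ r (map rule π)                   ≡⟨ cong (occ r) (trans (sym (map-∘ (after ++ before))) (map-id (after ++ before))) ⟩
    occ r (after ++ before)              ≤⟨ occ-unique r (proj₂ (cut-loop before eq path unique)) ⟩
    1                                    ≤⟨ s≤s z≤n ⟩
    2                                    ∎
    where
      open ≤-Reasoning
      π = totals τ (after ++ before)

  runK-selfLoops : ∀ {τ v} → All (SelfLoop ∘ rule) τ → runK τ v ≡ v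
  runK-selfLoops []                   = refl
  runK-selfLoops {t ∷ τ} (self ∷ ss) = trans (cong (runK τ) (stepK-selfLoop (factor t) _ self)) (runK-selfLoops ss)

  -- A self-loop changes no counter, so start and end agree and both factors vanish. Here the
  -- oversized factors produced by merging disappear.
  loopSchedule-selfLoop : ∀ σ₀ τ {r} → SelfLoop r → All (λ t → rule t ≡ r) τ → loopSchedule σ₀ τ [ r ] ≡ []
  loopSchedule-selfLoop σ₀ τ {r} self ∈s with span (_∈? map rule τ) [ r ] | span-view (_∈? map rule τ) [ r ]
  ... | _ | stop {before} {r′} {after} _ _ eq = trans (nonzero-missing σ₀ τ before r′ after) (empty before eq)
    where
      empty : ∀ before → [ r ] ≡ before ++ r′ ∷ after → filter nonzero? (totals τ (after ++ before)) ≡ []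
      empty []            refl = refl
      empty (_ ∷ [])      ()
      empty (_ ∷ _ ∷ _)   ()
  ... | _ | all _ = filter-none nonzero? {xs = flush² b [ r ] σ₀ e} ((λ ≢0 → ≢0 f₁≡0) ∷ (λ ≢0 → ≢0 f₂≡0) ∷ [])
    where
      v = κ σ₀
      e = κ (run τ σ₀)
      b = λ ℓ → lookup v ℓ ⊓ lookup e ℓ
      e≡v : e ≡ v
      e≡v = trans (κ-run τ σ₀) (runK-selfLoops (All.map (λ { refl → self }) ∈s))
      f₁ = lookup v (from r) ∸ b (from r)
      f₁≡0 : f₁ ≡ 0
      f₁≡0 = trans (cong (λ w → lookup v (from r) ∸ (lookup v (from r) ⊓ lookup w (from r))) e≡v)
               (trans (cong (lookup v (from r) ∸_) (⊓-idem (lookup v (from r)))) (n∸n≡0 (lookup v (from r))))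
      f₂≡0 : lookup (stepK (r ,ₜ f₁) v) (from r) ∸ lookup e (from r) ≡ 0
      f₂≡0 = trans (cong₂ (λ w w′ → lookup w (from r) ∸ lookup w′ (from r)) (stepK-selfLoop f₁ v self) e≡v) (n∸n≡0 (lookup v (from r)))

-- From occurrence bounds to length bounds.

∑-mono : ∀ n {f : Fin n → ℕ} {k} → (∀ i → f i ≤ k) → ∑ f ≤ n * k
∑-mono zero    le = z≤n
∑-mono (suc n) le = +-mono-≤ (le zero) (∑-mono n (le ∘ suc))

∑-δ : ∀ {n} (j : Fin n) → ∑ (λ i → δ i j) ≡ 1
∑-δ {suc n} zero    = cong suc (sum-replicate-zero n)
∑-δ {suc n} (suc j) = ∑-δ j

∑-occ : ∀ {n} (js : List (Fin n)) → ∑ (λ i → occ i js) ≡ length js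
∑-occ {n} []   = sum-replicate-zero n
∑-occ (j ∷ js) = trans (∑-distrib-+ (λ i → δ i j) (λ i → occ i js)) (cong₂ _+_ (∑-δ j) (∑-occ js))

occ≤⇒length≤ : ∀ {n k} (js : List (Fin n)) → (∀ i → occ i js ≤ k) → length js ≤ n * k
occ≤⇒length≤ {n} {k} js le = subst (_≤ n * k) (∑-occ js) (∑-mono n le)

∈⇒occ>0 : ∀ {n} {i : Fin n} {js} → i ∈ js → 0 < occ i js
∈⇒occ>0 {i = i} {_ ∷ js} (here refl) = subst (λ x → 0 < x + occ i js) (sym (δ-refl i)) (s≤s z≤n)
∈⇒occ>0 {i = i} {j ∷ _}  (there i∈)  = ≤-trans (∈⇒occ>0 i∈) (m≤n+m _ (δ i j))

AllPairs-tabulate : ∀ {A : Set} {R : A → A → Set} {xs} → (∀ {x y} → x ∈ xs → y ∈ xs → R x y) → AllPairs R xs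
AllPairs-tabulate {xs = []}     _ = []
AllPairs-tabulate {xs = x ∷ xs} f = All.tabulate (f (here refl) ∘ there) ∷ AllPairs-tabulate (λ x∈ y∈ → f (there x∈) (there y∈))

AllPairs-++⁻ : ∀ {A : Set} {R : A → A → Set} xs {ys} → AllPairs R (xs ++ ys) →
  AllPairs R xs × AllPairs R ys × All (λ x → All (R x) ys) xs
AllPairs-++⁻ []       ps       = [] , ps , []
AllPairs-++⁻ (x ∷ xs) (p ∷ ps) with AllPairs-++⁻ xs ps
... | ps₁ , ps₂ , ps₁₂ = All.++⁻ˡ xs p ∷ ps₁ , ps₂ , All.++⁻ʳ xs p ∷ ps₁₂

-- Correctness of simple representatives for an arbitrary floor.

module SimpleRepresentative {TA : ThresholdAutomaton} (simple : AllCyclesSimple TA)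
  (lin : LinearExtension TA) (enum : LoopEnumeration TA) where
  open ThresholdAutomaton TA
  open R TA
  open Config using (κ)
  open Transition
  open Tokens TA
  open Rearrange TA
  open Cycles TA
  open Srep lin
  open SortMerge lin
  open LoopReplacement lin
  open LinearExtension lin
  open IsStrictTotalOrder isStrictTotalOrder using (compare; irrefl; <-respˡ-≈; <-respʳ-≈) renaming (module Eq to ∼)

  -- Cycles do not update shared variables, so such weights suffice to
  -- compute the shared variables after a schedule.
  ZeroOnCycles : (RuleName TA → ℕ) → Set
  ZeroOnCycles w = ∀ {r} → OnCycle TA r → w r ≡ 0

  -- Since loop replacement may change how often the rules of a cycle are used, `same` does not
  -- follow from `weights` and is kept as its own field. The field `rules` is what later yields the
  -- guards, which are known only for rules that τ uses.
  record Represents (c : Loc TA → ℕ) (v : Counters) (τ π : Schedule TA) : Set where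
    field
      fires   : FiresAll c π v
      same    : runK π v ≡ runK τ v
      rules   : All (λ t → rule t ∈ map rule τ) π
      weights : ∀ {w} → ZeroOnCycles w → weight w π ≡ weight w τ

  Represents-trans : ∀ {c v τ τ′ τ″} → Represents c v τ τ′ → Represents c v τ′ τ″ → Represents c v τ τ″
  Represents-trans {τ = τ} {τ′} p q = record
    { fires   = fires q
    ; same    = trans (same q) (same p)
    ; rules   = All.map through (rules q)
    ; weights = λ z → trans (weights q z) (weights p z)
    }
    where
      open Represents
      through : ∀ {r} → r ∈ map rule τ′ → r ∈ map rule τ
      through r∈ with ∈-map⁻ rule r∈
      ... | t , t∈ , refl = All.lookup (rules p) t∈

  -- `first⋠` holds because a nonempty `rest` begins with a transition of the loop and all rules of
  -- a loop lie in one class; in a sorted schedule no earlier class can follow.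
  record Split (rs : List (RuleName TA)) (τ pre rest : Schedule TA) : Set where
    field
      τ≡     : τ ≡ pre ++ rest
      pre∉   : All (λ t → rule t ∉ rs) pre
      first⋠ : Sorted τ → IsLoop TA rs → ∀ {s r} → s ∈ rest → r ∈ rs → r ⋠ rule s

  -- The unfolding of `replaceLoop` is part of the statement because both rest on the same call of
  -- `span`.
  split : ∀ rs τ → ∃ λ pre → ∃ λ rest → Split rs τ pre rest ×
    (∀ σ → replaceLoop σ τ rs ≡ pre ++ loopSchedule (run pre σ) (filter (λ t → rule t ∈? rs) rest) rs
                                    ++ filter (λ t → ¬? (rule t ∈? rs)) rest)
  split rs τ with span (λ t → ¬? (rule t ∈? rs)) τ | span-view (λ t → ¬? (rule t ∈? rs)) τ
  ... | _ | all pre∉ = τ , [] , record { τ≡ = sym (++-identityʳ τ) ; pre∉ = pre∉ ; first⋠ = λ _ _ () } , λ σ → refl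
  ... | _ | stop {pre} {z} {zs} pre∉ ¬z∉ refl = pre , z ∷ zs , record
      { τ≡ = refl ; pre∉ = pre∉
      ; first⋠ = λ sorted loop s∈ t∈ s≺t → after-z (proj₁ (proj₂ (AllPairs-++⁻ pre sorted))) s∈
                   (<-respʳ-≈ (loop-∼P loop t∈ z∈) s≺t)
      } , λ σ → refl
    where
      z∈ : rule z ∈ rs
      z∈ = decidable-stable (rule z ∈? rs) ¬z∉
      after-z : Sorted (z ∷ zs) → ∀ {s} → s ∈ z ∷ zs → rule z ⋠ rule s
      after-z _        (here refl) = irrefl ∼.refl
      after-z (z⋠ ∷ _) (there s∈)  = All.lookup z⋠ s∈

  module Replace (σ : Config TA) {rs} (loop : IsLoop TA rs) (τ : Schedule TA) where
    private
      pre  = proj₁ (split rs τ)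
      rest = proj₁ (proj₂ (split rs τ))
      open Split (proj₁ (proj₂ (proj₂ (split rs τ))))
      in? : Decidable (λ (t : Transition TA) → rule t ∈ rs)
      in? t = rule t ∈? rs
      ins outs : Schedule TA
      ins  = filter in? rest
      outs = filter (¬? ∘ in?) rest
      σ₁ = run pre σ
      π : Schedule TA
      π = loopSchedule σ₁ ins rs
      v = κ σ
      v₁ = runK pre v
      τ′ = replaceLoop σ τ rs
      τ′≡ : τ′ ≡ pre ++ π ++ outs
      τ′≡ = proj₂ (proj₂ (proj₂ (split rs τ))) σ
      ins∈ : All (λ t → rule t ∈ rs) ins
      ins∈ = All.all-filter in? rest
      outs∉ : All (λ t → rule t ∉ rs) outs
      outs∉ = All.all-filter (¬? ∘ in?) rest

    module _ {c} (sorted : Sorted τ) (above : Above c v) (x : FiresAll c τ v) where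
      private
        -- This is where simplicity of cycles enters. If a foreign `s` supplied a loop transition
        -- `t`, and neither were a self-loop, then either both are in one class and `enters-loop`
        -- puts `s` on the loop, or `s` is of an earlier class, which sorting excludes from `rest`.
        commutes : AllPairs (λ s t → rule s ∉ rs → rule t ∈ rs → Commutes (rule s) (rule t)) rest
        commutes = AllPairs-tabulate go
          where
            go : ∀ {s t} → s ∈ rest → t ∈ rest → rule s ∉ rs → rule t ∈ rs → Commutes (rule s) (rule t)
            go {s} {t} s∈ t∈ s∉ t∈rs with from (rule s) Fin.≟ to (rule s) | from (rule t) Fin.≟ to (rule t) | to (rule s) Fin.≟ from (rule t)
            ... | yes self | _        | _      = inj₁ self
            ... | no _     | yes self | _      = inj₂ (inj₁ self)
            ... | no _     | no _     | no ≢   = inj₂ (inj₂ ≢)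
            ... | no ¬s    | no ¬t    | yes eq with ≺P⇒ eq
            ...   | inj₁ s∼t = contradiction (enters-loop simple loop t∈rs eq s∼t ¬s ¬t) s∉
            ...   | inj₂ s≺t = contradiction s≺t (first⋠ sorted loop s∈ t∈rs)

        x-pre-rest : FiresAll c pre v × FiresAll c rest v₁
        x-pre-rest = FiresAll-++⁻ pre (subst (λ τ → FiresAll c τ v) τ≡ x)
        x-in-out : FiresAll c ins v₁ × FiresAll c outs (runK ins v₁)
        x-in-out = FiresAll-++⁻ ins (FiresAll-partition in? commutes (proj₂ x-pre-rest))
        replaces : Replaces c v₁ ins π
        replaces = subst (λ v → Replaces c v ins π) (κ-run pre σ)
          (loopSchedule-replaces σ₁ ins loop ins∈
            (subst (Above c) (sym (κ-run pre σ)) (runK-above pre (proj₁ x-pre-rest) above))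
            (subst (FiresAll c ins) (sym (κ-run pre σ)) (proj₁ x-in-out)))
        π-rules : ∀ {r} → r ∈ map rule π → ∃ λ t → t ∈ rest × rule t ∈ rs × r ≡ rule t
        π-rules r∈ with ∈-map⁻ rule r∈
        ... | p , p∈ , refl with ∈-map⁻ rule (All.lookup (Replaces.rules replaces) p∈)
        ...   | t , t∈ins , eq with ∈-filter⁻ in? {xs = rest} t∈ins
        ...     | t∈ , t∈rs = t , t∈ , t∈rs , eq
        π∈ : All (λ t → rule t ∈ rs) π
        π∈ = All.tabulate λ p∈ → case π-rules (∈-map⁺ rule p∈) of λ { (_ , _ , t∈rs , eq) → subst (_∈ rs) (sym eq) t∈rs }
        on-cycle : ∀ {w} → ZeroOnCycles w → ∀ {τ} → All (λ t → rule t ∈ rs) τ → weight w τ ≡ 0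
        on-cycle z {τ} ∈s = weight-≡0 τ (All.map (λ r∈ → z (rs , proj₁ loop , r∈)) ∈s)

      replaceLoop-represents : Represents c v τ τ′
      replaceLoop-represents = subst (Represents c v τ) (sym τ′≡) (record
        { fires   = FiresAll-++⁺ pre (proj₁ x-pre-rest) (FiresAll-++⁺ π (Replaces.fires replaces)
                      (subst (FiresAll c outs) (sym (Replaces.same replaces)) (proj₂ x-in-out)))
        ; same    = begin
            runK (pre ++ π ++ outs) v  ≡⟨ runK-++ pre (π ++ outs) v ⟩
            runK (π ++ outs) v₁        ≡⟨ runK-++ π outs v₁ ⟩
            runK outs (runK π v₁)      ≡⟨ cong (runK outs) (Replaces.same replaces) ⟩
            runK outs (runK ins v₁)    ≡⟨ runK-++ ins outs v₁ ⟨
            runK (ins ++ outs) v₁      ≡⟨ runK-partition in? commutes (proj₂ x-pre-rest) ⟨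
            runK rest v₁               ≡⟨ runK-++ pre rest v ⟨
            runK (pre ++ rest) v       ≡⟨ cong (λ τ → runK τ v) τ≡ ⟨
            runK τ v                   ∎
        ; rules   = All.++⁺ {xs = pre} (All.tabulate (λ t∈ → inτ (∈-++⁺ˡ t∈)))
                      (All.++⁺ (All.tabulate λ p∈ → from-π p∈)
                               (All.filter⁺ (¬? ∘ in?) (All.tabulate (λ t∈ → inτ (∈-++⁺ʳ pre t∈)))))
        ; weights = λ {w} z → begin
            weight w (pre ++ π ++ outs)                   ≡⟨ weight-++ w pre (π ++ outs) ⟩
            weight w pre + weight w (π ++ outs)           ≡⟨ cong (weight w pre +_) (weight-++ w π outs) ⟩
            weight w pre + (weight w π + weight w outs)   ≡⟨ cong (λ y → weight w pre + (y + weight w outs)) (trans (on-cycle z π∈) (sym (on-cycle z ins∈))) ⟩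
            weight w pre + (weight w ins + weight w outs) ≡⟨ cong (weight w pre +_) (trans (weight-partition w in? rest) (weight-++ w ins outs)) ⟨
            weight w pre + weight w rest                  ≡⟨ weight-++ w pre rest ⟨
            weight w (pre ++ rest)                        ≡⟨ cong (weight w) τ≡ ⟨
            weight w τ                                    ∎
        })
        where
          open ≡-Reasoning
          inτ : ∀ {t} → t ∈ pre ++ rest → rule t ∈ map rule τ
          inτ t∈ = ∈-map⁺ rule (subst (_ ∈_) (sym τ≡) t∈)
          from-π : ∀ {p} → p ∈ π → rule p ∈ map rule τ
          from-π p∈ with π-rules (∈-map⁺ rule p∈)
          ... | t , t∈ , _ , eq = subst (_∈ map rule τ) (sym eq) (inτ (∈-++⁺ʳ pre t∈))

      -- The replacement uses a single class and stands where the loop was first used. Sortedness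
      -- has to survive because the treatment of the next loop relies on it.
      replaceLoop-sorted : Sorted τ′
      replaceLoop-sorted with AllPairs-++⁻ pre (subst Sorted τ≡ sorted)
      ... | sorted-pre , sorted-rest , pre⋠ = subst Sorted (sym τ′≡)
        (AllPairs.++⁺ {xs = pre} sorted-pre
          (AllPairs.++⁺ (AllPairs-tabulate within)
                        (AllPairs.filter⁺ (¬? ∘ in?) sorted-rest)
                        (All.tabulate λ p∈ → All.filter⁺ (¬? ∘ in?) (All.tabulate λ q∈ → first⋠ sorted loop q∈ (All.lookup π∈ p∈))))
          (All.map (λ {s} s⋠ → All.++⁺ (All.tabulate (before-π {s} s⋠)) (All.filter⁺ (¬? ∘ in?) s⋠)) pre⋠))
        where
          within : ∀ {p q} → p ∈ π → q ∈ π → rule p ⋠ rule q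
          within p∈ q∈ = irrefl (loop-∼P loop (All.lookup π∈ q∈) (All.lookup π∈ p∈))
          before-π : ∀ {s} → All (λ t → rule s ⋠ rule t) rest → ∀ {p} → p ∈ π → rule s ⋠ rule p
          before-π {s} s⋠ p∈ with π-rules (∈-map⁺ rule p∈)
          ... | t , t∈ , _ , eq = subst (rule s ⋠_) (sym eq) (All.lookup s⋠ t∈)

      occ-replaceLoop-∉ : ∀ {r} → r ∉ rs → occ r (map rule τ′) ≤ occ r (map rule τ)
      occ-replaceLoop-∉ {r} r∉ = begin
        occ r (map rule τ′)                                ≡⟨ cong (occ r ∘ map rule) τ′≡ ⟩
        occ r (map rule (pre ++ π ++ outs))                ≡⟨ occ-map-++ pre (π ++ outs) ⟩
        occ r (map rule pre) + occ r (map rule (π ++ outs)) ≡⟨ cong (occ r (map rule pre) +_) (occ-map-++ π outs) ⟩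
        occ r (map rule pre) + (occ r (map rule π) + occ r (map rule outs))
          ≡⟨ cong (λ y → occ r (map rule pre) + (y + occ r (map rule outs))) (occ-∉ (map rule π) (λ r∈ → r∉ (π-map r∈))) ⟩
        occ r (map rule pre) + occ r (map rule outs)       ≤⟨ +-monoʳ-≤ (occ r (map rule pre)) (occ-filter (¬? ∘ in?) rule r rest) ⟩
        occ r (map rule pre) + occ r (map rule rest)       ≡⟨ occ-map-++ pre rest ⟨
        occ r (map rule (pre ++ rest))                     ≡⟨ cong (occ r ∘ map rule) τ≡ ⟨
        occ r (map rule τ)                                 ∎
        where
          open ≤-Reasoning
          occ-map-++ : ∀ xs ys → occ r (map rule (xs ++ ys)) ≡ occ r (map rule xs) + occ r (map rule ys)
          occ-map-++ xs ys = trans (cong (occ r) (map-++ rule xs ys)) (occ-++ r (map rule xs) (map rule ys))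
          π-map : r ∈ map rule π → r ∈ rs
          π-map r∈ with ∈-map⁻ rule r∈
          ... | p , p∈ , refl = All.lookup π∈ p∈

    private
      occ-loop : ∀ {r} → r ∈ rs → occ r (map rule τ′) ≡ occ r (map rule π)
      occ-loop {r} r∈ = begin
        occ r (map rule τ′)                 ≡⟨ cong (occ r ∘ map rule) τ′≡ ⟩
        occ r (map rule (pre ++ π ++ outs)) ≡⟨ cong (occ r) (trans (map-++ rule pre (π ++ outs)) (cong (map rule pre ++_) (map-++ rule π outs))) ⟩
        occ r (map rule pre ++ map rule π ++ map rule outs) ≡⟨ trans (occ-++ r (map rule pre) _) (cong (occ r (map rule pre) +_) (occ-++ r (map rule π) _)) ⟩
        occ r (map rule pre) + (occ r (map rule π) + occ r (map rule outs)) ≡⟨ cong₂ (λ y z → y + (occ r (map rule π) + z)) (none pre∉) (none outs∉) ⟩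
        occ r (map rule π) + 0              ≡⟨ +-identityʳ _ ⟩
        occ r (map rule π)                  ∎
        where
          open ≡-Reasoning
          none : ∀ {τ} → All (λ t → rule t ∉ rs) τ → occ r (map rule τ) ≡ 0
          none {τ} ∉s = occ-∉ (map rule τ) λ r∈τ → case ∈-map⁻ rule r∈τ of λ { (t , t∈ , refl) → All.lookup ∉s t∈ r∈ }

    occ-replaceLoop-∈ : ∀ {r} → r ∈ rs → occ r (map rule τ′) ≤ 2
    occ-replaceLoop-∈ {r} r∈ = subst (_≤ 2) (sym (occ-loop r∈)) (occ-loopSchedule σ₁ ins loop r)

    occ-replaceLoop-selfLoop : ∀ {r} → r ∈ rs → SelfLoop r → occ r (map rule τ′) ≡ 0
    occ-replaceLoop-selfLoop {r} r∈ self = trans (occ-loop r∈) (cong (occ r ∘ map rule) (go (IsLoop-selfLoop loop r∈ self)))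
      where
        go : rs ≡ [ r ] → π ≡ []
        go refl = loopSchedule-selfLoop σ₁ ins self (All.map (λ { (here eq) → eq }) ins∈)

  -- `twice` is the source of the length bound; `selfLoop` excludes the `idles` case of `Fires`, so
  -- that firing becomes genuine availability of tokens.
  record Bounded (r : RuleName TA) (τ : Schedule TA) : Set where
    field
      twice    : occ r (map rule τ) ≤ 2
      selfLoop : SelfLoop r → occ r (map rule τ) ≡ 0

  -- A rule outside all loops occurs once after merging, and a rule of a loop
  -- is bounded from the time when its loop is replaced.
  foldl-replaceLoop : ∀ {c} σ loops → All (IsLoop TA) loops → ∀ τ →
    Sorted τ → Above c (κ σ) → FiresAll c τ (κ σ) →
    Represents c (κ σ) τ (foldl (replaceLoop σ) τ loops) ×
    (∀ r → Bounded r τ ⊎ Any (r ∈_) loops → Bounded r (foldl (replaceLoop σ) τ loops))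
  foldl-replaceLoop σ [] [] τ sorted above x =
    record { fires = x ; same = refl ; rules = All.tabulate (∈-map⁺ rule) ; weights = λ _ → refl } ,
    λ { r (inj₁ b) → b ; r (inj₂ ()) }
  foldl-replaceLoop {c} σ (rs ∷ loops) (loop ∷ isLoops) τ sorted above x =
    Represents-trans rep (proj₁ rec) , bounded
    where
      open Replace σ loop τ
      τ′ = replaceLoop σ τ rs
      rep : Represents c (κ σ) τ τ′
      rep = replaceLoop-represents sorted above x
      rec = foldl-replaceLoop {c} σ loops isLoops τ′ (replaceLoop-sorted sorted above x) above (Represents.fires rep)
      bounded : ∀ r → Bounded r τ ⊎ Any (r ∈_) (rs ∷ loops) → Bounded r (foldl (replaceLoop σ) τ′ loops)
      bounded r h with r ∈? rs | h
      ... | yes r∈ | _ = proj₂ rec r (inj₁ (record { twice = occ-replaceLoop-∈ r∈ ; selfLoop = occ-replaceLoop-selfLoop r∈ }))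
      ... | no r∉ | inj₂ (here r∈)  = contradiction r∈ r∉
      ... | no r∉ | inj₂ (there r∈) = proj₂ rec r (inj₂ r∈)
      ... | no r∉ | inj₁ b = proj₂ rec r (inj₁ (record
        { twice    = ≤-trans fewer (Bounded.twice b)
        ; selfLoop = λ self → n≤0⇒n≡0 (subst (occ r (map rule τ′) ≤_) (Bounded.selfLoop b self) fewer)
        }))
        where
          fewer : occ r (map rule τ′) ≤ occ r (map rule τ)
          fewer = occ-replaceLoop-∉ sorted above x r∉

  ∼P⇒OnCycle : ∀ {r q} → _∼P_ TA r q → r ≢ q → OnCycle TA r
  ∼P⇒OnCycle (inj₁ (r≺q , q≺r)) _   = ≺P⁺⇒OnCycle (r≺q ++⁺ q≺r)
  ∼P⇒OnCycle (inj₂ r≡q)         r≢q = contradiction r≡q r≢q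

  -- A rule on no cycle is alone in its class, so sorting makes its transitions adjacent and merging
  -- leaves one.
  occ-merge : ∀ {r} τ → ¬ OnCycle TA r → Sorted τ → occ r (map rule (merge τ)) ≤ 1
  occ-merge         []      _      _                 = z≤n
  occ-merge {r} (t ∷ τ) acyclic (t⋠ ∷ sorted) =
    go (merge τ) (All-merge {rule t ⋠_} t⋠) (Sorted-merge sorted) (occ-merge τ acyclic sorted)
    where
      go : ∀ μ → All (λ s → rule t ⋠ rule s) μ → Sorted μ → occ r (map rule μ) ≤ 1 → occ r (map rule (cons-merge t μ)) ≤ 1
      go [] _ _ _ with r Fin.≟ rule t
      ... | yes _ = s≤s z≤n
      ... | no _  = z≤n
      go (s ∷ μ) (t⋠s ∷ _) (s⋠ ∷ _) le with rule t Fin.≟ rule s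
      ... | yes eq = subst (λ q → δ r q + occ r (map rule μ) ≤ 1) (sym eq) le
      ... | no t≢s with r Fin.≟ rule t
      ...   | no _ = le
      ...   | yes refl = s≤s (≤-reflexive (occ-∉ (map rule (s ∷ μ)) absent))
        where
          s≁t : ¬ _∼P_ TA (rule t) (rule s)
          s≁t t∼s = acyclic (∼P⇒OnCycle t∼s t≢s)
          absent : rule t ∉ map rule (s ∷ μ)
          absent (here eq)  = t≢s eq
          absent (there t∈) with ∈-map⁻ rule t∈
          -- A further use of the rule behind `s` would enclose `s` between two members of one
          -- class, and sortedness would force `s` into that class.
          ... | q , q∈ , eq with compare (rule t) (rule s)
          ...   | tri< t≺s _ _ = All.lookup s⋠ q∈ (subst (_≺lin rule s) eq t≺s)
          ...   | tri≈ _ t∼s _ = s≁t t∼s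
          ...   | tri> _ _ s≺t = t⋠s s≺t

  record IsSimpleRepresentative (c : Loc TA → ℕ) (v : Counters) (τ π : Schedule TA) : Set where
    field
      represents  : Represents c v τ π
      noSelfLoops : All (¬_ ∘ SelfLoop ∘ rule) π
      short       : length π ≤ 2 * |R|
    open Represents represents public

  -- Since `srep` is independent of `c`, any set of tokens that τ leaves in place is also left in
  -- place by the representative. Guards are not considered here.
  srep-correct : ∀ {c} σ τ → Above c (κ σ) → FiresAll c τ (κ σ) → IsSimpleRepresentative c (κ σ) τ (srep lin enum σ τ)
  srep-correct {c} σ τ above x = record
    { represents  = Represents-trans merged (proj₁ folded)
    ; noSelfLoops = All.tabulate λ {t} t∈ self → <⇒≢ (∈⇒occ>0 (∈-map⁺ rule t∈)) (sym (Bounded.selfLoop (bounded (rule t)) self))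
    ; short       = subst₂ _≤_ (length-map rule π) (*-comm |R| 2) (occ≤⇒length≤ (map rule π) (λ r → Bounded.twice (bounded r)))
    }
    where
      open LoopEnumeration enum
      μ π : Schedule TA
      μ = merge (sort τ)
      π = srep lin enum σ τ
      v = κ σ
      x-sort = FiresAll-sort τ x
      x-merge : FiresAll c μ v
      x-merge = FiresAll-merges (sort τ) x-sort
      weight-μ : ∀ w → weight w μ ≡ weight w τ
      weight-μ w = sym (trans (weight-sort w τ) (weight-merges w (sort τ)))
      merged : Represents c v τ μ
      merged = record
        { fires   = x-merge
        ; same    = runK-weight μ τ v x-merge x weight-μ
        ; rules   = All-merge {_∈ map rule τ} (All-sort {_∈ map rule τ} (All.tabulate (∈-map⁺ rule)))
        ; weights = λ {w} _ → weight-μ w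
        }
      folded : Represents c v μ π × (∀ r → Bounded r μ ⊎ Any (r ∈_) loops → Bounded r π)
      folded = foldl-replaceLoop σ loops isLoop μ (Sorted-merge (Sorted-sort τ)) above x-merge
      bounded : ∀ r → Bounded r π
      bounded r with Any.any? (r ∈?_) loops
      ... | yes r∈ = proj₂ folded r (inj₂ r∈)
      -- A rule in no listed loop is on no cycle, in particular no self-loop; merging has already
      -- reduced it to one occurrence.
      ... | no r∉  = proj₂ folded r (inj₁ (record
        { twice    = m≤n⇒m≤1+n (occ-merge (sort τ) (λ cyc → r∉ (covers cyc)) (Sorted-sort τ))
        ; selfLoop = λ self → contradiction (covers ((r ∷ []) , ((λ ()) , from r , refl , sym self) , here refl)) r∉
        }))

-- Shared variables, guards and steadiness.

module Guards {TA : ThresholdAutomaton} where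
  open ThresholdAutomaton TA
  open R TA
  open Config
  open Transition
  open Tokens TA

  infix 4 _≤g_
  record _≤g_ (σ σ′ : Config TA) : Set where
    constructor _,g_
    field
      p≡ : p σ ≡ p σ′
      g≤ : ∀ j → lookup (g σ) j ≤ lookup (g σ′) j
  open _≤g_

  ⊨≤-mono : ∀ {σ σ′ : Config TA} {γ : TAGuard TA} → σ ≤g σ′ → σ ⊨≤ γ → σ′ ⊨≤ γ
  ⊨≤-mono (refl ,g le) h = ℤ.≤-trans h (ℤ.+≤+ (le _))

  ⊨>-anti : ∀ {σ σ′ : Config TA} {γ : TAGuard TA} → σ ≤g σ′ → σ′ ⊨> γ → σ ⊨> γ
  ⊨>-anti (refl ,g le) h = ℤ.≤-<-trans (ℤ.+≤+ (le _)) h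

  infix 7 _⊕[_]_
  _⊕[_]_ : ∀ {n} → Vec ℕ n → ℕ → Vec ℕ n → Vec ℕ n
  _⊕[_]_ = _+[_]·_ {TA}

  lookup-⊕ : ∀ {n} (v w : Vec ℕ n) k j → lookup (v ⊕[ k ] w) j ≡ lookup v j + k * lookup w j
  lookup-⊕ v w k j = trans (Vec.lookup-zipWith _+_ j v _) (cong (λ y → lookup v j + y) (Vec.lookup-map j (k *_) w))

  update : Fin |Γ| → RuleName TA → ℕ
  update j r = lookup (u r) j

  g-run : ∀ τ (σ : Config TA) j → lookup (g (run τ σ)) j ≡ lookup (g σ) j + weight (update j) τ
  g-run []      σ j = sym (+-identityʳ _)
  g-run (t ∷ τ) σ j = begin
    lookup (g (run τ (step t σ))) j                                    ≡⟨ g-run τ (step t σ) j ⟩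
    lookup (g (step t σ)) j + weight (update j) τ                      ≡⟨ cong (_+ weight (update j) τ) (lookup-⊕ (g σ) (u (rule t)) (factor t) j) ⟩
    lookup (g σ) j + factor t * update j (rule t) + weight (update j) τ ≡⟨ +-assoc (lookup (g σ) j) _ _ ⟩
    lookup (g σ) j + weight (update j) (t ∷ τ)                         ∎
    where open ≡-Reasoning

  p-run : ∀ (τ : Schedule TA) (σ : Config TA) → p (run τ σ) ≡ p σ
  p-run []      σ = refl
  p-run (t ∷ τ) σ = p-run τ (step t σ)

  run-≡ : ∀ τ τ′ σ → runK τ (κ σ) ≡ runK τ′ (κ σ) → (∀ j → weight (update j) τ ≡ weight (update j) τ′) →
    run τ σ ≡ run τ′ σ
  run-≡ τ τ′ σ same weights = config-≡
    (trans (κ-run τ σ) (trans same (sym (κ-run τ′ σ))))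
    (lookup-ext λ j → trans (g-run τ σ j) (trans (cong (lookup (g σ) j +_) (weights j)) (sym (g-run τ′ σ j))))
    (trans (p-run τ σ) (sym (p-run τ′ σ)))
    where
      config-≡ : ∀ {σ σ′ : Config TA} → κ σ ≡ κ σ′ → g σ ≡ g σ′ → p σ ≡ p σ′ → σ ≡ σ′
      config-≡ refl refl refl = refl

  -- The counter part of applicability. In contrast to `Fires`, self-loops must meet the bound too.
  data Available : Schedule TA → Counters → Set where
    []  : ∀ {v} → Available [] v
    _∷_ : ∀ {t τ v} → factor t ≤ lookup v (from (rule t)) → Available τ (stepK t v) → Available (t ∷ τ) v

  Available-++⁺ : ∀ τ {τ′ v} → Available τ v → Available τ′ (runK τ v) → Available (τ ++ τ′) v
  Available-++⁺ []      []       y = y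
  Available-++⁺ (t ∷ τ) (le ∷ x) y = le ∷ Available-++⁺ τ x y

  FiresAll⇒Available : ∀ {c τ v} → All (¬_ ∘ SelfLoop ∘ rule) τ → FiresAll c τ v → Available τ v
  FiresAll⇒Available []           []             = []
  FiresAll⇒Available (¬self ∷ ss) (idles loop ∷ x) = contradiction loop ¬self
  FiresAll⇒Available (¬self ∷ ss) (moves le ∷ x) = m+n≤o⇒m≤o _ le ∷ FiresAll⇒Available ss x

  Available⇒FiresAll : ∀ {τ v} → Available τ v → FiresAll (λ _ → 0) τ v
  Available⇒FiresAll []       = []
  Available⇒FiresAll (le ∷ x) = moves (subst (_≤ _) (sym (+-identityʳ _)) le) ∷ Available⇒FiresAll x

  Applicable⇒Available : ∀ τ {σ} → Applicable τ σ → Available τ (κ σ)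
  Applicable⇒Available []      _                   = []
  Applicable⇒Available (t ∷ τ) (inj₁ (_ , le) , x) = le ∷ Applicable⇒Available τ x
  Applicable⇒Available (t ∷ τ) (inj₂ eq , x)       = subst (_≤ _) (sym eq) z≤n ∷ Applicable⇒Available τ x

  start∈Cfgs : ∀ (σ : Config TA) τ → σ ∈ Cfgs σ τ
  start∈Cfgs σ []      = here refl
  start∈Cfgs σ (t ∷ τ) = here refl

  end∈Cfgs : ∀ (σ : Config TA) τ → run τ σ ∈ Cfgs σ τ
  end∈Cfgs σ []      = here refl
  end∈Cfgs σ (t ∷ τ) = there (end∈Cfgs (step t σ) τ)

  GuardsHold : Config TA → RuleName TA → Set
  GuardsHold σ r = All (σ ⊨≤_) (φ≤ r) × All (σ ⊨>_) (φ> r)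

  -- With factor 1 being unlocked means that the guards hold for `k = 0`, that is, in the
  -- configuration itself up to adding 0 times `u`. A transition of factor 0 would reveal nothing
  -- about its guards.
  fired : ∀ {σ} τ → Conventional τ → Applicable τ σ → ∀ {r} → r ∈ map rule τ →
    ∃ λ σ′ → σ′ ∈ Cfgs σ τ × GuardsHold σ′ r
  fired {σ} ((r ,ₜ _) ∷ τ) (refl ∷ _) (inj₁ (unlocked , _) , _) (here refl) =
    σ , here refl ,
    All.map (λ {γ} → ⊨≤-mono {σ = σ₀} {σ} {γ} (refl ,g λ j → ≤-reflexive (same j))) (proj₁ (unlocked 0 (s≤s z≤n))) ,
    All.map (λ {γ} → ⊨>-anti {σ = σ} {σ₀} {γ} (refl ,g λ j → ≤-reflexive (sym (same j)))) (proj₂ (unlocked 0 (s≤s z≤n)))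
    where
      σ₀ = config (κ σ) (g σ ⊕[ 0 ] u r) (p σ)
      same : ∀ j → lookup (g σ₀) j ≡ lookup (g σ) j
      same j = trans (lookup-⊕ (g σ) (u r) 0 j) (+-identityʳ _)
  fired (_ ∷ τ) (refl ∷ _)  (inj₂ () , _) (here refl)
  fired (_ ∷ τ) (_ ∷ conv) (_ , x) (there r∈) with fired τ conv x r∈
  ... | σ′ , σ′∈ , hold = σ′ , there σ′∈ , hold

  -- Shared variables only grow, so the truth of the guards at both ends of a
  -- steady schedule fixes it for all values in between.
  module _ {σ : Config TA} {τ : Schedule TA} (steady : Steady σ τ) where

    Between : Pred (Config TA) _
    Between ρ = σ ≤g ρ × ρ ≤g run τ σ

    module _ (conv : Conventional τ) (app : Applicable τ σ) where

      -- From the moment when `r` fired in τ, steadiness carries lower guards back to the start,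
      -- whence they persist upwards to `ρ`, and upper guards forward to the end, whence they
      -- persist downwards.
      GuardsHold-between : ∀ {ρ r} → Between ρ → r ∈ map rule τ → GuardsHold ρ r
      GuardsHold-between {ρ} {r} (low , high) r∈ with fired τ conv app r∈
      ... | σ′ , σ′∈ , lower , upper =
        All.tabulate (λ {γ} γ∈ → ⊨≤-mono {σ = σ} {ρ} {γ} low
          (proj₂ (proj₁ (steady σ′∈ (start∈Cfgs σ τ)) {inj₁ γ} ((r , γ∈) , All.lookup lower γ∈)))) ,
        All.tabulate (λ {γ} γ∈ → ⊨>-anti {σ = ρ} {run τ σ} {γ} high (at-end γ γ∈))
        where
          at-end : ∀ γ → γ ∈ φ> r → run τ σ ⊨> γ
          -- Contexts record the upper guards that fail, so the guard is decided at the end and its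
          -- failure is carried back to the moment of firing.
          at-end γ γ∈ with (ℤ.+ lookup (g (run τ σ)) (Guard.var γ)) ℤ.<? ⟦ Guard.threshold γ ⟧ (Vec.map ℤ.+_ (p (run τ σ)))
          ... | yes h = h
          ... | no ¬h = contradiction (All.lookup upper γ∈)
            (proj₂ (proj₁ (steady (end∈Cfgs σ τ) σ′∈) {inj₂ γ} ((r , γ∈) , ¬h)))

      -- The inequality includes all updates still to come. It is passed on unchanged from step to
      -- step, and as updates are nonnegative it bounds every value on the way.
      applicable-between : ∀ π {ρ} → σ ≤g ρ → (∀ j → lookup (g ρ) j + weight (update j) π ≤ lookup (g (run τ σ)) j) →
        All (λ t → rule t ∈ map rule τ) π → Available π (κ ρ) → Applicable π ρ × All Between (Cfgs ρ π)
      applicable-between π {ρ} low high ∈s x = go π low high ∈s x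
        where
          between : ∀ {ρ} (n : Fin |Γ| → ℕ) → σ ≤g ρ → (∀ j → lookup (g ρ) j + n j ≤ lookup (g (run τ σ)) j) → Between ρ
          between n low high = low , trans (sym (p≡ low)) (sym (p-run τ σ)) ,g λ j → m+n≤o⇒m≤o _ (high j)
          go : ∀ π {ρ} → σ ≤g ρ → (∀ j → lookup (g ρ) j + weight (update j) π ≤ lookup (g (run τ σ)) j) →
            All (λ t → rule t ∈ map rule τ) π → Available π (κ ρ) → Applicable π ρ × All Between (Cfgs ρ π)
          go []       low high []       []       = _ , (between (λ _ → 0) low high ∷ [])
          go (t@(r ,ₜ f) ∷ π) {ρ} low high (r∈ ∷ ∈s) (le ∷ x) with go π {step t ρ} low′ high′ ∈s x
            where
              low′ : σ ≤g step t ρ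
              low′ = p≡ low ,g λ j → ≤-trans (g≤ low j) (subst (lookup (g ρ) j ≤_) (sym (lookup-⊕ (g ρ) (u r) f j)) (m≤m+n _ _))
              high′ : ∀ j → lookup (g (step t ρ)) j + weight (update j) π ≤ lookup (g (run τ σ)) j
              high′ j = subst (_≤ lookup (g (run τ σ)) j)
                (trans (sym (+-assoc (lookup (g ρ) j) _ _)) (cong (_+ weight (update j) π) (sym (lookup-⊕ (g ρ) (u r) f j)))) (high j)
          ... | app′ , betw = (inj₁ (unlocked , le) , app′) , (between (λ j → weight (update j) (t ∷ π)) low high ∷ betw)
            where
              unlocked : Unlocked t ρ
              -- The guards are also needed at the virtual configurations inside an accelerated
              -- transition; their shared values lie below those after the whole transition because
              -- `k < f`.
              unlocked k k<f = GuardsHold-between (between {config (κ ρ) (g ρ ⊕[ k ] u r) (p ρ)} (λ _ → 0)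
                (p≡ low ,g λ j → ≤-trans (g≤ low j) (subst (lookup (g ρ) j ≤_) (sym (lookup-⊕ (g ρ) (u r) k j)) (m≤m+n _ _)))
                (λ j → begin
                  lookup (g ρ ⊕[ k ] u r) j + 0      ≡⟨ +-identityʳ _ ⟩
                  lookup (g ρ ⊕[ k ] u r) j          ≡⟨ lookup-⊕ (g ρ) (u r) k j ⟩
                  lookup (g ρ) j + k * update j r     ≤⟨ +-monoʳ-≤ (lookup (g ρ) j) (*-monoˡ-≤ (update j r) (<⇒≤ k<f)) ⟩
                  lookup (g ρ) j + f * update j r     ≤⟨ +-monoʳ-≤ (lookup (g ρ) j) (m≤m+n _ _) ⟩
                  lookup (g ρ) j + weight (update j) (t ∷ π) ≤⟨ high j ⟩
                  lookup (g (run τ σ)) j              ∎)) r∈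
                where open ≤-Reasoning

    -- Contexts only grow with the shared variables, and steadiness of τ makes them equal at the two
    -- ends of the interval, hence constant on it.
    steady-between : ∀ {ρ π} → All Between (Cfgs ρ π) → Steady ρ π
    steady-between betw ρ₁∈ ρ₂∈ =
      (λ {x} → up (All.lookup betw ρ₂∈) {x} ∘ down (All.lookup betw ρ₁∈) {x}) ,
      (λ {x} → up (All.lookup betw ρ₁∈) {x} ∘ down (All.lookup betw ρ₂∈) {x})
      where
        down : ∀ {ρ} → Between ρ → ∀ {x} → ω ρ x → ω σ x
        down {ρ} (_ , high) {inj₁ γ} (rise , h) = proj₁ (steady (end∈Cfgs σ τ) (start∈Cfgs σ τ)) {inj₁ γ} (rise , ⊨≤-mono {σ = ρ} {run τ σ} {γ} high h)
        down {ρ} (_ , high) {inj₂ γ} (fall , h) = proj₁ (steady (end∈Cfgs σ τ) (start∈Cfgs σ τ)) {inj₂ γ} (fall , h ∘ ⊨>-anti {σ = ρ} {run τ σ} {γ} high)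
        up : ∀ {ρ} → Between ρ → ∀ {x} → ω σ x → ω ρ x
        up {ρ} (low , _) {inj₁ γ} (rise , h) = rise , ⊨≤-mono {σ = σ} {ρ} {γ} low h
        up {ρ} (low , _) {inj₂ γ} (fall , h) = fall , h ∘ ⊨>-anti {σ = σ} {ρ} {γ} low

-- The formulas ψ along a schedule.

module Invariants {TA : ThresholdAutomaton} where
  open ThresholdAutomaton TA
  open R TA
  open Config using (κ)
  open Transition
  open Tokens TA
  open Rearrange TA using (stepK-zero)
  open Guards {TA}

  -- The counter shadow of `All` over `Cfgs`: ψ speaks of counters only, and so do the arguments
  -- about tokens.
  data Along (P : Pred Counters 0ℓ) : Schedule TA → Counters → Set where
    end : ∀ {v} → P v → Along P [] v
    _∷_ : ∀ {t τ v} → P v → Along P τ (stepK t v) → Along P (t ∷ τ) v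

  Along-head : ∀ {P τ v} → Along P τ v → P v
  Along-head (end h)   = h
  Along-head (h ∷ _) = h

  Along-last : ∀ {P τ v} → Along P τ v → P (runK τ v)
  Along-last (end h)   = h
  Along-last (_ ∷ x) = Along-last x

  Along-map : ∀ {P Q : Pred Counters 0ℓ} {τ v} → (∀ {v} → P v → Q v) → Along P τ v → Along Q τ v
  Along-map f (end h)   = end (f h)
  Along-map f (h ∷ x) = f h ∷ Along-map f x

  Along-++⁺ : ∀ {P} τ {τ′ v} → Along P τ v → Along P τ′ (runK τ v) → Along P (τ ++ τ′) v
  Along-++⁺ []      (end _)   y = y
  Along-++⁺ (t ∷ τ) (h ∷ x) y = h ∷ Along-++⁺ τ x y

  Along-above : ∀ {c τ v} → FiresAll c τ v → Above c v → Along (Above c) τ v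
  Along-above []      above = end above
  Along-above (o ∷ x) above = above ∷ Along-above x (stepK-above _ o above)

  Holds : Formula TA → Pred Counters 0ℓ
  Holds (⋁κ≢0 Locs) v = ∃ λ ℓ → ℓ ∈ₛ Locs × lookup v ℓ ≢ 0
  Holds (⋀κ≡0 Locs) v = ∀ ℓ → ℓ ∈ₛ Locs → lookup v ℓ ≡ 0

  ⊨⇒Holds : ∀ ψ {σ} → σ ⊨ ψ → Holds ψ (κ σ)
  ⊨⇒Holds (⋁κ≢0 _) h = h
  ⊨⇒Holds (⋀κ≡0 _) h = h

  Holds⇒⊨ : ∀ ψ {σ} → Holds ψ (κ σ) → σ ⊨ ψ
  Holds⇒⊨ (⋁κ≢0 _) h = h
  Holds⇒⊨ (⋀κ≡0 _) h = h

  Along⁺ : ∀ ψ τ {σ} → All (_⊨ ψ) (Cfgs σ τ) → Along (Holds ψ) τ (κ σ)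
  Along⁺ ψ []      {σ} (h ∷ []) = end (⊨⇒Holds ψ {σ} h)
  Along⁺ ψ (t ∷ τ) {σ} (h ∷ hs) = ⊨⇒Holds ψ {σ} h ∷ Along⁺ ψ τ hs

  Along⁻ : ∀ ψ τ {σ} → Along (Holds ψ) τ (κ σ) → All (_⊨ ψ) (Cfgs σ τ)
  Along⁻ ψ []      {σ} (end h)    = Holds⇒⊨ ψ {σ} h ∷ []
  Along⁻ ψ (t ∷ τ) {σ} (h ∷ hs) = Holds⇒⊨ ψ {σ} h ∷ Along⁻ ψ τ hs

  -- Each transition of nonzero factor has just occupied its target, which lies in Locs; one of
  -- factor zero inherits the witness. This serves the phase in which the only token known to be in
  -- Locs moves itself.
  Along-inside : ∀ {c Locs τ v} → All (λ t → to (rule t) ∈ₛ Locs) τ → All (¬_ ∘ SelfLoop ∘ rule) τ → FiresAll c τ v →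
    Holds (⋁κ≢0 Locs) v → Along (Holds (⋁κ≢0 Locs)) τ v
  Along-inside [] [] [] h = end h
  Along-inside {Locs = Locs} {(r ,ₜ zero) ∷ τ} {v} (_ ∷ ∈s) (_ ∷ ss) (_ ∷ x) h =
    h ∷ Along-inside ∈s ss x (subst (Holds (⋁κ≢0 Locs)) (sym (stepK-zero r v)) h)
  Along-inside {Locs = Locs} {(r ,ₜ suc f) ∷ τ} {v} (to∈ ∷ ∈s) (¬self ∷ ss) (_ ∷ x) h =
    h ∷ Along-inside ∈s ss x (to r , to∈ , λ eq → case trans (sym (stepK-to (suc f) v ¬self)) eq of λ e → 1+n≢0 (m+n≡0⇒n≡0 (lookup v (to r)) e))

  Untouched : Subset |L| → RuleName TA → Set
  Untouched Locs r = ∀ ℓ → ℓ ∈ₛ Locs → ℓ ≢ from r × ℓ ≢ to r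

  Along-untouched : ∀ {Locs τ v} → All (Untouched Locs ∘ rule) τ →
    Holds (⋀κ≡0 Locs) v → Along (Holds (⋀κ≡0 Locs)) τ v
  Along-untouched []         h = end h
  Along-untouched {τ = t ∷ τ} {v} (ne ∷ nes) h =
    h ∷ Along-untouched nes λ ℓ ℓ∈ → trans (stepK-other (factor t) v (proj₁ (ne ℓ ℓ∈)) (proj₂ (ne ℓ ℓ∈))) (h ℓ ℓ∈)

  -- With factor 1 the source is occupied before the step, and the target after it unless the rule
  -- is a self-loop; neither can lie in Locs while all counters there are 0.
  untouched : ∀ {Locs τ v} → Conventional τ → Available τ v → Along (Holds (⋀κ≡0 Locs)) τ v →
    All (λ t → ¬ SelfLoop (rule t) → Untouched Locs (rule t)) τ
  untouched []            []       (end _)   = []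
  untouched {Locs} {(r ,ₜ _) ∷ τ} {v} (refl ∷ conv) (le ∷ x) (h ∷ hs) = ne ∷ untouched conv x hs
    where
      ne : ¬ SelfLoop r → Untouched Locs r
      ne ¬self ℓ ℓ∈ = (λ { refl → case subst (1 ≤_) (h ℓ ℓ∈) le of λ () })
                    , (λ { refl → 1+n≢0 (trans (sym (+-comm (lookup v ℓ) 1)) (trans (sym (stepK-to 1 v ¬self)) (Along-head hs ℓ ℓ∈))) })

-- Assembling three representatives.

module Assembly {TA : ThresholdAutomaton} (noUpdate : CyclesDoNotUpdate TA) (simple : AllCyclesSimple TA)
  (lin : LinearExtension TA) (enum : LoopEnumeration TA) where
  open ThresholdAutomaton TA
  open R TA
  open Config using (κ; g; p)
  open Transition
  open Tokens TA
  open Guards {TA}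
  open Invariants {TA}
  open SimpleRepresentative simple lin enum

  -- The floor belongs to the piece because different tokens wait in different pieces.
  record Piece (ψ : Formula TA) (σ : Config TA) (τ : Schedule TA) : Set where
    constructor piece
    field
      {floor}   : Loc TA → ℕ
      correct   : IsSimpleRepresentative floor (κ σ) τ (srep lin enum σ τ)
      invariant : Along (Holds ψ) (srep lin enum σ τ) (κ σ)

  Goal : Config TA → Schedule TA → Formula TA → Set
  Goal σ τ ψ = ∃[ repr ]
      Steady σ repr
      × (Applicable repr σ × run repr σ ≡ run τ σ)
      × length repr ≤ 6 * |R|
      × All (_⊨ ψ) (Cfgs σ repr)
      × (∃[ τ₁ ] ∃[ τ₂ ] ∃[ τ₃ ]
          τ₁ ⊆ τ × τ₂ ⊆ τ × τ₃ ⊆ τ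
          × Applicable (τ₁ ++ τ₂ ++ τ₃) σ
          × run (τ₁ ++ τ₂ ++ τ₃) σ ≡ run τ σ
          × repr ≡ srep lin enum σ τ₁
                   ++ srep lin enum (run τ₁ σ) τ₂
                   ++ srep lin enum (run (τ₁ ++ τ₂) σ) τ₃)

  update-zeroOnCycles : ∀ j → ZeroOnCycles (update j)
  update-zeroOnCycles j {r} cyc = trans (cong (λ w → lookup w j) (noUpdate r cyc)) (Vec.lookup-replicate j 0)

  run-++ : ∀ τ {τ′} (σ : Config TA) → run (τ ++ τ′) σ ≡ run τ′ (run τ σ)
  run-++ []      σ = refl
  run-++ (t ∷ τ) σ = run-++ τ (step t σ)

  module _ {σ τ ψ} (steady : Steady σ τ) (conv : Conventional τ) (app : Applicable τ σ)
    {τ₁ τ₂ τ₃} (τ₁⊆τ : τ₁ ⊆ τ) (τ₂⊆τ : τ₂ ⊆ τ) (τ₃⊆τ : τ₃ ⊆ τ)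
    (available : Available (τ₁ ++ τ₂ ++ τ₃) (κ σ))
    (same : runK (τ₁ ++ τ₂ ++ τ₃) (κ σ) ≡ runK τ (κ σ))
    (weights : ∀ w → weight w (τ₁ ++ τ₂ ++ τ₃) ≡ weight w τ)
    (piece₁ : Piece ψ σ τ₁) (piece₂ : Piece ψ (run τ₁ σ) τ₂) (piece₃ : Piece ψ (run (τ₁ ++ τ₂) σ) τ₃)
    where
    private
      σ₁ = run τ₁ σ
      σ₂ = run (τ₁ ++ τ₂) σ
      π₁ = srep lin enum σ τ₁
      π₂ = srep lin enum σ₁ τ₂
      π₃ = srep lin enum σ₂ τ₃
      π : Schedule TA
      π = π₁ ++ π₂ ++ π₃
      module C₁ = IsSimpleRepresentative (Piece.correct piece₁)
      module C₂ = IsSimpleRepresentative (Piece.correct piece₂)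
      module C₃ = IsSimpleRepresentative (Piece.correct piece₃)
      κ₁ : κ σ₁ ≡ runK π₁ (κ σ)
      κ₁ = trans (κ-run τ₁ σ) (sym C₁.same)
      κ₂ : κ σ₂ ≡ runK π₂ (κ σ₁)
      κ₂ = trans (cong κ (run-++ τ₁ σ)) (trans (κ-run τ₂ σ₁) (sym C₂.same))

      -- The later pieces are set up at the counters reached by the subschedules; `κ₁` and `κ₂`
      -- identify these with the counters reached by the representatives.
      concat : ∀ (Q : Schedule TA → Counters → Set) → (∀ τ {τ′ v} → Q τ v → Q τ′ (runK τ v) → Q (τ ++ τ′) v) →
        Q π₁ (κ σ) → Q π₂ (κ σ₁) → Q π₃ (κ σ₂) → Q π (κ σ)
      concat Q app q₁ q₂ q₃ = app π₁ q₁ (subst (Q (π₂ ++ π₃)) κ₁ (app π₂ q₂ (subst (Q π₃) κ₂ q₃)))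

      same-π : runK π (κ σ) ≡ runK τ (κ σ)
      same-π = begin
        runK (π₁ ++ π₂ ++ π₃) (κ σ)     ≡⟨ trans (runK-++ π₁ (π₂ ++ π₃) (κ σ)) (runK-++ π₂ π₃ _) ⟩
        runK π₃ (runK π₂ (runK π₁ (κ σ))) ≡⟨ cong (λ v → runK π₃ (runK π₂ v)) κ₁ ⟨
        runK π₃ (runK π₂ (κ σ₁))        ≡⟨ cong (runK π₃) κ₂ ⟨
        runK π₃ (κ σ₂)                  ≡⟨ C₃.same ⟩
        runK τ₃ (κ σ₂)                  ≡⟨ cong (runK τ₃) (κ-run (τ₁ ++ τ₂) σ) ⟩
        runK τ₃ (runK (τ₁ ++ τ₂) (κ σ)) ≡⟨ runK-++ (τ₁ ++ τ₂) τ₃ (κ σ) ⟨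
        runK ((τ₁ ++ τ₂) ++ τ₃) (κ σ)   ≡⟨ cong (λ τ → runK τ (κ σ)) (++-assoc τ₁ τ₂ τ₃) ⟩
        runK (τ₁ ++ τ₂ ++ τ₃) (κ σ)     ≡⟨ same ⟩
        runK τ (κ σ)                    ∎
        where open ≡-Reasoning

      weights-π : ∀ {w} → ZeroOnCycles w → weight w π ≡ weight w τ
      weights-π {w} z = begin
        weight w (π₁ ++ π₂ ++ π₃)                ≡⟨ expand π₁ π₂ π₃ ⟩
        weight w π₁ + (weight w π₂ + weight w π₃) ≡⟨ cong₂ _+_ (C₁.weights z) (cong₂ _+_ (C₂.weights z) (C₃.weights z)) ⟩
        weight w τ₁ + (weight w τ₂ + weight w τ₃) ≡⟨ expand τ₁ τ₂ τ₃ ⟨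
        weight w (τ₁ ++ τ₂ ++ τ₃)                ≡⟨ weights w ⟩
        weight w τ                               ∎
        where
          open ≡-Reasoning
          expand : ∀ xs ys zs → weight w (xs ++ ys ++ zs) ≡ weight w xs + (weight w ys + weight w zs)
          expand xs ys zs = trans (weight-++ w xs (ys ++ zs)) (cong (weight w xs +_) (weight-++ w ys zs))

      -- A schedule with the same total update as τ exhausts the allowance of `applicable-between`
      -- exactly.
      between : ∀ π′ → Available π′ (κ σ) → All (λ t → rule t ∈ map rule τ) π′ → (∀ j → weight (update j) π′ ≡ weight (update j) τ) →
        Applicable π′ σ × All (Between {σ} {τ} steady) (Cfgs σ π′)
      between π′ avail ∈s eqs = applicable-between steady conv app π′ (refl ,g λ j → ≤-refl)
        (λ j → ≤-reflexive (trans (cong (lookup (g σ) j +_) (eqs j)) (sym (g-run τ σ j)))) ∈s avail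

      rules⊆ : ∀ {τ′ π′ : Schedule TA} → τ′ ⊆ τ → All (λ t → rule t ∈ map rule τ′) π′ → All (λ t → rule t ∈ map rule τ) π′
      rules⊆ {τ′} sub = All.map through
        where
          through : ∀ {r} → r ∈ map rule τ′ → r ∈ map rule τ
          through r∈ with ∈-map⁻ rule r∈
          ... | t , t∈ , eq = subst (_∈ map rule τ) (sym eq) (∈-map⁺ rule (Sublist.lookup sub t∈))

      good : Applicable π σ × All (Between {σ} {τ} steady) (Cfgs σ π)
      good = between π
        (concat Available Available-++⁺ (FiresAll⇒Available C₁.noSelfLoops C₁.fires)
          (FiresAll⇒Available C₂.noSelfLoops C₂.fires) (FiresAll⇒Available C₃.noSelfLoops C₃.fires))
        (All.++⁺ (rules⊆ τ₁⊆τ C₁.rules) (All.++⁺ (rules⊆ τ₂⊆τ C₂.rules) (rules⊆ τ₃⊆τ C₃.rules)))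
        (λ j → weights-π (update-zeroOnCycles j))

      members : ∀ {τ′ : Schedule TA} → τ′ ⊆ τ → All (λ t → rule t ∈ map rule τ) τ′
      members sub = All.tabulate λ t∈ → ∈-map⁺ rule (Sublist.lookup sub t∈)

    assemble : Goal σ τ ψ
    assemble = π , steady-between steady (proj₂ good) , (proj₁ good , run-≡ π τ σ same-π (λ j → weights-π (update-zeroOnCycles j))) ,
      short , Along⁻ ψ π (concat (Along (Holds ψ)) Along-++⁺ (Piece.invariant piece₁) (Piece.invariant piece₂) (Piece.invariant piece₃)) ,
      τ₁ , τ₂ , τ₃ , τ₁⊆τ , τ₂⊆τ , τ₃⊆τ ,
      proj₁ (between (τ₁ ++ τ₂ ++ τ₃) available (All.++⁺ (members τ₁⊆τ) (All.++⁺ (members τ₂⊆τ) (members τ₃⊆τ))) (λ j → weights (update j))) ,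
      run-≡ (τ₁ ++ τ₂ ++ τ₃) τ σ same (λ j → weights (update j)) , refl
      where
        short : length π ≤ 6 * |R|
        short = begin
          length (π₁ ++ π₂ ++ π₃)             ≡⟨ trans (length-++ π₁) (cong (length π₁ +_) (length-++ π₂)) ⟩
          length π₁ + (length π₂ + length π₃) ≤⟨ +-mono-≤ C₁.short (+-mono-≤ C₂.short C₃.short) ⟩
          2 * |R| + (2 * |R| + 2 * |R|)       ≡⟨ cong (2 * |R| +_) (*-distribʳ-+ |R| 2 2) ⟨
          2 * |R| + 4 * |R|                   ≡⟨ *-distribʳ-+ |R| 2 4 ⟨
          6 * |R|                             ∎
          where open ≤-Reasoning

  Piece-[] : ∀ {ψ σ} → Holds ψ (κ σ) → Piece ψ σ []
  Piece-[] {ψ} {σ} h = piece correct (subst (λ π → Along (Holds ψ) π (κ σ)) (sym (empty _ (IsSimpleRepresentative.rules correct))) (end h))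
    where
      correct : IsSimpleRepresentative (λ _ → 0) (κ σ) [] (srep lin enum σ [])
      correct = srep-correct σ [] (λ _ → z≤n) []
      empty : ∀ (π : Schedule TA) → All (λ t → rule t ∈ []) π → π ≡ []
      empty []      _        = refl
      empty (_ ∷ _) (() ∷ _)

  -- The representative never goes below the floor, so the location `ℓ` stays occupied throughout.
  Piece-waiting : ∀ {Locs σ τ} c ℓ → ℓ ∈ₛ Locs → 0 < c ℓ → Above c (κ σ) → FiresAll c τ (κ σ) → Piece (⋁κ≢0 Locs) σ τ
  Piece-waiting {σ = σ} {τ} c ℓ ℓ∈ pos above x = piece correct
    (Along-map (λ above → ℓ , ℓ∈ , >⇒≢ (≤-trans pos (above ℓ))) (Along-above (IsSimpleRepresentative.fires correct) above))
    where correct = srep-correct {c} σ τ above x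

  -- Here floor 0 suffices: the representative uses only rules of τ, so each of its moves also ends
  -- in Locs.
  Piece-inside : ∀ {Locs σ τ} → Available τ (κ σ) → All (λ t → to (rule t) ∈ₛ Locs) τ → Holds (⋁κ≢0 Locs) (κ σ) → Piece (⋁κ≢0 Locs) σ τ
  Piece-inside {Locs} {σ} {τ} x ∈s h = piece correct (Along-inside (All.map inside C.rules) C.noSelfLoops C.fires h)
    where
      correct = srep-correct σ τ (λ _ → z≤n) (Available⇒FiresAll x)
      module C = IsSimpleRepresentative correct
      inside : ∀ {r} → r ∈ map rule τ → to r ∈ₛ Locs
      inside r∈ with ∈-map⁻ rule r∈
      ... | t , t∈ , refl = All.lookup ∈s t∈

  theorem-⋀ : ∀ {σ τ} Locs → Steady σ τ → Conventional τ → Applicable τ σ →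
    All (_⊨ ⋀κ≡0 Locs) (Cfgs σ τ) → Goal σ τ (⋀κ≡0 Locs)
  theorem-⋀ {σ} {τ} Locs steady conv app inv = assemble steady conv app Sublist.⊆-refl (Sublist.minimum τ) (Sublist.minimum τ)
    (subst (λ τ → Available τ (κ σ)) (sym (++-identityʳ τ)) available)
    (cong (λ τ → runK τ (κ σ)) (++-identityʳ τ)) (λ w → cong (weight w) (++-identityʳ τ))
    (piece correct (Along-untouched (All.zipWith (λ (r∈ , ¬self) → avoid r∈ ¬self) (C.rules , C.noSelfLoops)) (Along-head along)))
    (Piece-[] {⋀κ≡0 Locs} {run τ σ} at-end)
    (Piece-[] {⋀κ≡0 Locs} {run (τ ++ []) σ} (subst (λ τ → Holds (⋀κ≡0 Locs) (κ (run τ σ))) (sym (++-identityʳ τ)) at-end))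
    where
      available = Applicable⇒Available τ app
      correct = srep-correct σ τ (λ _ → z≤n) (Available⇒FiresAll available)
      module C = IsSimpleRepresentative correct
      along : Along (Holds (⋀κ≡0 Locs)) τ (κ σ)
      along = Along⁺ (⋀κ≡0 Locs) τ inv
      at-end : Holds (⋀κ≡0 Locs) (κ (run τ σ))
      at-end = subst (Holds (⋀κ≡0 Locs)) (sym (κ-run τ σ)) (Along-last along)
      avoid : ∀ {r} → r ∈ map rule τ → ¬ SelfLoop r → Untouched Locs r
      avoid r∈ ¬self with ∈-map⁻ rule r∈
      ... | t , t∈ , refl = All.lookup (untouched conv available along) t∈ ¬self

-- Finite sums and counters as numbers of tokens.

δ-sym : ∀ {n} (i j : Fin n) → δ i j ≡ δ j i
δ-sym i j with i Fin.≟ j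
... | yes refl = sym (δ-refl i)
... | no i≢j   = sym (δ-≢ (i≢j ∘ sym))

∑-≥₁ : ∀ {n} (f : Fin n → ℕ) i → f i ≤ ∑ f
∑-≥₁ f zero    = m≤m+n _ _
∑-≥₁ f (suc i) = ≤-trans (∑-≥₁ (f ∘ suc) i) (m≤n+m _ (f zero))

∑-≥₂ : ∀ {n} (f : Fin n → ℕ) {i j} → i ≢ j → f i + f j ≤ ∑ f
∑-≥₂ f {zero}  {zero}  i≢j = contradiction refl i≢j
∑-≥₂ f {zero}  {suc j} i≢j = +-monoʳ-≤ (f zero) (∑-≥₁ (f ∘ suc) j)
∑-≥₂ f {suc i} {zero}  i≢j = subst (_≤ ∑ f) (+-comm (f zero) _) (+-monoʳ-≤ (f zero) (∑-≥₁ (f ∘ suc) i))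
∑-≥₂ f {suc i} {suc j} i≢j = ≤-trans (∑-≥₂ (f ∘ suc) (i≢j ∘ cong suc)) (m≤n+m _ (f zero))

∑-≢0 : ∀ {n} (f : Fin n → ℕ) → ∑ f ≢ 0 → ∃ λ i → f i ≢ 0
∑-≢0 {zero}  f ∑≢0 = contradiction refl ∑≢0
∑-≢0 {suc n} f ∑≢0 with f zero ℕ.≟ 0
... | no f₀≢0  = zero , f₀≢0
... | yes f₀≡0 with ∑-≢0 (f ∘ suc) (λ eq → ∑≢0 (cong₂ _+_ f₀≡0 eq))
...   | i , fi≢0 = suc i , fi≢0

∑-updateAt : ∀ {n} {A : Set} (h : A → ℕ) (s : Fin n → A) i a →
  ∑ (h ∘ updateAt s i (const a)) + h (s i) ≡ ∑ (h ∘ s) + h a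
∑-updateAt h s zero    a = solve 3 (λ x y z → x :+ y :+ z := z :+ y :+ x) refl (h a) (∑ (h ∘ s ∘ suc)) (h (s zero))
  where open +-*-Solver
∑-updateAt h s (suc i) a = trans (+-assoc (h (s zero)) _ _)
  (trans (cong (h (s zero) +_) (∑-updateAt h (s ∘ suc) i a)) (sym (+-assoc (h (s zero)) _ _)))

counts : ∀ {N n} → (Fin N → Fin n) → Vec ℕ n
counts s = tabulate λ ℓ → ∑ (λ i → δ (s i) ℓ)

lookup-counts : ∀ {N n} (s : Fin N → Fin n) ℓ → lookup (counts s) ℓ ≡ ∑ (λ i → δ (s i) ℓ)
lookup-counts s = Vec.lookup∘tabulate _

counts-cong : ∀ {N n} {s s′ : Fin N → Fin n} → s ≗ s′ → counts s ≡ counts s′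
counts-cong s≗s′ = Vec.tabulate-cong λ ℓ → sum-cong-≗ (λ i → cong (λ a → δ a ℓ) (s≗s′ i))

-- Provides the token identities that a counter configuration lacks.
counts-surjective : ∀ {n} (v : Vec ℕ n) → ∃ λ N → ∃ λ (s : Fin N → Fin n) → counts s ≡ v
counts-surjective v = length (tokens v) , List.lookup (tokens v) , lookup-ext λ ℓ →
    trans (lookup-counts (List.lookup (tokens v)) ℓ) (trans (∑-lookup ℓ (tokens v)) (occ-tokens v ℓ))
  where
    tokens : ∀ {n} → Vec ℕ n → List (Fin n)
    tokens []      = []
    tokens (k ∷ v) = List.replicate k zero ++ map suc (tokens v)
    ∑-lookup : ∀ {n} (ℓ : Fin n) xs → ∑ (λ i → δ (List.lookup xs i) ℓ) ≡ occ ℓ xs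
    ∑-lookup ℓ []       = refl
    ∑-lookup ℓ (x ∷ xs) = cong₂ _+_ (δ-sym x ℓ) (∑-lookup ℓ xs)
    occ-suc : ∀ {n} (ℓ : Fin n) xs → occ (suc ℓ) (map suc xs) ≡ occ ℓ xs
    occ-suc ℓ []       = refl
    occ-suc ℓ (x ∷ xs) = cong (δ ℓ x +_) (occ-suc ℓ xs)
    occ-zero : ∀ {n} (xs : List (Fin n)) → occ zero (map suc xs) ≡ 0
    occ-zero []       = refl
    occ-zero (x ∷ xs) = occ-zero xs
    occ-tokens : ∀ {n} (v : Vec ℕ n) ℓ → occ ℓ (tokens v) ≡ lookup v ℓ
    occ-tokens (k ∷ v) zero    = trans (occ-++ zero (List.replicate k zero) _) (trans (cong₂ _+_ (go k) (occ-zero (tokens v))) (+-identityʳ k))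
      where
        go : ∀ {n} k → occ {suc n} zero (List.replicate k zero) ≡ k
        go zero    = refl
        go (suc k) = cong suc (go k)
    occ-tokens (k ∷ v) (suc ℓ) = trans (occ-++ (suc ℓ) (List.replicate k zero) _) (cong₂ _+_ (go k) (trans (occ-suc ℓ (tokens v)) (occ-tokens v ℓ)))
      where
        go : ∀ k → occ (suc ℓ) (List.replicate k zero) ≡ 0
        go zero    = refl
        go (suc k) = go k

-- Schedules as interleaved paths of individual tokens.

module LabelledTokens {TA : ThresholdAutomaton} {N : ℕ} where
  open ThresholdAutomaton TA using (|L|)
  open R TA
  open Transition
  open Tokens TA
  open Cycles TA using (Path-++⁺)
  open Guards {TA} using (Available; []; _∷_)

  Placement : Set
  Placement = Fin N → Loc TA

  Move : Set
  Move = Fin N × RuleName TA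

  transition : Move → Transition TA
  transition (_ , r) = r ,ₜ 1

  schedule : List Move → Schedule TA
  schedule = map transition

  _isBy?_ : ∀ (m : Move) i → Dec (proj₁ m ≡ i)
  (j , _) isBy? i = j Fin.≟ i

  only without : Fin N → List Move → List Move
  only    i = filter (_isBy? i)
  without i = filter (λ m → ¬? (m isBy? i))

  rulesOf : Fin N → List Move → List (RuleName TA)
  rulesOf i ms = map proj₂ (only i ms)

  -- Validity is required for each token separately, so the interleaving does not enter. Moves of
  -- different tokens can therefore be reordered without any commutation argument.
  record Moves (ms : List Move) (s s′ : Placement) : Set where
    field
      path : ∀ i → Path TA (s i) (rulesOf i ms) (s′ i)
  open Moves

  Moves-++⁺ : ∀ {ms ms′ s s′ s″} → Moves ms s s′ → Moves ms′ s′ s″ → Moves (ms ++ ms′) s s″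
  Moves-++⁺ {ms} {ms′} {s} {_} {s″} p q .path i = subst (λ rs → Path TA (s i) rs (s″ i))
    (sym (trans (cong (map proj₂) (filter-++ (_isBy? i) ms ms′)) (map-++ proj₂ (only i ms) (only i ms′))))
    (Path-++⁺ (rulesOf i ms) (path p i) (path q i))

  act : Move → Placement → Placement
  act (i , r) s = updateAt s i (const (to r))

  Moves-cons : ∀ {i r ms s s′} → from r ≡ s i → Moves ms (act (i , r) s) s′ → Moves ((i , r) ∷ ms) s s′
  Moves-cons {i} {r} {ms} {s} {s′} eq p .path j with i Fin.≟ j
  ... | yes refl = eq , subst (λ a → Path TA a (rulesOf i ms) (s′ i)) (Vector.updateAt-updates i s) (path p i)
  ... | no i≢j   = subst (λ a → Path TA a (rulesOf j ms) (s′ j)) (Vector.updateAt-minimal j i s (i≢j ∘ sym)) (path p j)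

  Moves-uncons : ∀ {i r ms s s′} → Moves ((i , r) ∷ ms) s s′ → from r ≡ s i × Moves ms (act (i , r) s) s′
  Moves-uncons {i} {r} {ms} {s} {s′} p = proj₁ first , rest
    where
      first : Path TA (s i) (r ∷ rulesOf i ms) (s′ i)
      first with path p i
      ... | q with i Fin.≟ i
      ...   | yes _  = q
      ...   | no i≢i = contradiction refl i≢i
      rest : Moves ms (act (i , r) s) s′
      rest .path j with i Fin.≟ j | path p j
      ... | yes refl | _ = subst (λ a → Path TA a (rulesOf i ms) (s′ i)) (sym (Vector.updateAt-updates i s)) (proj₂ first)
      ... | no i≢j | q = subst (λ a → Path TA a (rulesOf j ms) (s′ j)) (sym (Vector.updateAt-minimal j i s (i≢j ∘ sym))) q

  occupied : ∀ (s : Placement) i → 1 ≤ lookup (counts s) (s i)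
  occupied s i = subst₂ _≤_ (δ-refl (s i)) (sym (lookup-counts s (s i))) (∑-≥₁ (λ j → δ (s j) (s i)) i)

  -- If the waiting token `w` shares the location of the moving token `i`, the two are counted
  -- separately; this is the firing condition over the floor formed by `w`.
  occupied₂ : ∀ (s : Placement) {i w} → i ≢ w → 1 + δ (s w) (s i) ≤ lookup (counts s) (s i)
  occupied₂ s {i} {w} i≢w = subst₂ _≤_ (cong (_+ δ (s w) (s i)) (δ-refl (s i))) (sym (lookup-counts s (s i))) (∑-≥₂ (λ j → δ (s j) (s i)) i≢w)

  counts-above : ∀ (s : Placement) w → Above (δ (s w)) (counts s)
  counts-above s w ℓ = subst (δ (s w) ℓ ≤_) (sym (lookup-counts s ℓ)) (∑-≥₁ (λ j → δ (s j) ℓ) w)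

  tokenAt : ∀ (s : Placement) {ℓ} → lookup (counts s) ℓ ≢ 0 → ∃ λ i → s i ≡ ℓ
  tokenAt s {ℓ} ≢0 with ∑-≢0 (λ j → δ (s j) ℓ) (λ eq → ≢0 (trans (lookup-counts s ℓ) eq))
  ... | i , δ≢0 with s i Fin.≟ ℓ
  ...   | yes eq = i , eq
  ...   | no _   = contradiction refl δ≢0

  counts-act : ∀ {i r} {s : Placement} → from r ≡ s i → stepK (r ,ₜ 1) (counts s) ≡ counts (act (i , r) s)
  counts-act {i} {r} {s} eq = lookup-ext λ ℓ → +-cancelʳ-≡ (δ (s i) ℓ) _ _ (begin
    lookup (stepK (r ,ₜ 1) (counts s)) ℓ + δ (s i) ℓ
      ≡⟨ cong (lookup (stepK (r ,ₜ 1) (counts s)) ℓ +_) (trans (cong (λ a → δ a ℓ) (sym eq)) (sym (*-identityˡ _))) ⟩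
    lookup (stepK (r ,ₜ 1) (counts s)) ℓ + 1 * δ (from r) ℓ
      ≡⟨ stepK-flow {λ _ → 0} (r ,ₜ 1) (counts s) (moves (subst (λ a → 1 ≤ lookup (counts s) a) (sym eq) (occupied s i))) ℓ ⟩
    lookup (counts s) ℓ + 1 * δ (to r) ℓ
      ≡⟨ cong₂ _+_ (lookup-counts s ℓ) (*-identityˡ _) ⟩
    ∑ (λ j → δ (s j) ℓ) + δ (to r) ℓ
      ≡⟨ ∑-updateAt (λ a → δ a ℓ) s i (to r) ⟨
    ∑ (λ j → δ (act (i , r) s j) ℓ) + δ (s i) ℓ
      ≡⟨ cong (_+ δ (s i) ℓ) (lookup-counts (act (i , r) s) ℓ) ⟨
    lookup (counts (act (i , r) s)) ℓ + δ (s i) ℓ ∎)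
    where open ≡-Reasoning

  runK-schedule : ∀ {ms s s′} → Moves ms s s′ → runK (schedule ms) (counts s) ≡ counts s′
  runK-schedule {[]}     p = counts-cong (path p)
  runK-schedule {m ∷ ms} p with Moves-uncons p
  ... | eq , p′ = trans (cong (runK (schedule ms)) (counts-act eq)) (runK-schedule p′)

  Available-schedule : ∀ {ms s s′} → Moves ms s s′ → Available (schedule ms) (counts s)
  Available-schedule {[]}           p = []
  Available-schedule {(i , r) ∷ ms} {s} p with Moves-uncons p
  ... | eq , p′ = subst (λ a → 1 ≤ lookup (counts s) a) (sym eq) (occupied s i) ∷
                  subst (Available (schedule ms)) (sym (counts-act eq)) (Available-schedule p′)

  -- The resting token is the floor. Its place `a` is a separate argument because the placement
  -- changes in the recursion while the floor must not.
  FiresAll-schedule : ∀ {w a ms s s′} → Moves ms s s′ → All (λ m → proj₁ m ≢ w) ms → s w ≡ a →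
    FiresAll (δ a) (schedule ms) (counts s)
  FiresAll-schedule                          p []          _  = []
  FiresAll-schedule {w} {a} {(i , r) ∷ ms} {s} p (i≢w ∷ ≢w) refl with Moves-uncons p
  ... | eq , p′ = moves (subst (λ ℓ → 1 + δ (s w) ℓ ≤ lookup (counts s) ℓ) (sym eq) (occupied₂ s i≢w)) ∷
                  subst (FiresAll (δ (s w)) (schedule ms)) (sym (counts-act eq))
                    (FiresAll-schedule p′ ≢w (Vector.updateAt-minimal w i s (i≢w ∘ sym)))

  -- Any token at the source may be chosen as the one that moves, and a positive counter guarantees
  -- one.
  label : ∀ {τ s} → Conventional τ → Available τ (counts s) → ∃ λ ms → τ ≡ schedule ms × ∃ (Moves ms s)
  label {s = s} [] [] = [] , refl , s , record { path = λ _ → refl }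
  label {(r ,ₜ _) ∷ τ} {s} (refl ∷ conv) (le ∷ x) with tokenAt s {from r} (>⇒≢ le)
  ... | i , eq with label {τ} {act (i , r) s} conv (subst (Available τ) (counts-act (sym eq)) x)
  ...   | ms , refl , s′ , p = (i , r) ∷ ms , refl , s′ , Moves-cons (sym eq) p

  by-only : ∀ i ms → All (λ m → proj₁ m ≡ i) (only i ms)
  by-only i ms = All.all-filter (_isBy? i) ms

  by-without : ∀ i ms → All (λ m → proj₁ m ≢ i) (without i ms)
  by-without i ms = All.all-filter (λ m → ¬? (m isBy? i)) ms

  rulesOf-only : ∀ i ms → rulesOf i (only i ms) ≡ rulesOf i ms
  rulesOf-only i ms = cong (map proj₂) (filter-idem (_isBy? i) ms)

  rulesOf-none : ∀ {i} {ms} → All (λ m → proj₁ m ≢ i) ms → rulesOf i ms ≡ []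
  rulesOf-none {i} ≢i = cong (map proj₂) (filter-none (_isBy? i) ≢i)

  rulesOf-only-≢ : ∀ {i j} ms → j ≢ i → rulesOf j (only i ms) ≡ []
  rulesOf-only-≢ {i} ms j≢i = rulesOf-none (All.map (λ m≡i m≡j → j≢i (trans (sym m≡j) m≡i)) (by-only i ms))

  rulesOf-without-≢ : ∀ {i j} ms → j ≢ i → rulesOf j (without i ms) ≡ rulesOf j ms
  rulesOf-without-≢         []             j≢i = refl
  rulesOf-without-≢ {i} {j} ((k , r) ∷ ms) j≢i with k Fin.≟ i | rulesOf-without-≢ ms j≢i
  ... | no _ | eq with k Fin.≟ j
  ...   | yes _ = cong (r ∷_) eq
  ...   | no _  = eq
  rulesOf-without-≢ {i} {j} ((k , r) ∷ ms) j≢i | yes refl | eq with k Fin.≟ j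
  ...   | yes k≡j = contradiction (sym k≡j) j≢i
  ...   | no _    = eq

  infix 9 _[_≔_]
  _[_≔_] : Placement → Fin N → Loc TA → Placement
  s [ i ≔ a ] = updateAt s i (const a)

  private
    relabel : ∀ {a a′ z z′ rs rs′} → a ≡ a′ → z ≡ z′ → rs ≡ rs′ → Path TA a rs z → Path TA a′ rs′ z′
    relabel refl refl refl q = q

  -- The other tokens may stand anywhere. This freedom is used with the others at their initial or
  -- at their final places; likewise `Moves-without` lets token `i` be parked at any location.
  Moves-only : ∀ {i s a z} ms → Path TA a (rulesOf i ms) z → Moves (only i ms) (s [ i ≔ a ]) (s [ i ≔ z ])
  Moves-only {i} {s} ms q .path j with j Fin.≟ i
  ... | yes refl = relabel (sym (Vector.updateAt-updates i s)) (sym (Vector.updateAt-updates i s)) (sym (rulesOf-only i ms)) q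
  ... | no j≢i   = relabel (sym (Vector.updateAt-minimal j i s j≢i)) (sym (Vector.updateAt-minimal j i s j≢i)) (sym (rulesOf-only-≢ ms j≢i)) refl

  Moves-without : ∀ {i s s′ a ms} → Moves ms s s′ → Moves (without i ms) (s [ i ≔ a ]) (s′ [ i ≔ a ])
  Moves-without {i} {s} {s′} {ms = ms} p .path j with j Fin.≟ i
  ... | yes refl = relabel (sym (Vector.updateAt-updates i s)) (sym (Vector.updateAt-updates i s′)) (sym (rulesOf-none (by-without i ms))) refl
  ... | no j≢i   = relabel (sym (Vector.updateAt-minimal j i s j≢i)) (sym (Vector.updateAt-minimal j i s′ j≢i)) (sym (rulesOf-without-≢ ms j≢i)) (path p j)

  Moves-≗ : ∀ {ms s₁ s₂ s₁′ s₂′} → s₁ ≗ s₂ → s₁′ ≗ s₂′ → Moves ms s₁ s₁′ → Moves ms s₂ s₂′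
  Moves-≗ eq eq′ p .path i = relabel (eq i) (eq′ i) refl (path p i)

  ≔-self : ∀ (s : Placement) i → s [ i ≔ s i ] ≗ s
  ≔-self s i j with j Fin.≟ i
  ... | yes refl = Vector.updateAt-updates i s
  ... | no j≢i   = Vector.updateAt-minimal j i s j≢i

  only-without-↭ : ∀ i ms → only i ms ++ without i ms ↭ ms
  only-without-↭ i []       = ↭-refl
  only-without-↭ i (m ∷ ms) with does (m isBy? i)
  ... | true  = prep m (only-without-↭ i ms)
  ... | false = ↭-trans (shift m (only i ms) (without i ms)) (prep m (only-without-↭ i ms))

  weight-↭ : ∀ w {ms ms′} → ms ↭ ms′ → weight w (schedule ms) ≡ weight w (schedule ms′)
  weight-↭ w ↭.refl        = refl
  weight-↭ w (prep m p)     = cong (1 * w (proj₂ m) +_) (weight-↭ w p)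
  weight-↭ w (swap {xs} m m′ p) = trans
    (solve 3 (λ x y z → x :+ (y :+ z) := y :+ (x :+ z)) refl (1 * w (proj₂ m)) (1 * w (proj₂ m′)) (weight w (schedule xs)))
    (cong (λ x → 1 * w (proj₂ m′) + (1 * w (proj₂ m) + x)) (weight-↭ w p))
    where open +-*-Solver
  weight-↭ w (↭.trans p q) = trans (weight-↭ w p) (weight-↭ w q)

  schedule-++ : ∀ ms ms′ → schedule (ms ++ ms′) ≡ schedule ms ++ schedule ms′
  schedule-++ = map-++ transition

-- Splitting a schedule for the disjunctive formula.

module Disjunction {TA : ThresholdAutomaton} (noUpdate : CyclesDoNotUpdate TA) (simple : AllCyclesSimple TA)
  (lin : LinearExtension TA) (enum : LoopEnumeration TA) (Locs : Subset (ThresholdAutomaton.|L| TA)) {N : ℕ} where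
  open R TA
  open Config using (κ)
  open Tokens TA
  open Guards {TA}
  open Invariants {TA}
  open Assembly noUpdate simple lin enum
  open LabelledTokens {TA} {N}

  ψ : Formula TA
  ψ = ⋁κ≢0 Locs

  waiting : ∀ {ms s s′} w → Moves ms s s′ → All (λ m → proj₁ m ≢ w) ms → s w ∈ₛ Locs →
    ∀ {σ} → κ σ ≡ counts s → Piece ψ σ (schedule ms)
  waiting {ms} {s} w p ≢w w∈ κ≡ = Piece-waiting (δ (s w)) (s w) w∈ (≤-reflexive (sym (δ-refl (s w))))
    (subst (Above (δ (s w))) (sym κ≡) (counts-above s w))
    (subst (FiresAll (δ (s w)) (schedule ms)) (sym κ≡) (FiresAll-schedule p ≢w refl))

  inside : ∀ {ms s s′} x → Moves ms s s′ → All (λ m → to (proj₂ m) ∈ₛ Locs) ms → s x ∈ₛ Locs →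
    ∀ {σ} → κ σ ≡ counts s → Piece ψ σ (schedule ms)
  inside {ms} {s} x p to∈ x∈ κ≡ = Piece-inside
    (subst (Available (schedule ms)) (sym κ≡) (Available-schedule p)) (All.map⁺ to∈)
    (s x , x∈ , λ eq → >⇒≢ (occupied s x) (trans (cong (λ v → lookup v (s x)) (sym κ≡)) eq))

  -- Each piece is requested for all configurations with the given counters, which spares computing
  -- the shared variables reached in between. The permutation guarantees equal numbers of uses of
  -- every rule.
  stages : ∀ {σ ms s s₁ s₂ s′} m₁ m₂ m₃ →
    Steady σ (schedule ms) → Applicable (schedule ms) σ → κ σ ≡ counts s → Moves ms s s′ →
    Moves m₁ s s₁ → Moves m₂ s₁ s₂ → Moves m₃ s₂ s′ →
    m₁ ⊆ ms → m₂ ⊆ ms → m₃ ⊆ ms → m₁ ++ m₂ ++ m₃ ↭ ms →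
    (∀ {σ} → κ σ ≡ counts s  → Piece ψ σ (schedule m₁)) →
    (∀ {σ} → κ σ ≡ counts s₁ → Piece ψ σ (schedule m₂)) →
    (∀ {σ} → κ σ ≡ counts s₂ → Piece ψ σ (schedule m₃)) →
    Goal σ (schedule ms) ψ
  stages {σ} {ms} {s} {s₁} {s₂} {s′} m₁ m₂ m₃ steady app κ≡ p p₁ p₂ p₃ sub₁ sub₂ sub₃ perm q₁ q₂ q₃ =
    assemble steady (All.map⁺ (All.universal (λ _ → refl) ms)) app
      (Sublist.map⁺ transition sub₁) (Sublist.map⁺ transition sub₂) (Sublist.map⁺ transition sub₃)
      (subst₂ Available split (sym κ≡) (Available-schedule p₁₂₃))
      (trans (cong₂ runK (sym split) κ≡) (trans (runK-schedule p₁₂₃) (trans (sym (runK-schedule p)) (cong (runK (schedule ms)) (sym κ≡)))))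
      (λ w → trans (cong (weight w) (sym split)) (weight-↭ w perm))
      (q₁ κ≡) (q₂ (reaches p₁)) (q₃ (trans (cong κ (cong (λ τ → run τ σ) (sym (schedule-++ m₁ m₂)))) (reaches p₁₂)))
    where
      p₁₂ : Moves (m₁ ++ m₂) s s₂
      p₁₂ = Moves-++⁺ p₁ p₂
      p₁₂₃ : Moves (m₁ ++ m₂ ++ m₃) s s′
      p₁₂₃ = Moves-++⁺ p₁ (Moves-++⁺ p₂ p₃)
      split : schedule (m₁ ++ m₂ ++ m₃) ≡ schedule m₁ ++ schedule m₂ ++ schedule m₃
      split = trans (schedule-++ m₁ (m₂ ++ m₃)) (cong (schedule m₁ ++_) (schedule-++ m₂ m₃))
      reaches : ∀ {m t} → Moves m s t → κ (run (schedule m) σ) ≡ counts t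
      reaches {m} p = trans (κ-run (schedule m) σ) (trans (cong (runK (schedule m)) κ≡) (runK-schedule p))

  Leaves : Fin N → List Move → Placement → Placement → Set
  Leaves x ms s s′ = ∃ λ ms₁ → ∃ λ ms₂ → ∃ λ s₁ →
    ms ≡ ms₁ ++ ms₂ × Moves ms₁ s s₁ × Moves ms₂ s₁ s′ × ¬ (s₁ x ∈ₛ Locs)

  -- A token changes place only by its own moves, so it suffices to inspect their targets; a target
  -- outside Locs marks the moment at which the schedule is cut.
  stays-or-leaves : ∀ x ms {s s′} → Moves ms s s′ →
    All (λ m → proj₁ m ≡ x → to (proj₂ m) ∈ₛ Locs) ms ⊎ Leaves x ms s s′
  stays-or-leaves x []             p = inj₁ []
  stays-or-leaves x ((i , r) ∷ ms) {s} p with Moves-uncons p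
  ... | eq , p′ with stays-or-leaves x ms p′ | i Fin.≟ x | to r ∈ₛ? Locs
  ...   | inj₂ (ms₁ , ms₂ , s₁ , refl , p₁ , p₂ , ∉Locs) | _ | _ =
    inj₂ ((i , r) ∷ ms₁ , ms₂ , s₁ , refl , Moves-cons eq p₁ , p₂ , ∉Locs)
  ...   | inj₁ stays | no i≢x  | _        = inj₁ ((λ i≡x → contradiction i≡x i≢x) ∷ stays)
  ...   | inj₁ stays | yes _    | yes to∈ = inj₁ ((λ _ → to∈) ∷ stays)
  ...   | inj₁ stays | yes refl | no to∉  = inj₂
    ((i , r) ∷ [] , ms , act (i , r) s , refl , Moves-cons eq (record { path = λ _ → refl }) , p′ ,
     λ x∈ → to∉ (subst (_∈ₛ Locs) (Vector.updateAt-updates i s) x∈))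

  Along-mid : ∀ {P} τ {τ′ v} → Along P (τ ++ τ′) v → P (runK τ v)
  Along-mid []      x       = Along-head x
  Along-mid (t ∷ τ) (_ ∷ x) = Along-mid τ x

  tokenIn : ∀ (s : Placement) → Holds ψ (counts s) → ∃ λ i → s i ∈ₛ Locs
  tokenIn s (ℓ , ℓ∈ , ≢0) with tokenAt s ≢0
  ... | i , refl = i , ℓ∈

  only-≢ : ∀ {z w} → z ≢ w → ∀ ms → All (λ m → proj₁ m ≢ w) (only z ms)
  only-≢ z≢w ms = All.map (λ m≡z m≡w → z≢w (trans (sym m≡z) m≡w)) (by-only _ ms)

  only-⊆ : ∀ i ms → only i ms ⊆ ms
  only-⊆ i ms = Sublist.filter-⊆ (_isBy? i) ms

  without-⊆ : ∀ i ms → without i ms ⊆ ms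
  without-⊆ i ms = Sublist.filter-⊆ (λ m → ¬? (m isBy? i)) ms

  module _ {σ ms s s′} (steady : Steady σ (schedule ms)) (app : Applicable (schedule ms) σ)
    (κ≡ : κ σ ≡ counts s) (p : Moves ms s s′) (h′ : Holds ψ (counts s′)) where

    private
      starts : ∀ z → s [ z ≔ s z ] ≗ s
      starts = ≔-self s
      ends : ∀ z → s′ [ z ≔ s′ z ] ≗ s′
      ends = ≔-self s′
      at : ∀ {t : Placement} z {a} → a ∈ₛ Locs → (t [ z ≔ a ]) z ∈ₛ Locs
      at {t} z = subst (_∈ₛ Locs) (sym (Vector.updateAt-updates z t))
      finished : ∀ {σ} → κ σ ≡ counts s′ → Piece ψ σ []
      finished eq = Piece-[] (subst (Holds ψ) (sym eq) h′)

    staying-token : ∀ x → s x ∈ₛ Locs → All (λ m → proj₁ m ≡ x → to (proj₂ m) ∈ₛ Locs) ms → Goal σ (schedule ms) ψ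
    staying-token x x∈ stays = stages (without x ms) (only x ms) [] steady app κ≡ p p₁ p₂ (record { path = λ _ → refl })
      (without-⊆ x ms) (only-⊆ x ms) (Sublist.minimum ms)
      (↭-trans (↭-reflexive (cong (without x ms ++_) (++-identityʳ (only x ms))))
        (↭-trans (++-comm (without x ms) (only x ms)) (only-without-↭ x ms)))
      (waiting x p₁ (by-without x ms) x∈)
      (inside x p₂ (All.zipWith (λ (to∈ , m≡x) → to∈ m≡x) (All.filter⁺ (_isBy? x) stays , by-only x ms)) (at x x∈))
      finished
      where
        p₁ : Moves (without x ms) s (s′ [ x ≔ s x ])
        p₁ = Moves-≗ (starts x) (λ _ → refl) (Moves-without p)
        p₂ : Moves (only x ms) (s′ [ x ≔ s x ]) s′
        p₂ = Moves-≗ (λ _ → refl) (ends x) (Moves-only ms (Moves.path p x))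

    first-and-last : ∀ {x z} → z ≢ x → s x ∈ₛ Locs → s′ z ∈ₛ Locs → Goal σ (schedule ms) ψ
    first-and-last {x} {z} z≢x x∈ z∈ = stages (only z ms) (without z ms) [] steady app κ≡ p p₁ p₂ (record { path = λ _ → refl })
      (only-⊆ z ms) (without-⊆ z ms) (Sublist.minimum ms)
      (↭-trans (↭-reflexive (cong (only z ms ++_) (++-identityʳ (without z ms)))) (only-without-↭ z ms))
      (waiting x p₁ (only-≢ z≢x ms) x∈)
      (waiting z p₂ (by-without z ms) (at z z∈))
      finished
      where
        p₁ : Moves (only z ms) s (s [ z ≔ s′ z ])
        p₁ = Moves-≗ (starts z) (λ _ → refl) (Moves-only ms (Moves.path p z))
        p₂ : Moves (without z ms) (s [ z ≔ s′ z ]) s′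
        p₂ = Moves-≗ (λ _ → refl) (ends z) (Moves-without p)

    three-tokens : ∀ {x y z ms₁ ms₂ s₁} → z ≢ x → z ≢ y → ms ≡ ms₁ ++ ms₂ → Moves ms₁ s s₁ → Moves ms₂ s₁ s′ →
      s x ∈ₛ Locs → s₁ z ∈ₛ Locs → s′ y ∈ₛ Locs → Goal σ (schedule ms) ψ
    three-tokens {x} {y} {z} {ms₁} {ms₂} {s₁} z≢x z≢y refl q₁ q₂ x∈ z∈ y∈ =
      stages (only z ms₁) (without z ms) (only z ms₂) steady app κ≡ p p₁ p₂ p₃
        (Sublist.⊆-trans (only-⊆ z ms₁) (Sublist.++⁺ʳ ms₂ Sublist.⊆-refl)) (without-⊆ z ms)
        (Sublist.⊆-trans (only-⊆ z ms₂) (Sublist.++⁺ˡ ms₁ Sublist.⊆-refl))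
        (↭-trans (++⁺ˡ (only z ms₁) (++-comm (without z ms) (only z ms₂)))
          (↭-trans (↭-reflexive (trans (sym (++-assoc (only z ms₁) _ _)) (cong (_++ without z ms) (sym (filter-++ (_isBy? z) ms₁ ms₂)))))
            (only-without-↭ z ms)))
        (waiting x p₁ (only-≢ z≢x ms₁) x∈)
        (waiting z p₂ (by-without z ms) (at z z∈))
        -- By now all tokens except `z` have finished, so `y` already stands at its final place.
        (waiting y p₃ (only-≢ z≢y ms₂) (subst (_∈ₛ Locs) (sym (Vector.updateAt-minimal y z s′ (z≢y ∘ sym))) y∈))
      where
        p₁ : Moves (only z ms₁) s (s [ z ≔ s₁ z ])
        p₁ = Moves-≗ (starts z) (λ _ → refl) (Moves-only ms₁ (Moves.path q₁ z))
        p₂ : Moves (without z ms) (s [ z ≔ s₁ z ]) (s′ [ z ≔ s₁ z ])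
        p₂ = Moves-without p
        p₃ : Moves (only z ms₂) (s′ [ z ≔ s₁ z ]) s′
        p₃ = Moves-≗ (λ _ → refl) (ends z) (Moves-only ms₂ (Moves.path q₂ z))

  theorem-⋁ : ∀ {σ τ} {s : Placement} → Steady σ τ → Conventional τ → Applicable τ σ →
    κ σ ≡ counts s → Along (Holds ψ) τ (counts s) → Goal σ τ ψ
  theorem-⋁ {σ} {τ} {s} steady conv app κ≡ along with label conv (subst (Available τ) κ≡ (Applicable⇒Available τ app))
  ... | ms , refl , s′ , p = go (tokenIn s (Along-head along)) (tokenIn s′ h′)
    where
      h′ : Holds ψ (counts s′)
      h′ = subst (Holds ψ) (runK-schedule p) (Along-last along)
      go : ∃ (λ x → s x ∈ₛ Locs) → ∃ (λ y → s′ y ∈ₛ Locs) → Goal σ (schedule ms) ψ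
      go (x , x∈) (y , y∈) with stays-or-leaves x ms p
      ... | inj₁ stays = staying-token steady app κ≡ p h′ x x∈ stays
      ... | inj₂ (ms₁ , ms₂ , s₁ , eq , p₁ , p₂ , x∉)
        with tokenIn s₁ (subst (Holds ψ) (runK-schedule p₁) (Along-mid (schedule ms₁)
               (subst (λ τ → Along (Holds ψ) τ (counts s)) (trans (cong schedule eq) (schedule-++ ms₁ ms₂)) along)))
      ...   | z , z∈ with z Fin.≟ y
      -- The tokens `z` and `x` differ because at the cut the one is in Locs and the other is not.
      ...     | yes refl = first-and-last steady app κ≡ p h′ (λ { refl → x∉ z∈ }) x∈ y∈
      ...     | no z≢y   = three-tokens steady app κ≡ p h′ (λ { refl → x∉ z∈ }) z≢y eq p₁ p₂ x∈ z∈ y∈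

theorem6p3 : (TA : ThresholdAutomaton) →
    CyclesDoNotUpdate TA →
    AllCyclesSimple TA →
    (lin : LinearExtension TA) (enum : LoopEnumeration TA) →
    (σ : Config TA) → Admissible σ →
    (τ : Schedule TA) → Steady σ τ → Conventional τ → Applicable τ σ →
    (ψ : Formula TA) → All (_⊨ ψ) (Cfgs σ τ) →
    ∃[ repr ]
      Steady σ repr
      × (Applicable repr σ × run repr σ ≡ run τ σ)
      × length repr ≤ 6 * ThresholdAutomaton.|R| TA
      × All (_⊨ ψ) (Cfgs σ repr)
      × (∃[ τ₁ ] ∃[ τ₂ ] ∃[ τ₃ ]
          τ₁ ⊆ τ × τ₂ ⊆ τ × τ₃ ⊆ τ
          × Applicable (τ₁ ++ τ₂ ++ τ₃) σ
          × run (τ₁ ++ τ₂ ++ τ₃) σ ≡ run τ σ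
          × repr ≡ srep lin enum σ τ₁
                   ++ srep lin enum (run τ₁ σ) τ₂
                   ++ srep lin enum (run (τ₁ ++ τ₂) σ) τ₃)
theorem6p3 TA noUpdate simple lin enum σ _ τ steady conv app (⋀κ≡0 Locs) inv =
  Assembly.theorem-⋀ noUpdate simple lin enum Locs steady conv app inv
theorem6p3 TA noUpdate simple lin enum σ _ τ steady conv app (⋁κ≢0 Locs) inv
  with counts-surjective (Config.κ σ)
... | N , s , counts≡κ = Disjunction.theorem-⋁ noUpdate simple lin enum Locs {s = s} steady conv app (sym counts≡κ)
  (subst (Invariants.Along _ τ) (sym counts≡κ) (Invariants.Along⁺ (⋁κ≢0 Locs) τ inv))
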